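{- Let $R = l\Rightarrow r$ be a CRS rule (following Barendregt's variable convention) and let $u$ be a CRS term. If $u\Rightarrow_R v$, then $\vdash u \to^{c}_{\mathcal{R}\cup\sigma} \cdots \to^{c}_{\mathcal{R}\cup\sigma} v$ in one or more closed nominal rewriting steps, where $\mathcal{R}=\mathcal{C}^{\mathcal{R}}(l,r)$ and $\sigma$ denotes the explicit substitution rules; here CRS terms are regarded as ground nominal terms.
   Context: CRSs: fix function symbols with arities, a countably infinite set of variables (identified with nominal atoms) and meta-variables $Z$ with arities. Meta-terms: $a\mid Z(t_1,\dots,t_n)\mid [a]t\mid f\,t\mid (t_1,\dots,t_n)$, modulo renaming of bound variables; terms contain no meta-variables; a CRS term is also a ground nominal term. A CRS rule $l\Rightarrow r$: $l,r$ closed, $l=f(s_1,\dots,s_n)$, meta-variables of $r$ occur in $l$, and in $l$ each meta-variable occurs only as $Z(a_1,\dots,a_n)$ with pairwise distinct bound variables. Valuations assign substitutes $\underline{\lambda}(a_1,\dots,a_n).s$; $\sigma(Z(t_1,\dots,t_n))$ is $s$ with $a_i$ replaced capture-avoidingly by $\sigma(t_i)$. Rewrite step: $C[\sigma(l)]\Rightarrow C[\sigma(r)]$; bound variables are assumed distinct from each other and from free variables, and valuations are safe (free variables of substitutes differ from bound variables of the rule and of other substitutes). Nominal rewriting: nominal terms $a\mid \pi\cdot X\mid [a]s\mid f\,s\mid (s_1,\dots,s_n)$, freshness contexts, standard freshness and $\alpha$-equivalence judgements; $\Delta\vdash s\to_R t$ if $s=C[s']$ and a substitution $\theta$ satisfies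 $\Delta\vdash\nabla\theta$, $\Delta\vdash l\theta\approx_\alpha s'$, $\Delta\vdash C[r\theta]\approx_\alpha t$ for $R=\nabla\vdash l\to r$. Closed rewriting: $\Delta\vdash s\to^c_R t$ if $\Delta,\Delta'\vdash s\to_{R'} t$ where $R'$ is a copy of $R$ with atoms and variables renamed to fresh ones and $\Delta'=\{a\#X\mid a \text{ an atom of } R',\ X \text{ a variable of } \Delta \text{ or } s\}$. Translation $\mathcal{C}^{\mathcal{R}}$: $\Phi_l(Z)=[a_1,\dots,a_n]$ if $Z(a_1,\dots,a_n)$ is the leftmost occurrence of $Z$ in $l$; $\Phi_l(Z)_k$ is its $k$-th element. For lists of distinct variables $[a_1,\dots,a_n],[b_1,\dots,b_n]$, $\Psi([a_1,\ldots,a_n],[b_1,\dots,b_n])$ is a list of swappings denoting a permutation $\pi$ with $\pi(a_k)=b_k$ for all $k$, obtained by following the chains $\cdots\mapsto a_k\mapsto b_k\mapsto\cdots$ of the injection $a_k\mapsto b_k$, closing each chain into a cycle and decomposing each cycle $(c_1,\dots,c_m)$ as $(c_1\ c_m)\cdots(c_1\ c_2)$. $\mathit{Left}(l)=(\Delta_l,l')$: $l'$ is $l$ with the leftmost occurrence of each $Z(a_1,\ldots,a_n)$ replaced by the nominal variable $Z$ and every other occurrence $Z(b_1,\dots,b_n)$ replaced by $\Psi(\Phi_l(Z),[b_1,\dots,b_n])\cdot Z$; $\Delta_l$ contains $b\#Z$ for every occurrence of $Z$ in $l$ and every variable $b$ abstracted above that occurrence with $b\notin\Phi_l(Z)$.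 $\mathit{Right}(r)=(\Delta_r,r')$: $\Delta_r=\{a\#Z\mid a \text{ abstracted above an occurrence of } Z \text{ in } r\}$, and $r'=\langle r\rangle_l$ where $\langle\cdot\rangle_l$ is homomorphic on variables, abstractions, function applications and tuples, $\langle Z\rangle_l=Z$ for arity $0$, and $\langle Z(t_1,\dots,t_n)\rangle_l=(\pi\cdot Z)[\Phi_l(Z)_{m_1}\mapsto\langle t_{m_1}\rangle_l]\cdots[\Phi_l(Z)_{m_k}\mapsto\langle t_{m_k}\rangle_l]$, with $\pi$ the composition of the swappings $(\Phi_l(Z)_j\ \langle t_j\rangle_l)$ over the indices $j$ for which $\langle t_j\rangle_l$ is an atom, and $m_1,\dots,m_k$ the remaining indices. Here $t[a\mapsto s]$ abbreviates $\mathtt{sub}([a]t,s)$. $\mathcal{C}^{\mathcal{R}}(l,r)$ is the nominal rule $\Delta_l\cup\Delta_r\vdash l'\to r'$. Explicit substitution rules: $\vdash a[a\mapsto X]\to X$; $a\#Y\vdash Y[a\mapsto X]\to Y$; $\vdash (f\,X)[a\mapsto Y]\to f\,X[a\mapsto Y]$ for each function symbol $f$; $\vdash (X_1,\dots,X_n)[a\mapsto Y]\to (X_1[a\mapsto Y],\dots,X_n[a\mapsto Y])$; $b\#Y\vdash([b]X)[a\mapsto Y]\to[b](X[a\mapsto Y])$.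
   Formalization: In Right, an atom repeated among the arguments of one meta-variable occurrence, as in Z(b,b), gives a swapping only the first time and an explicit substitution afterwards; with swappings for every index the claim fails, e.g. f([a1][a2]Z(a1,a2)) ⇒ g([b]Z(b,b)) on f([x][y]y). -}

module Defs where

open import Data.Empty using (⊥)
open import Data.Nat using (ℕ; zero; suc; _⊔_; _≟_)
open import Data.Product using (_×_; _,_; proj₁; proj₂; ∃; ∃-syntax)
open import Data.Maybe using (Maybe; just; nothing)
open import Data.Bool using (if_then_else_)
open import Data.Fin using (toℕ)
open import Data.List as L using (List; []; _∷_; _++_)
open import Data.List.Membership.Propositional using (_∈_; _∉_)
open import Data.List.Membership.DecPropositional _≟_ using (_∈?_)
open import Data.List.Relation.Unary.All using (All)
open import Data.List.Relation.Unary.Unique.Propositional using (Unique)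
open import Data.Vec as V using (Vec; []; _∷_; toList)
open import Data.Vec.Relation.Unary.All as VAll using ()
open import Data.Vec.Relation.Binary.Pointwise.Inductive using (Pointwise)
open import Function using (_∘_)
open import Function.Definitions using (Injective)
open import Relation.Binary.Construct.Closure.Transitive using (TransClosure)
open import Relation.Binary.PropositionalEquality using (_≡_; _≢_)
open import Relation.Nullary using (¬?; does; yes; no)
open import Relation.Unary using (Pred; _∪_; ｛_｝)

------------------------------------------------------------------------
-- Atoms, meta-variables, swappings

-- The variables of CRSs and the atoms of nominal syntax are one and the same set.
Atom : Set
Atom = ℕ

-- The meta-variables of CRSs and the variables of nominal syntax are also
-- drawn from one set: the translation maps a meta-variable Z to the nominal
-- variable Z.
Var : Set
Var = ℕ

swapₐ : Atom → Atom → Atom → Atom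
swapₐ a b c = if does (c ≟ a) then b else if does (c ≟ b) then a else c

-- Greater than every element of the list.
fresh : List Atom → Atom
fresh xs = suc (L.foldr _⊔_ 0 xs)

lookupₐ : {A : Set} → List (Atom × A) → Atom → Maybe A
lookupₐ []             a = nothing
lookupₐ ((b , x) ∷ ps) a = if does (a ≟ b) then just x else lookupₐ ps a

record Signature : Set₁ where
  field
    Sym      : Set
    symArity : Sym → ℕ
    mvArity  : Var → ℕ

------------------------------------------------------------------------
-- Combinatory Reduction Systems

module CRS (S : Signature) where
  open Signature S

  -- Raw syntax over a set M of meta-variables; meta-terms use all
  -- meta-variables and terms use none.  α-equivalence is the explicit relation
  -- _≈_ below.
  data Pre (M : Set) (ar : M → ℕ) : Set where
    var  : Atom → Pre M ar
    meta : (Z : M) → Vec (Pre M ar) (ar Z) → Pre M ar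
    abs  : Atom → Pre M ar → Pre M ar
    fun  : Sym → Pre M ar → Pre M ar
    tup  : ∀ {n} → Vec (Pre M ar) n → Pre M ar

  MetaTerm : Set
  MetaTerm = Pre Var mvArity

  Term : Set
  Term = Pre ⊥ (λ ())

  module _ {M : Set} {ar : M → ℕ} where

    fv  : Pre M ar → List Atom
    fv* : ∀ {n} → Vec (Pre M ar) n → List Atom
    fv (var a)     = a ∷ []
    fv (meta Z ts) = fv* ts
    fv (abs a t)   = L.filter (λ b → ¬? (b ≟ a)) (fv t)
    fv (fun f t)   = fv t
    fv (tup ts)    = fv* ts
    fv* []       = []
    fv* (t ∷ ts) = fv t ++ fv* ts

    binders  : Pre M ar → List Atom
    binders* : ∀ {n} → Vec (Pre M ar) n → List Atom
    binders (var a)     = []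
    binders (meta Z ts) = binders* ts
    binders (abs a t)   = a ∷ binders t
    binders (fun f t)   = binders t
    binders (tup ts)    = binders* ts
    binders* []       = []
    binders* (t ∷ ts) = binders t ++ binders* ts

    swap  : Atom → Atom → Pre M ar → Pre M ar
    swap* : ∀ {n} → Atom → Atom → Vec (Pre M ar) n → Vec (Pre M ar) n
    swap a b (var c)     = var (swapₐ a b c)
    swap a b (meta Z ts) = meta Z (swap* a b ts)
    swap a b (abs c t)   = abs (swapₐ a b c) (swap a b t)
    swap a b (fun f t)   = fun f (swap a b t)
    swap a b (tup ts)    = tup (swap* a b ts)
    swap* a b []       = []
    swap* a b (t ∷ ts) = swap a b t ∷ swap* a b ts

    infix 4 _≈_
    data _≈_ : Pre M ar → Pre M ar → Set where
      var   : ∀ {a} → var a ≈ var a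
      meta  : ∀ {Z ss ts} → Pointwise _≈_ ss ts → meta Z ss ≈ meta Z ts
      abs   : ∀ {a s t} → s ≈ t → abs a s ≈ abs a t
      abs-≢ : ∀ {a b s t} → a ≢ b → a ∉ fv t → s ≈ swap a b t → abs a s ≈ abs b t
      fun   : ∀ {f s t} → s ≈ t → fun f s ≈ fun f t
      tup   : ∀ {n} {ss ts : Vec (Pre M ar) n} → Pointwise _≈_ ss ts → tup ss ≈ tup ts

  Closed : MetaTerm → Set
  Closed t = ∀ a → a ∉ fv t

  -- Capture-avoiding simultaneous substitution: a bound variable is always
  -- renamed, by extending the environment, to one that is fresh for the body
  -- and for every term in the environment.  The leftmost entry of the
  -- environment for a variable is the one used.
  Env : Set
  Env = List (Atom × Term)

  fvEnv : Env → List Atom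
  fvEnv = L.concatMap (fv ∘ proj₂)

  infixl 8 _⟪_⟫ _⟪_⟫*
  _⟪_⟫  : Term → Env → Term
  _⟪_⟫* : ∀ {n} → Vec Term n → Env → Vec Term n
  var a ⟪ ρ ⟫ with lookupₐ ρ a
  ... | just t  = t
  ... | nothing = var a
  abs a t ⟪ ρ ⟫ = let c = fresh (fv t ++ fvEnv ρ) in abs c (t ⟪ (a , var c) ∷ ρ ⟫)
  fun f t ⟪ ρ ⟫ = fun f (t ⟪ ρ ⟫)
  tup ts ⟪ ρ ⟫  = tup (ts ⟪ ρ ⟫*)
  []       ⟪ ρ ⟫* = []
  (t ∷ ts) ⟪ ρ ⟫* = t ⟪ ρ ⟫ ∷ ts ⟪ ρ ⟫*

  -- λ̲(a₁,…,aₙ).s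
  record Substitute (n : ℕ) : Set where
    constructor λ̲
    field
      params   : Vec Atom n
      body     : Term
      distinct : Unique (toList params)

  open Substitute public

  fvₛ : ∀ {n} → Substitute n → List Atom
  fvₛ s = L.filter (λ b → ¬? (b ∈? toList (params s))) (fv (body s))

  bindersₛ : ∀ {n} → Substitute n → List Atom
  bindersₛ s = toList (params s) ++ binders (body s)

  Valuation : Set
  Valuation = (Z : Var) → Substitute (mvArity Z)

  -- No renaming happens under an abstraction of the meta-term: valuations are
  -- only ever applied when they are Safe (below).
  infixl 8 _[_] _[_]*
  _[_]  : MetaTerm → Valuation → Term
  _[_]* : ∀ {n} → Vec MetaTerm n → Valuation → Vec Term n
  var a [ σ ]     = var a
  meta Z ts [ σ ] = body (σ Z) ⟪ toList (V.zip (params (σ Z)) (ts [ σ ]*)) ⟫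
  abs a t [ σ ]   = abs a (t [ σ ])
  fun f t [ σ ]   = fun f (t [ σ ])
  tup ts [ σ ]    = tup (ts [ σ ]*)
  []       [ σ ]* = []
  (t ∷ ts) [ σ ]* = t [ σ ] ∷ ts [ σ ]*

  -- An occurrence Z(t₁,…,tₙ) of a meta-variable, together with the variables
  -- abstracted above it.
  record Occurrence : Set where
    constructor occ
    field
      mv    : Var
      above : List Atom
      args  : List MetaTerm

  open Occurrence public

  -- The occurrences in a meta-term, from left to right.
  occsUnder  : List Atom → MetaTerm → List Occurrence
  occsUnder* : ∀ {n} → List Atom → Vec MetaTerm n → List Occurrence
  occsUnder bs (var a)     = []
  occsUnder bs (meta Z ts) = occ Z bs (toList ts) ∷ occsUnder* bs ts
  occsUnder bs (abs a t)   = occsUnder (a ∷ bs) t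
  occsUnder bs (fun f t)   = occsUnder bs t
  occsUnder bs (tup ts)    = occsUnder* bs ts
  occsUnder* bs []       = []
  occsUnder* bs (t ∷ ts) = occsUnder bs t ++ occsUnder* bs ts

  occs : MetaTerm → List Occurrence
  occs = occsUnder []

  metaVars : MetaTerm → List Var
  metaVars t = L.map mv (occs t)

  -- The arguments are pairwise distinct bound variables.
  Linear : Occurrence → Set
  Linear o = ∃[ bs ] args o ≡ L.map var bs × Unique bs × All (_∈ above o) bs

  record IsRule (l r : MetaTerm) : Set where
    field
      closedˡ   : Closed l
      closedʳ   : Closed r
      headed    : ∃[ f ] ∃[ ss ] l ≡ fun f (tup {n = symArity f} ss)
      metaVars⊆ : ∀ Z → Z ∈ metaVars r → Z ∈ metaVars l
      patternˡ  : All Linear (occs l)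

  -- Rules have no free variables, so Barendregt's convention for a rule says
  -- that all the abstractions in its two sides bind different variables.
  Barendregt : MetaTerm → MetaTerm → Set
  Barendregt l r = Unique (binders l ++ binders r)

  record Safe (σ : Valuation) (l r : MetaTerm) : Set where
    field
      rule   : ∀ Z → Z ∈ metaVars l → ∀ a → a ∈ fvₛ (σ Z) → a ∉ binders l ++ binders r
      others : ∀ Z Z′ → Z ∈ metaVars l → Z′ ∈ metaVars l → Z ≢ Z′ →
               ∀ a → a ∈ fvₛ (σ Z) → a ∉ bindersₛ (σ Z′)

  data Context : Set where
    □   : Context
    abs : Atom → Context → Context
    fun : Sym → Context → Context
    tup : ∀ {m n} → Vec Term m → Context → Vec Term n → Context

  plug : Context → Term → Term
  plug □             t = t
  plug (abs a C)     t = abs a (plug C t)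
  plug (fun f C)     t = fun f (plug C t)
  plug (tup ss C ts) t = tup (ss V.++ plug C t ∷ ts)

  -- u ⇒ v by the rule l ⇒ r.  Terms and rules are taken modulo renaming of
  -- bound variables; hence the renamed copy l′ ⇒ r′ of the rule, without which
  -- a safe valuation need not exist (a free variable of u may happen to be
  -- bound in l or r).
  record Rewrites (l r : MetaTerm) (u v : Term) : Set where
    field
      l′ r′      : MetaTerm
      l≈         : l ≈ l′
      r≈         : r ≈ r′
      barendregt : Barendregt l′ r′
      σ          : Valuation
      safe       : Safe σ l′ r′
      C          : Context
      u≈         : u ≈ plug C (l′ [ σ ])
      v≈         : v ≈ plug C (r′ [ σ ])

------------------------------------------------------------------------
-- Nominal terms and nominal rewriting over a set F of function symbols

-- The list (a₁ , b₁) ∷ … ∷ (aₙ , bₙ) ∷ [] is the permutation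
-- (a₁ b₁) ∘ … ∘ (aₙ bₙ), whose rightmost swapping acts first.
Perm : Set
Perm = List (Atom × Atom)

infixr 9 _·ₐ_
_·ₐ_ : Perm → Atom → Atom
π ·ₐ c = L.foldr (λ (a , b) → swapₐ a b) c π

_⁻¹ : Perm → Perm
π ⁻¹ = L.reverse π

module Nominal (F : Set) where

  data NTerm : Set where
    atom : Atom → NTerm
    susp : Perm → Var → NTerm
    abs  : Atom → NTerm → NTerm
    fun  : F → NTerm → NTerm
    tup  : ∀ {n} → Vec NTerm n → NTerm

  infixr 9 _·_ _·*_
  _·_  : Perm → NTerm → NTerm
  _·*_ : ∀ {n} → Perm → Vec NTerm n → Vec NTerm n
  π · atom a    = atom (π ·ₐ a)
  π · susp π′ X = susp (π ++ π′) X
  π · abs a t   = abs (π ·ₐ a) (π · t)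
  π · fun f t   = fun f (π · t)
  π · tup ts    = tup (π ·* ts)
  π ·* []       = []
  π ·* (t ∷ ts) = π · t ∷ π ·* ts

  Subst : Set
  Subst = Var → NTerm

  -- Instantiation of nominal variables (not capture-avoiding).
  infixl 8 _⟦_⟧ _⟦_⟧*
  _⟦_⟧  : NTerm → Subst → NTerm
  _⟦_⟧* : ∀ {n} → Vec NTerm n → Subst → Vec NTerm n
  atom a ⟦ θ ⟧   = atom a
  susp π X ⟦ θ ⟧ = π · θ X
  abs a t ⟦ θ ⟧  = abs a (t ⟦ θ ⟧)
  fun f t ⟦ θ ⟧  = fun f (t ⟦ θ ⟧)
  tup ts ⟦ θ ⟧   = tup (ts ⟦ θ ⟧*)
  []       ⟦ θ ⟧* = []
  (t ∷ ts) ⟦ θ ⟧* = t ⟦ θ ⟧ ∷ ts ⟦ θ ⟧*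

  -- (a , X) stands for the primitive constraint a # X.
  FreshCtx : Set
  FreshCtx = List (Atom × Var)

  infix 4 _⊢_#_ _⊢_≈_
  data _⊢_#_ (Δ : FreshCtx) (a : Atom) : NTerm → Set where
    atom  : ∀ {b} → a ≢ b → Δ ⊢ a # atom b
    susp  : ∀ {π X} → (π ⁻¹ ·ₐ a , X) ∈ Δ → Δ ⊢ a # susp π X
    abs-≡ : ∀ {t} → Δ ⊢ a # abs a t
    abs-≢ : ∀ {b t} → a ≢ b → Δ ⊢ a # t → Δ ⊢ a # abs b t
    fun   : ∀ {f t} → Δ ⊢ a # t → Δ ⊢ a # fun f t
    tup   : ∀ {n} {ts : Vec NTerm n} → VAll.All (Δ ⊢ a #_) ts → Δ ⊢ a # tup ts

  data _⊢_≈_ (Δ : FreshCtx) : NTerm → NTerm → Set where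
    atom  : ∀ {a} → Δ ⊢ atom a ≈ atom a
    susp  : ∀ {π π′ X} → (∀ a → π ·ₐ a ≢ π′ ·ₐ a → (a , X) ∈ Δ) → Δ ⊢ susp π X ≈ susp π′ X
    abs-≡ : ∀ {a s t} → Δ ⊢ s ≈ t → Δ ⊢ abs a s ≈ abs a t
    abs-≢ : ∀ {a b s t} → a ≢ b → Δ ⊢ a # t → Δ ⊢ s ≈ ((a , b) ∷ []) · t →
            Δ ⊢ abs a s ≈ abs b t
    fun   : ∀ {f s t} → Δ ⊢ s ≈ t → Δ ⊢ fun f s ≈ fun f t
    tup   : ∀ {n} {ss ts : Vec NTerm n} → Pointwise (Δ ⊢_≈_) ss ts → Δ ⊢ tup ss ≈ tup ts

  data NContext : Set where
    □   : NContext
    abs : Atom → NContext → NContext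
    fun : F → NContext → NContext
    tup : ∀ {m n} → Vec NTerm m → NContext → Vec NTerm n → NContext

  plugₙ : NContext → NTerm → NTerm
  plugₙ □             t = t
  plugₙ (abs a C)     t = abs a (plugₙ C t)
  plugₙ (fun f C)     t = fun f (plugₙ C t)
  plugₙ (tup ss C ts) t = tup (ss V.++ plugₙ C t ∷ ts)

  infix 3 _⊢_⟶_
  record NRule : Set where
    constructor _⊢_⟶_
    field
      ∇   : FreshCtx
      lhs : NTerm
      rhs : NTerm

  open NRule public

  record Step (Δ : FreshCtx) (R : NRule) (s t : NTerm) : Set where
    field
      C   : NContext
      s′  : NTerm
      s≡  : s ≡ plugₙ C s′
      θ   : Subst
      ∇θ  : All (λ (a , X) → Δ ⊢ a # θ X) (∇ R)
      l≈  : Δ ⊢ lhs R ⟦ θ ⟧ ≈ s′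
      r≈  : Δ ⊢ plugₙ C (rhs R ⟦ θ ⟧) ≈ t

  permAtoms : Perm → List Atom
  permAtoms = L.concatMap (λ (a , b) → a ∷ b ∷ [])

  -- All atoms: free, abstracted, and in suspended permutations.
  atoms  : NTerm → List Atom
  atoms* : ∀ {n} → Vec NTerm n → List Atom
  atoms (atom a)   = a ∷ []
  atoms (susp π X) = permAtoms π
  atoms (abs a t)  = a ∷ atoms t
  atoms (fun f t)  = atoms t
  atoms (tup ts)   = atoms* ts
  atoms* []       = []
  atoms* (t ∷ ts) = atoms t ++ atoms* ts

  vars  : NTerm → List Var
  vars* : ∀ {n} → Vec NTerm n → List Var
  vars (atom a)   = []
  vars (susp π X) = X ∷ []
  vars (abs a t)  = vars t
  vars (fun f t)  = vars t
  vars (tup ts)   = vars* ts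
  vars* []       = []
  vars* (t ∷ ts) = vars t ++ vars* ts

  ctxAtoms : FreshCtx → List Atom
  ctxAtoms = L.map proj₁

  ctxVars : FreshCtx → List Var
  ctxVars = L.map proj₂

  ruleAtoms : NRule → List Atom
  ruleAtoms R = ctxAtoms (∇ R) ++ atoms (lhs R) ++ atoms (rhs R)

  ruleVars : NRule → List Var
  ruleVars R = ctxVars (∇ R) ++ vars (lhs R) ++ vars (rhs R)

  rename  : (Atom → Atom) → (Var → Var) → NTerm → NTerm
  rename* : ∀ {n} → (Atom → Atom) → (Var → Var) → Vec NTerm n → Vec NTerm n
  rename ρ ξ (atom a)   = atom (ρ a)
  rename ρ ξ (susp π X) = susp (L.map (λ (a , b) → ρ a , ρ b) π) (ξ X)
  rename ρ ξ (abs a t)  = abs (ρ a) (rename ρ ξ t)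
  rename ρ ξ (fun f t)  = fun f (rename ρ ξ t)
  rename ρ ξ (tup ts)   = tup (rename* ρ ξ ts)
  rename* ρ ξ []       = []
  rename* ρ ξ (t ∷ ts) = rename ρ ξ t ∷ rename* ρ ξ ts

  renameRule : (Atom → Atom) → (Var → Var) → NRule → NRule
  renameRule ρ ξ (∇ ⊢ l ⟶ r) =
    L.map (λ (a , X) → ρ a , ξ X) ∇ ⊢ rename ρ ξ l ⟶ rename ρ ξ r

  -- "Fresh" means: not occurring in R, Δ, s or t.
  record ClosedStep (Δ : FreshCtx) (R : NRule) (s t : NTerm) : Set where
    field
      ρ     : Atom → Atom
      ρ-inj : Injective _≡_ _≡_ ρ
      ξ     : Var → Var
      ξ-inj : Injective _≡_ _≡_ ξ
    R′ : NRule
    R′ = renameRule ρ ξ R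
    Δ′ : FreshCtx
    Δ′ = L.cartesianProduct (ruleAtoms R′) (ctxVars Δ ++ vars s)
    field
      freshAtoms : ∀ a → a ∈ ruleAtoms R′ →
                   a ∉ ruleAtoms R ++ ctxAtoms Δ ++ atoms s ++ atoms t
      freshVars  : ∀ X → X ∈ ruleVars R′ →
                   X ∉ ruleVars R ++ ctxVars Δ ++ vars s ++ vars t
      step       : Step (Δ ++ Δ′) R′ s t

  ClosedStepIn : FreshCtx → (NRule → Set) → NTerm → NTerm → Set
  ClosedStepIn Δ 𝓡 s t = ∃[ R ] 𝓡 R × ClosedStep Δ R s t

------------------------------------------------------------------------
-- The translation

-- The maximal chain c, ps(c), ps(ps(c)), … of the injection ps from s onwards,
-- stopping before it returns to s.  The first argument is fuel; the number of
-- pairs always suffices.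
chain : ℕ → List (Atom × Atom) → (s c : Atom) → List Atom
chain zero    ps s c = c ∷ []
chain (suc k) ps s c with lookupₐ ps c
... | nothing = c ∷ []
... | just d  = if does (d ≟ s) then c ∷ [] else c ∷ chain k ps s d

-- The second argument lists the atoms of the chains found so far; the third
-- lists the candidate starting points.
chains : List (Atom × Atom) → List Atom → List Atom → List (List Atom)
chains ps seen []       = []
chains ps seen (c ∷ cs) with c ∈? seen
... | yes _ = chains ps seen cs
... | no  _ = let cyc = chain (L.length ps) ps c c in
                               cyc ∷ chains ps (cyc ++ seen) cs

-- (c₁ … cₘ) = (c₁ cₘ) ⋯ (c₁ c₂)
cyclePerm : List Atom → Perm
cyclePerm []       = []
cyclePerm (c ∷ cs) = L.map (c ,_) (L.reverse cs)

-- The starting points of open chains (the aₖ that are no bⱼ) come before those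
-- of chains that are already cycles.  Each chain is closed into a cycle just by
-- being read as one.
Ψ : List Atom → List Atom → Perm
Ψ as bs = L.concatMap cyclePerm
            (chains (L.zip as bs) [] (L.filter (λ a → ¬? (a ∈? bs)) as ++ as))

data NSym (Sym : Set) : Set where
  op  : Sym → NSym Sym
  sub : NSym Sym

module Translation (S : Signature) where
  open Signature S
  open CRS S public
  open Nominal (NSym Sym) public

  ⌜_⌝  : Term → NTerm
  ⌜_⌝* : ∀ {n} → Vec Term n → Vec NTerm n
  ⌜ var a ⌝   = atom a
  ⌜ abs a t ⌝ = abs a ⌜ t ⌝
  ⌜ fun f t ⌝ = fun (op f) ⌜ t ⌝
  ⌜ tup ts ⌝  = tup ⌜ ts ⌝*
  ⌜ [] ⌝*     = []
  ⌜ t ∷ ts ⌝* = ⌜ t ⌝ ∷ ⌜ ts ⌝*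

  infixl 10 _[_↦_]
  _[_↦_] : NTerm → Atom → NTerm → NTerm
  t [ a ↦ s ] = fun sub (tup (abs a t ∷ s ∷ []))

  atomic : MetaTerm → Maybe Atom
  atomic (var a) = just a
  atomic _       = nothing

  -- The atoms in the arguments of the leftmost of the given occurrences of Z.
  -- (The empty list if there is none, which never arises for the Z of a rule.)
  leftmost : List Occurrence → Var → List Atom
  leftmost []       Z = []
  leftmost (o ∷ os) Z =
    if does (mv o ≟ Z) then L.mapMaybe atomic (args o) else leftmost os Z

  Φ : MetaTerm → Var → List Atom
  Φ l = leftmost (occs l)

  -- At the leftmost occurrence of Z, and wherever the arguments are literally
  -- those of the leftmost one, Ψ yields the empty list of swappings, so that
  -- susp [] Z, i.e. Z, is what replaces the occurrence.
  leftTerm  : MetaTerm → MetaTerm → NTerm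
  leftTerm* : ∀ {n} → MetaTerm → Vec MetaTerm n → Vec NTerm n
  leftTerm l (var a)     = atom a
  leftTerm l (meta Z ts) = susp (Ψ (Φ l Z) (L.mapMaybe atomic (toList ts))) Z
  leftTerm l (abs a t)   = abs a (leftTerm l t)
  leftTerm l (fun f t)   = fun (op f) (leftTerm l t)
  leftTerm l (tup ts)    = tup (leftTerm* l ts)
  leftTerm* l []       = []
  leftTerm* l (t ∷ ts) = leftTerm l t ∷ leftTerm* l ts

  Left : MetaTerm → FreshCtx × NTerm
  Left l =
      L.concatMap (λ o → L.map (_, mv o) (L.filter (λ b → ¬? (b ∈? Φ l (mv o))) (above o)))
                  (occs l)
    , leftTerm l l

  -- Splits the pairs (Φ l Z)ⱼ , ⟨ tⱼ ⟩ into swappings, for the j where ⟨ tⱼ ⟩ is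
  -- an atom, and explicit substitutions, for the other j.  The first argument
  -- lists the atoms already used in a swapping: an atom b that is repeated, as
  -- in Z(b,b), gives a swapping only once, and an explicit substitution
  -- [a ↦ b] from then on.  Composing the swappings (a₁ b)(a₂ b) instead would
  -- not map both a₁ and a₂ to b, and the simulation would fail, e.g. for
  -- f([a₁][a₂]Z(a₁,a₂)) ⇒ g([b]Z(b,b)) on f([a₁][a₂]a₂).
  split : List Atom → List (Atom × NTerm) → Perm × List (Atom × NTerm)
  split used [] = [] , []
  split used ((a , atom b) ∷ ps) with b ∈? used
  ... | yes _ = let π , ρ = split used ps in π , (a , atom b) ∷ ρ
  ... | no  _ = let π , ρ = split (b ∷ used) ps in (a , b) ∷ π , ρ
  split used ((a , t) ∷ ps) = let π , ρ = split used ps in π , (a , t) ∷ ρ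

  metaApp : Var → List (Atom × NTerm) → NTerm
  metaApp Z ps = let π , ρ = split [] ps in
    L.foldl (λ s (a , t) → s [ a ↦ t ]) (susp π Z) ρ

  -- For arity 0 this gives ⟨ Z ⟩ = susp [] Z.
  ⟨_⟩[_]  : MetaTerm → MetaTerm → NTerm
  ⟨_⟩*[_] : ∀ {n} → Vec MetaTerm n → MetaTerm → Vec NTerm n
  ⟨ var a ⟩[ l ]     = atom a
  ⟨ meta Z ts ⟩[ l ] = metaApp Z (L.zip (Φ l Z) (toList ⟨ ts ⟩*[ l ]))
  ⟨ abs a t ⟩[ l ]   = abs a ⟨ t ⟩[ l ]
  ⟨ fun f t ⟩[ l ]   = fun (op f) ⟨ t ⟩[ l ]
  ⟨ tup ts ⟩[ l ]    = tup ⟨ ts ⟩*[ l ]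
  ⟨ [] ⟩*[ l ]     = []
  ⟨ t ∷ ts ⟩*[ l ] = ⟨ t ⟩[ l ] ∷ ⟨ ts ⟩*[ l ]

  Right : MetaTerm → MetaTerm → FreshCtx × NTerm
  Right l r =
      L.concatMap (λ o → L.map (_, mv o) (above o)) (occs r)
    , ⟨ r ⟩[ l ]

  𝓒ᴿ : MetaTerm → MetaTerm → NRule
  𝓒ᴿ l r = let Δₗ , l′ = Left l
               Δᵣ , r′ = Right l r
           in (Δₗ ++ Δᵣ) ⊢ l′ ⟶ r′

  -- Closed rewriting renames atoms and variables, so their names in the
  -- following rules are immaterial.
  module _ where
    private
      a b : Atom
      a = 0
      b = 1

      Y : Var
      Y = 0

      X : ℕ → Var
      X = suc

      ⟪_⟫ᵥ : Var → NTerm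
      ⟪ Z ⟫ᵥ = susp [] Z

    data ExplicitSubst : NRule → Set where
      σ-var : ExplicitSubst
        ([] ⊢ atom a [ a ↦ ⟪ X 0 ⟫ᵥ ] ⟶ ⟪ X 0 ⟫ᵥ)
      σ-ε   : ExplicitSubst
        ((a , Y) ∷ [] ⊢ ⟪ Y ⟫ᵥ [ a ↦ ⟪ X 0 ⟫ᵥ ] ⟶ ⟪ Y ⟫ᵥ)
      σ-fun : (f : Sym) → ExplicitSubst
        ([] ⊢ fun (op f) ⟪ X 0 ⟫ᵥ [ a ↦ ⟪ Y ⟫ᵥ ] ⟶ fun (op f) (⟪ X 0 ⟫ᵥ [ a ↦ ⟪ Y ⟫ᵥ ]))
      σ-tup : (n : ℕ) → ExplicitSubst
        ([] ⊢ tup (V.tabulate {n = n} λ i → ⟪ X (toℕ i) ⟫ᵥ) [ a ↦ ⟪ Y ⟫ᵥ ]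
            ⟶ tup (V.tabulate {n = n} λ i → ⟪ X (toℕ i) ⟫ᵥ [ a ↦ ⟪ Y ⟫ᵥ ]))
      σ-abs : ExplicitSubst
        ((b , Y) ∷ [] ⊢ abs b ⟪ X 0 ⟫ᵥ [ a ↦ ⟪ Y ⟫ᵥ ] ⟶ abs b (⟪ X 0 ⟫ᵥ [ a ↦ ⟪ Y ⟫ᵥ ]))

  -- Δ ⊢ s →ᶜ ⋯ →ᶜ t in one or more closed steps with rules in 𝓡.
  infix 4 _⊢_─[_]→ᶜ⁺_
  _⊢_─[_]→ᶜ⁺_ : FreshCtx → NTerm → (NRule → Set) → NTerm → Set
  Δ ⊢ s ─[ 𝓡 ]→ᶜ⁺ t = TransClosure (ClosedStepIn Δ 𝓡) s t

{-# OPTIONS --safe #-}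
module Submission where

-- Terms are compared through their values as de Bruijn terms under an environment: α-equivalent
-- terms have equal values, and ground nominal terms with equal values under an injective renaming
-- are α-equivalent. A meta-term has a value as well, given a valuation, and this value is invariant
-- under renaming the bound variables of the rule.
--
-- The rule step. The redex is matched by letting a nominal variable Z stand for the body of σ(Z)
-- with its parameters renamed to Φ(Z): the permutation Ψ(Φ(Z), bs) then turns it into the body
-- with the parameters renamed to bs, which is the instance of Z(bs). The binders of the given term
-- above the redex differ from those of C[σ(l)], so the free variables of σ(Z) are renamed too.
--
-- The substitution steps. Reducing innermost explicit substitutions first only involves
-- substitutions of pure terms into pure terms. In the instance of ⟨Z(t₁,…,tₙ)⟩ their sequential
-- execution agrees with the simultaneous substitution, because no value of a tⱼ contains an atom of
-- Φ(Z): its free atoms are bound in r or come from the valuation.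

open import Defs
open import Data.Bool using (Bool; true; false; if_then_else_)
open import Data.Empty using (⊥; ⊥-elim)
open import Data.Fin using (Fin; toℕ; zero; suc)
open import Data.List as L using (List; []; _∷_; _++_; length)
open import Data.List.Membership.Propositional using (_∈_; _∉_)
open import Data.List.Membership.Propositional.Properties
  using (∈-++⁺ˡ; ∈-++⁺ʳ; ∈-++⁻; ∈-filter⁺; ∈-filter⁻; ∈-∃++; ∈-map⁻; ∈-map⁺; ∈-concat⁺′)
open import Data.List.Properties
  using (∷-injective; map-++; map-∘; map-cong; map-cong-local; foldr-++; unfold-reverse; length-++; length-map)
open import Data.List.Relation.Unary.All as All using (All; []; _∷_)
import Data.List.Relation.Unary.All.Properties as AllP
open import Data.List.Relation.Unary.AllPairs using ([]; _∷_)
open import Data.List.Relation.Unary.Any using (here; there)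
open import Data.List.Relation.Unary.Unique.Propositional using (Unique)
open import Data.List.Relation.Unary.Unique.Propositional.Properties using (filter⁺)
open import Data.Maybe as M using (Maybe; just; nothing; fromMaybe)
open import Data.Maybe.Properties using (just-injective)
open import Data.Nat using (ℕ; zero; suc; _+_; _∸_; _≟_; _≤_; _<_; z≤n; s≤s; s≤s⁻¹; _⊔_)
open import Data.List.Membership.DecPropositional _≟_ using (_∈?_)
open import Data.Nat.Properties
  using (≤-trans; ≤-refl; ≤-reflexive; <-irrefl; <-≤-trans; m≤m+n; m≤m⊔n; m≤n⊔m; m+n∸m≡n;
         +-cancelˡ-≡; +-suc; +-identityʳ; suc-injective)
open import Data.Product using (Σ-syntax; _×_; _,_; proj₁; proj₂; ∃-syntax)
open import Data.Sum using (_⊎_; inj₁; inj₂)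
open import Data.Unit using (⊤; tt)
open import Data.Vec as V using (Vec; []; _∷_; toList)
open import Data.Vec.Properties using (length-toList)
open import Data.Vec.Relation.Binary.Pointwise.Inductive using (Pointwise; []; _∷_)
open import Data.Vec.Relation.Unary.All as VAll using ([]; _∷_)
open import Function using (_∘_; id)
open import Relation.Binary.Construct.Closure.Transitive as Plus using (TransClosure; _∷_; _∷ʳ_)
open import Relation.Binary.PropositionalEquality hiding ([_])
open import Relation.Nullary using (¬_; ¬?; does; yes; no)
open import Relation.Nullary.Decidable using (dec-true; dec-false)
open import Relation.Unary using (_∪_; ｛_｝)

-- A nominal step starts literally from the given term but may end in any α-variant. Hence `u`,
-- which is only α-equivalent to `C[σ(l)]`, cannot be converted beforehand: the redex is located
-- inside `u` itself, and every later α-conversion is absorbed by the step before it.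
--
-- Values are used because several namings of bound atoms meet in one step: those of `u`, of the
-- renamed rule `l′ ⇒ r′` with its valuation, and of the copy that closed rewriting demands.
-- Meta-terms are evaluated in two environments: `κ` for the free variables of substitutes, which a
-- binder of the rule merely weakens, and `ρ` for the atoms of the rule. Capture is thus excluded by
-- construction, and this is why the value survives a renaming of the rule's binders.
--
-- The symbol `sub` has two readings. For `sem` it is an ordinary symbol, so that intermediate
-- reducts can be compared up to α-equivalence; `vsem` carries the substitution out. The readings
-- are joined by `evaluate`, which reduces until no `sub` is left.

private variable
  A B U V W : Set

-- Updates of environments, and swappings

opaque
  -- Opaque, so that goals show `upd` folded and a `with` on `x ≟ a` does not reach inside it;
  -- outside this block it is known through its lemmas only.
  upd : Atom → A → (Atom → A) → Atom → A
  upd a d ρ x = if does (x ≟ a) then d else ρ x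

  upd-hit : ∀ a (d : A) ρ → upd a d ρ a ≡ d
  upd-hit a d ρ rewrite dec-true (a ≟ a) refl = refl

  upd-miss : ∀ a (d : A) ρ {x} → x ≢ a → upd a d ρ x ≡ ρ x
  upd-miss a d ρ {x} x≢a rewrite dec-false (x ≟ a) x≢a = refl

  upd-cong : ∀ {a} {d e : A} {ρ η : Atom → A} → d ≡ e → ρ ≗ η → upd a d ρ ≗ upd a e η
  upd-cong {a = a} d≡e ρ≗η x with does (x ≟ a)
  ... | true  = d≡e
  ... | false = ρ≗η x

  ∘-upd : (f : A → B) (a : Atom) (d : A) (ρ : Atom → A) → f ∘ upd a d ρ ≗ upd a (f d) (f ∘ ρ)
  ∘-upd f a d ρ x with does (x ≟ a)
  ... | true  = refl
  ... | false = refl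

upd-∘ : (f : Atom → Atom) (a : Atom) (d : A) (ρ : Atom → A) →
        (∀ {x y} → f x ≡ f y → x ≡ y) → upd (f a) d ρ ∘ f ≗ upd a d (ρ ∘ f)
upd-∘ f a d ρ inj x with x ≟ a
... | yes refl = trans (upd-hit (f a) d ρ) (sym (upd-hit a d (ρ ∘ f)))
... | no x≢a   = trans (upd-miss (f a) d ρ (x≢a ∘ inj)) (sym (upd-miss a d (ρ ∘ f) x≢a))

swap-left : ∀ a b → swapₐ a b a ≡ b
swap-left a b rewrite dec-true (a ≟ a) refl = refl

swap-right : ∀ a b → swapₐ a b b ≡ a
swap-right a b with b ≟ a
... | yes refl = swap-left a b
... | no b≢a rewrite dec-false (b ≟ a) b≢a | dec-true (b ≟ b) refl = refl

swap-other : ∀ {a b c} → c ≢ a → c ≢ b → swapₐ a b c ≡ c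
swap-other {a} {b} {c} c≢a c≢b rewrite dec-false (c ≟ a) c≢a | dec-false (c ≟ b) c≢b = refl

swap-invol : ∀ a b c → swapₐ a b (swapₐ a b c) ≡ c
swap-invol a b c with c ≟ a | c ≟ b
... | yes refl | _        = trans (cong (swapₐ c b) (swap-left c b)) (swap-right c b)
... | no _     | yes refl = trans (cong (swapₐ a c) (swap-right a c)) (swap-left a c)
... | no c≢a   | no c≢b   = trans (cong (swapₐ a b) (swap-other c≢a c≢b)) (swap-other c≢a c≢b)

swap-injective : ∀ a b {x y} → swapₐ a b x ≡ swapₐ a b y → x ≡ y
swap-injective a b {x} {y} e =
  trans (sym (swap-invol a b x)) (trans (cong (swapₐ a b) e) (swap-invol a b y))

·ₐ-injective : ∀ π {x y} → π ·ₐ x ≡ π ·ₐ y → x ≡ y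
·ₐ-injective []            e = e
·ₐ-injective ((a , b) ∷ π) e = ·ₐ-injective π (swap-injective a b e)

-- De Bruijn terms

-- Tuples are lists, so that tuples of different arities have values in one type; equal values then
-- force equal lengths.
data DB (F : Set) (V : Set) : Set where
  var : V → DB F V
  lam : DB F (Maybe V) → DB F V
  fun : F → DB F V → DB F V
  tup : List (DB F V) → DB F V

module _ {F : Set} where
  mapᴰ  : (V → W) → DB F V → DB F W
  mapᴰ* : (V → W) → List (DB F V) → List (DB F W)
  mapᴰ f (var x)   = var (f x)
  mapᴰ f (lam d)   = lam (mapᴰ (M.map f) d)
  mapᴰ f (fun g d) = fun g (mapᴰ f d)
  mapᴰ f (tup ds)  = tup (mapᴰ* f ds)
  mapᴰ* f []       = []
  mapᴰ* f (d ∷ ds) = mapᴰ f d ∷ mapᴰ* f ds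

  mapᴰ-∘  : (f : V → W) (g : W → U) (h : V → U) → g ∘ f ≗ h → ∀ d → mapᴰ g (mapᴰ f d) ≡ mapᴰ h d
  mapᴰ*-∘ : (f : V → W) (g : W → U) (h : V → U) → g ∘ f ≗ h → ∀ ds → mapᴰ* g (mapᴰ* f ds) ≡ mapᴰ* h ds
  mapᴰ-∘ f g h e (var x)   = cong var (e x)
  mapᴰ-∘ f g h e (lam d)   =
    cong lam (mapᴰ-∘ (M.map f) (M.map g) (M.map h) (λ { nothing → refl ; (just x) → cong just (e x) }) d)
  mapᴰ-∘ f g h e (fun k d) = cong (fun k) (mapᴰ-∘ f g h e d)
  mapᴰ-∘ f g h e (tup ds)  = cong tup (mapᴰ*-∘ f g h e ds)
  mapᴰ*-∘ f g h e []       = refl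
  mapᴰ*-∘ f g h e (d ∷ ds) = cong₂ _∷_ (mapᴰ-∘ f g h e d) (mapᴰ*-∘ f g h e ds)

  wk : DB F V → DB F (Maybe V)
  wk = mapᴰ just

  mapᴰ-wk : (f : V → W) (d : DB F V) → mapᴰ (M.map f) (wk d) ≡ wk (mapᴰ f d)
  mapᴰ-wk f d = trans (mapᴰ-∘ just (M.map f) (just ∘ f) (λ _ → refl) d)
                      (sym (mapᴰ-∘ f just (just ∘ f) (λ _ → refl) d))

  ext : Atom → (Atom → DB F V) → Atom → DB F (Maybe V)
  ext a ρ = upd a (var nothing) (wk ∘ ρ)

  ext-cong : ∀ {a} {ρ η : Atom → DB F V} → ρ ≗ η → ext a ρ ≗ ext a η
  ext-cong ρ≗η = upd-cong refl (cong wk ∘ ρ≗η)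

  mapᴰ-ext : (f : V → W) (a : Atom) (ρ : Atom → DB F V) → mapᴰ (M.map f) ∘ ext a ρ ≗ ext a (mapᴰ f ∘ ρ)
  mapᴰ-ext f a ρ x = trans (∘-upd (mapᴰ (M.map f)) a _ _ x) (upd-cong refl (mapᴰ-wk f ∘ ρ) x)

  var-injective : ∀ {x y : V} → var {F} x ≡ var y → x ≡ y
  var-injective refl = refl

  lam-injective : ∀ {d e : DB F (Maybe V)} → lam d ≡ lam e → d ≡ e
  lam-injective refl = refl

  fun-injective : ∀ {f g} {d e : DB F V} → fun f d ≡ fun g e → f ≡ g × d ≡ e
  fun-injective refl = refl , refl

  tup-injective : ∀ {ds es : List (DB F V)} → tup ds ≡ tup es → ds ≡ es
  tup-injective refl = refl

  IsRen : (Atom → DB F V) → Set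
  IsRen η = ∀ x → ∃[ v ] η x ≡ var v

  Inj : (Atom → DB F V) → Set
  Inj η = ∀ x y → η x ≡ η y → x ≡ y

  wk-injective-var : ∀ {d e : DB F V} {v w} → d ≡ var v → e ≡ var w → wk d ≡ wk e → d ≡ e
  wk-injective-var refl refl refl = refl

  nothing≢wk : ∀ {d : DB F V} {v} → d ≡ var v → var nothing ≢ wk d
  nothing≢wk refl ()

  IsRen-ext : ∀ a {η : Atom → DB F V} → IsRen η → IsRen (ext a η)
  IsRen-ext a {η} r x with x ≟ a
  ... | yes refl = nothing , upd-hit x _ _
  ... | no x≢a with r x
  ... | v , e = just v , trans (upd-miss a _ _ x≢a) (cong wk e)

  Inj-ext : ∀ a {η : Atom → DB F V} → IsRen η → Inj η → Inj (ext a η)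
  Inj-ext a {η} r inj x y e with x ≟ a | y ≟ a
  ... | yes refl | yes refl = refl
  ... | yes refl | no y≢a   = ⊥-elim (nothing≢wk (proj₂ (r y))
          (trans (sym (upd-hit a _ _)) (trans e (upd-miss a _ _ y≢a))))
  ... | no x≢a   | yes refl = ⊥-elim (nothing≢wk (proj₂ (r x))
          (trans (sym (upd-hit a _ _)) (trans (sym e) (upd-miss a _ _ x≢a))))
  ... | no x≢a   | no y≢a   = inj x y (wk-injective-var (proj₂ (r x)) (proj₂ (r y))
          (trans (sym (upd-miss a _ _ x≢a)) (trans e (upd-miss a _ _ y≢a))))

-- Values of nominal terms, and how they determine freshness and α-equivalence

module Semantics (F : Set) where
  open Nominal F

  -- Atoms are mapped to arbitrary de Bruijn terms, so that a substitution is a change of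
  -- environment just as a renaming is.
  Envᴰ : Set → Set
  Envᴰ V = Atom → DB F V

  sem  : NTerm → Envᴰ V → DB F V
  sem* : ∀ {n} → Vec NTerm n → Envᴰ V → List (DB F V)
  -- Only meant for ground terms: the value of a suspension is junk.
  sem (atom a)   ρ = ρ a
  sem (susp π X) ρ = tup []
  sem (abs a t)  ρ = lam (sem t (ext a ρ))
  sem (fun f t)  ρ = fun f (sem t ρ)
  sem (tup ts)   ρ = tup (sem* ts ρ)
  sem* []       ρ = []
  sem* (t ∷ ts) ρ = sem t ρ ∷ sem* ts ρ

  sem*-++ : ∀ {m n} (ss : Vec NTerm m) (ts : Vec NTerm n) (ρ : Envᴰ V) →
            sem* (ss V.++ ts) ρ ≡ sem* ss ρ ++ sem* ts ρ
  sem*-++ []       ts ρ = refl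
  sem*-++ (s ∷ ss) ts ρ = cong (sem s ρ ∷_) (sem*-++ ss ts ρ)

  sem-cong  : ∀ t {ρ η : Envᴰ V} → ρ ≗ η → sem t ρ ≡ sem t η
  sem*-cong : ∀ {n} (ts : Vec NTerm n) {ρ η : Envᴰ V} → ρ ≗ η → sem* ts ρ ≡ sem* ts η
  sem-cong (atom a)   e = e a
  sem-cong (susp π X) e = refl
  sem-cong (abs a t)  e = cong lam (sem-cong t (ext-cong e))
  sem-cong (fun f t)  e = cong (fun f) (sem-cong t e)
  sem-cong (tup ts)   e = cong tup (sem*-cong ts e)
  sem*-cong []       e = refl
  sem*-cong (t ∷ ts) e = cong₂ _∷_ (sem-cong t e) (sem*-cong ts e)

  sem-mapᴰ  : ∀ t (f : V → W) (ρ : Envᴰ V) → sem t (mapᴰ f ∘ ρ) ≡ mapᴰ f (sem t ρ)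
  sem*-mapᴰ : ∀ {n} (ts : Vec NTerm n) (f : V → W) (ρ : Envᴰ V) → sem* ts (mapᴰ f ∘ ρ) ≡ mapᴰ* f (sem* ts ρ)
  sem-mapᴰ (atom a)   f ρ = refl
  sem-mapᴰ (susp π X) f ρ = refl
  sem-mapᴰ (abs a t)  f ρ =
    cong lam (trans (sem-cong t (sym ∘ mapᴰ-ext f a ρ)) (sem-mapᴰ t (M.map f) (ext a ρ)))
  sem-mapᴰ (fun g t)  f ρ = cong (fun g) (sem-mapᴰ t f ρ)
  sem-mapᴰ (tup ts)   f ρ = cong tup (sem*-mapᴰ ts f ρ)
  sem*-mapᴰ []       f ρ = refl
  sem*-mapᴰ (t ∷ ts) f ρ = cong₂ _∷_ (sem-mapᴰ t f ρ) (sem*-mapᴰ ts f ρ)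

  sem-·  : ∀ π t (ρ : Envᴰ V) → sem (π · t) ρ ≡ sem t (ρ ∘ (π ·ₐ_))
  sem*-· : ∀ {n} π (ts : Vec NTerm n) (ρ : Envᴰ V) → sem* (π ·* ts) ρ ≡ sem* ts (ρ ∘ (π ·ₐ_))
  sem-· π (atom a)   ρ = refl
  sem-· π (susp _ X) ρ = refl
  sem-· π (abs a t)  ρ = cong lam (trans (sem-· π t (ext (π ·ₐ a) ρ))
    (sem-cong t (upd-∘ (π ·ₐ_) a (var nothing) (wk ∘ ρ) (·ₐ-injective π))))
  sem-· π (fun f t)  ρ = cong (fun f) (sem-· π t ρ)
  sem-· π (tup ts)   ρ = cong tup (sem*-· π ts ρ)
  sem*-· π []       ρ = refl
  sem*-· π (t ∷ ts) ρ = cong₂ _∷_ (sem-· π t ρ) (sem*-· π ts ρ)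

  -- Freshness judgements stand in for a list of free atoms: they are what `fresh-by-sem` delivers
  -- and what α-equivalence asks for.
  Agree : NTerm → Envᴰ V → Envᴰ V → Set
  Agree t ρ η = ∀ a → [] ⊢ a # t ⊎ ρ a ≡ η a

  Agree-abs : ∀ {a t} {ρ η : Envᴰ V} → Agree (abs a t) ρ η → Agree t (ext a ρ) (ext a η)
  Agree-abs {a = a} ag x with x ≟ a
  ... | yes refl = inj₂ (trans (upd-hit x _ _) (sym (upd-hit x _ _)))
  ... | no x≢a with ag x
  ... | inj₁ abs-≡       = ⊥-elim (x≢a refl)
  ... | inj₁ (abs-≢ _ p) = inj₁ p
  ... | inj₂ e = inj₂ (trans (upd-miss a _ _ x≢a) (trans (cong wk e) (sym (upd-miss a _ _ x≢a))))

  Agree-fun : ∀ {f t} {ρ η : Envᴰ V} → Agree (fun f t) ρ η → Agree t ρ η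
  Agree-fun ag x with ag x
  ... | inj₁ (fun p) = inj₁ p
  ... | inj₂ e = inj₂ e

  Agree* : ∀ {n} → Vec NTerm n → Envᴰ V → Envᴰ V → Set
  Agree* ts ρ η = ∀ a → VAll.All ([] ⊢ a #_) ts ⊎ ρ a ≡ η a

  Agree-tup : ∀ {n} {ts : Vec NTerm n} {ρ η : Envᴰ V} → Agree (tup ts) ρ η → Agree* ts ρ η
  Agree-tup ag x with ag x
  ... | inj₁ (tup p) = inj₁ p
  ... | inj₂ e = inj₂ e

  Agree-head : ∀ {n t} {ts : Vec NTerm n} {ρ η : Envᴰ V} → Agree* (t ∷ ts) ρ η → Agree t ρ η
  Agree-head ag x with ag x
  ... | inj₁ (p ∷ _) = inj₁ p
  ... | inj₂ e = inj₂ e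

  Agree-tail : ∀ {n t} {ts : Vec NTerm n} {ρ η : Envᴰ V} → Agree* (t ∷ ts) ρ η → Agree* ts ρ η
  Agree-tail ag x with ag x
  ... | inj₁ (_ ∷ p) = inj₁ p
  ... | inj₂ e = inj₂ e

  sem-agree  : ∀ t {ρ η : Envᴰ V} → Agree t ρ η → sem t ρ ≡ sem t η
  sem*-agree : ∀ {n} (ts : Vec NTerm n) {ρ η : Envᴰ V} → Agree* ts ρ η → sem* ts ρ ≡ sem* ts η
  sem-agree (atom a)   ag with ag a
  ... | inj₁ (atom a≢a) = ⊥-elim (a≢a refl)
  ... | inj₂ e = e
  sem-agree (susp π X) ag = refl
  sem-agree (abs a t)  ag = cong lam (sem-agree t (Agree-abs ag))
  sem-agree (fun f t)  ag = cong (fun f) (sem-agree t (Agree-fun ag))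
  sem-agree (tup ts)   ag = cong tup (sem*-agree ts (Agree-tup ag))
  sem*-agree []       ag = refl
  sem*-agree (t ∷ ts) ag = cong₂ _∷_ (sem-agree t (Agree-head ag)) (sem*-agree ts (Agree-tail ag))

  Ground  : NTerm → Set
  Ground* : ∀ {n} → Vec NTerm n → Set
  Ground (atom a)   = ⊤
  Ground (susp π X) = ⊥
  Ground (abs a t)  = Ground t
  Ground (fun f t)  = Ground t
  Ground (tup ts)   = Ground* ts
  Ground* []       = ⊤
  Ground* (t ∷ ts) = Ground t × Ground* ts

  Ground-·  : ∀ π t → Ground t → Ground (π · t)
  Ground*-· : ∀ {n} π (ts : Vec NTerm n) → Ground* ts → Ground* (π ·* ts)
  Ground-· π (atom a)   g = tt
  Ground-· π (abs a t)  g = Ground-· π t g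
  Ground-· π (fun f t)  g = Ground-· π t g
  Ground-· π (tup ts)   g = Ground*-· π ts g
  Ground*-· π []       g = tt
  Ground*-· π (t ∷ ts) (g , gs) = Ground-· π t g , Ground*-· π ts gs

  Ground-⟦⟧  : ∀ t {θ} → (∀ X → Ground (θ X)) → Ground (t ⟦ θ ⟧)
  Ground*-⟦⟧ : ∀ {n} (ts : Vec NTerm n) {θ} → (∀ X → Ground (θ X)) → Ground* (ts ⟦ θ ⟧*)
  Ground-⟦⟧ (atom a)   g = tt
  Ground-⟦⟧ (susp π X) {θ} g = Ground-· π (θ X) (g X)
  Ground-⟦⟧ (abs a t)  g = Ground-⟦⟧ t g
  Ground-⟦⟧ (fun f t)  g = Ground-⟦⟧ t g
  Ground-⟦⟧ (tup ts)   g = Ground*-⟦⟧ ts g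
  Ground*-⟦⟧ []       g = tt
  Ground*-⟦⟧ (t ∷ ts) g = Ground-⟦⟧ t g , Ground*-⟦⟧ ts g

  Ground*-++⁺ : ∀ {m n} (ss : Vec NTerm m) {ts : Vec NTerm n} → Ground* ss → Ground* ts → Ground* (ss V.++ ts)
  Ground*-++⁺ []       _        h = h
  Ground*-++⁺ (s ∷ ss) (g , gs) h = g , Ground*-++⁺ ss gs h

  Ground*-++⁻ : ∀ {m n} (ss : Vec NTerm m) {ts : Vec NTerm n} → Ground* (ss V.++ ts) → Ground* ss × Ground* ts
  Ground*-++⁻ []       g = tt , g
  Ground*-++⁻ (s ∷ ss) (g , gs) = let h , k = Ground*-++⁻ ss gs in (g , h) , k

  Groundᶜ : NContext → Set
  Groundᶜ □             = ⊤
  Groundᶜ (abs a C)     = Groundᶜ C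
  Groundᶜ (fun f C)     = Groundᶜ C
  Groundᶜ (tup ss C ts) = Ground* ss × Groundᶜ C × Ground* ts

  Ground-plug⁺ : ∀ C {t} → Groundᶜ C → Ground t → Ground (plugₙ C t)
  Ground-plug⁺ □             g h = h
  Ground-plug⁺ (abs a C)     g h = Ground-plug⁺ C g h
  Ground-plug⁺ (fun f C)     g h = Ground-plug⁺ C g h
  Ground-plug⁺ (tup ss C ts) (gs , g , gt) h = Ground*-++⁺ ss gs (Ground-plug⁺ C g h , gt)

  Ground-plug⁻ : ∀ C {t} → Ground (plugₙ C t) → Groundᶜ C × Ground t
  Ground-plug⁻ □             g = tt , g
  Ground-plug⁻ (abs a C)     g = Ground-plug⁻ C g
  Ground-plug⁻ (fun f C)     g = Ground-plug⁻ C g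
  Ground-plug⁻ (tup ss C ts) g with Ground*-++⁻ ss g
  ... | gs , h , gt = let k , j = Ground-plug⁻ C h in (gs , k , gt) , j

  sem-plug : ∀ C {s t} → (∀ {V} (ρ : Envᴰ V) → sem s ρ ≡ sem t ρ) →
             (ρ : Envᴰ V) → sem (plugₙ C s) ρ ≡ sem (plugₙ C t) ρ
  sem-plug □             e ρ = e ρ
  sem-plug (abs a C)     e ρ = cong lam (sem-plug C e _)
  sem-plug (fun f C)     e ρ = cong (fun f) (sem-plug C e ρ)
  sem-plug (tup ss C ts) e ρ = cong tup (trans (sem*-++ ss _ ρ)
    (trans (cong (λ d → sem* ss ρ ++ d ∷ sem* ts ρ) (sem-plug C e ρ)) (sym (sem*-++ ss _ ρ))))

  -- A free occurrence of `a` would put the variable `ρ a` into the value of `t`, but all free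
  -- variables in the value of `s` come from the range of `η`. The recursion runs through both terms
  -- in parallel, which avoids defining free variables of de Bruijn terms.
  fresh-by-sem  : ∀ {Δ} t s {a} {ρ η : Envᴰ V} → Ground t → IsRen ρ → IsRen η →
                  (∀ x → ρ a ≢ η x) → sem t ρ ≡ sem s η → Δ ⊢ a # t
  fresh-by-sem* : ∀ {Δ m n} (ts : Vec NTerm m) (ss : Vec NTerm n) {a} {ρ η : Envᴰ V} →
                  Ground* ts → IsRen ρ → IsRen η →
                  (∀ x → ρ a ≢ η x) → sem* ts ρ ≡ sem* ss η → VAll.All (Δ ⊢ a #_) ts
  fresh-by-sem (atom b) (atom c) g r r′ h e = atom λ { refl → h c e }
  fresh-by-sem (atom b) (susp _ _) g r r′ h e with () ← trans (sym (proj₂ (r b))) e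
  fresh-by-sem (atom b) (abs _ _) g r r′ h e with () ← trans (sym (proj₂ (r b))) e
  fresh-by-sem (atom b) (fun _ _) g r r′ h e with () ← trans (sym (proj₂ (r b))) e
  fresh-by-sem (atom b) (tup _) g r r′ h e with () ← trans (sym (proj₂ (r b))) e
  fresh-by-sem (abs b t) (atom c) g r r′ h e with () ← trans (sym (proj₂ (r′ c))) (sym e)
  fresh-by-sem (fun f t) (atom c) g r r′ h e with () ← trans (sym (proj₂ (r′ c))) (sym e)
  fresh-by-sem (tup ts) (atom c) g r r′ h e with () ← trans (sym (proj₂ (r′ c))) (sym e)
  -- The junk value of a suspension is that of the empty tuple, so the comparison continues with an
  -- empty vector.
  fresh-by-sem (tup ts) (susp _ _) g r r′ h e = tup (fresh-by-sem* ts [] g r r′ h (tup-injective e))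
  fresh-by-sem (tup ts) (tup ss) g r r′ h e = tup (fresh-by-sem* ts ss g r r′ h (tup-injective e))
  fresh-by-sem (fun f t) (fun _ s) g r r′ h e = fun (fresh-by-sem t s g r r′ h (proj₂ (fun-injective e)))
  fresh-by-sem (abs b t) (abs c s) {a} {ρ} {η} g r r′ h e with a ≟ b
  ... | yes refl = abs-≡
  ... | no a≢b = abs-≢ a≢b (fresh-by-sem t s g (IsRen-ext b r) (IsRen-ext c r′) h′ (lam-injective e))
    where
    h′ : ∀ x → ext b ρ a ≢ ext c η x
    h′ x e′ with x ≟ c
    ... | yes refl = nothing≢wk (proj₂ (r a))
            (trans (sym (upd-hit x _ _)) (trans (sym e′) (upd-miss b _ _ a≢b)))
    ... | no x≢c = h x (wk-injective-var (proj₂ (r a)) (proj₂ (r′ x))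
            (trans (sym (upd-miss b _ _ a≢b)) (trans e′ (upd-miss c _ _ x≢c))))
  fresh-by-sem* [] ss g r r′ h e = []
  fresh-by-sem* (t ∷ ts) (s ∷ ss) (g , gs) r r′ h e =
    fresh-by-sem t s g r r′ h (proj₁ (∷-injective e)) ∷
    fresh-by-sem* ts ss gs r r′ h (proj₂ (∷-injective e))

  sem*-length : ∀ {m n} (ss : Vec NTerm m) (ts : Vec NTerm n) {ρ η : Envᴰ V} → sem* ss ρ ≡ sem* ts η → m ≡ n
  sem*-length []       []       e = refl
  sem*-length (s ∷ ss) (t ∷ ts) e = cong suc (sem*-length ss ts (proj₂ (∷-injective e)))

  -- Supplies the range condition of `fresh-by-sem` once the binder `a` is entered: `a` was the only
  -- atom with its outer value, and now it has another one.
  ext-fresh : ∀ {a} {η : Envᴰ V} → IsRen η → Inj η → ∀ y → wk (η a) ≢ ext a η y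
  ext-fresh {a = a} r inj y e with y ≟ a
  ... | yes refl = nothing≢wk (proj₂ (r a)) (trans (sym (upd-hit a _ _)) (sym e))
  ... | no y≢a = y≢a (inj y a (sym (wk-injective-var (proj₂ (r a)) (proj₂ (r y)) (trans e (upd-miss a _ _ y≢a)))))

  sem-complete  : ∀ {Δ} s t {η : Envᴰ V} → Ground s → Ground t → IsRen η → Inj η →
                  sem s η ≡ sem t η → Δ ⊢ s ≈ t
  sem-complete* : ∀ {Δ n} (ss ts : Vec NTerm n) {η : Envᴰ V} → Ground* ss → Ground* ts → IsRen η → Inj η →
                  sem* ss η ≡ sem* ts η → Pointwise (Δ ⊢_≈_) ss ts
  sem-complete (atom a) (atom b) g h r inj e with refl ← inj a b e = atom
  sem-complete (atom a) (abs _ _) g h r inj e with () ← trans (sym (proj₂ (r a))) e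
  sem-complete (atom a) (fun _ _) g h r inj e with () ← trans (sym (proj₂ (r a))) e
  sem-complete (atom a) (tup _) g h r inj e with () ← trans (sym (proj₂ (r a))) e
  sem-complete (abs a s) (atom b) g h r inj e with () ← trans (sym (proj₂ (r b))) (sym e)
  sem-complete (fun f s) (atom b) g h r inj e with () ← trans (sym (proj₂ (r b))) (sym e)
  sem-complete (tup ss) (atom b) g h r inj e with () ← trans (sym (proj₂ (r b))) (sym e)
  sem-complete (fun f s) (fun f′ t) g h r inj e with refl , e′ ← fun-injective e =
    fun (sem-complete s t g h r inj e′)
  sem-complete (tup ss) (tup ts) g h r inj e with tup-injective e
  ... | e′ with refl ← sem*-length ss ts e′ = tup (sem-complete* ss ts g h r inj e′)
  sem-complete (abs a s) (abs b t) {η} g h r inj e with a ≟ b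
  ... | yes refl = abs-≡ (sem-complete s t g h (IsRen-ext a r) (Inj-ext a r inj) (lam-injective e))
  -- Both premises of `abs-≢` come from the one equation between the bodies: `a` is fresh for `t` by
  -- a range argument, and on all other atoms the swapping turns `ext b η` into `ext a η`.
  ... | no a≢b = abs-≢ a≢b (a# _) (sem-complete s (((a , b) ∷ []) · t) g (Ground-· _ t h)
                   (IsRen-ext a r) (Inj-ext a r inj) (trans (lam-injective e) swapped))
    where
    a# : ∀ Δ → Δ ⊢ a # t
    a# Δ = fresh-by-sem t s h (IsRen-ext b r) (IsRen-ext a r)
             (λ x e′ → ext-fresh r inj x (trans (sym (upd-miss b _ _ a≢b)) e′))
             (sym (lam-injective e))
    agree : Agree t (ext b η) (ext a η ∘ swapₐ a b)
    agree x with x ≟ a | x ≟ b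
    ... | yes refl | _ = inj₁ (a# [])
    ... | no x≢a | yes refl = inj₂ (trans (upd-hit x _ _)
            (sym (trans (cong (ext a η) (swap-right a x)) (upd-hit a _ _))))
    ... | no x≢a | no x≢b = inj₂ (trans (upd-miss b _ _ x≢b)
            (sym (trans (cong (ext a η) (swap-other x≢a x≢b)) (upd-miss a _ _ x≢a))))
    swapped : sem t (ext b η) ≡ sem (((a , b) ∷ []) · t) (ext a η)
    swapped = trans (sem-agree t agree) (sym (sem-· ((a , b) ∷ []) t (ext a η)))
  sem-complete* []       []       g h r inj e = []
  sem-complete* (s ∷ ss) (t ∷ ts) (g , gs) (h , hs) r inj e =
    sem-complete s t g h r inj (proj₁ (∷-injective e)) ∷
    sem-complete* ss ts gs hs r inj (proj₂ (∷-injective e))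

  -- A semantic form of "the free atoms of `t₂` are among those of `t`". It is the property of a
  -- reduct `t₂` by which a renaming justified for the redex `t` may be used for the reduct too.
  DependsOn : NTerm → NTerm → Set₁
  DependsOn t t₂ = ∀ {V} {ρ η : Envᴰ V} → Agree t ρ η → sem t₂ ρ ≡ sem t₂ η

  Agree*-++ˡ : ∀ {m n} (ss : Vec NTerm m) {ts : Vec NTerm n} {ρ η : Envᴰ V} →
               Agree* (ss V.++ ts) ρ η → Agree* ss ρ η
  Agree*-++ˡ []       ag x = inj₁ []
  Agree*-++ˡ (s ∷ ss) ag x with ag x | Agree*-++ˡ ss (Agree-tail ag) x
  ... | inj₂ e | _ = inj₂ e
  ... | inj₁ _ | inj₂ e = inj₂ e
  ... | inj₁ (p ∷ _) | inj₁ ps = inj₁ (p ∷ ps)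

  Agree*-++ʳ : ∀ {m n} (ss : Vec NTerm m) {ts : Vec NTerm n} {ρ η : Envᴰ V} →
               Agree* (ss V.++ ts) ρ η → Agree* ts ρ η
  Agree*-++ʳ []       ag = ag
  Agree*-++ʳ (s ∷ ss) ag = Agree*-++ʳ ss (Agree-tail ag)

  DependsOn-plug : ∀ C {t t₂} → DependsOn t t₂ → DependsOn (plugₙ C t) (plugₙ C t₂)
  DependsOn-plug □         dep ag = dep ag
  DependsOn-plug (abs a C) {t} {t₂} dep ag = cong lam (DependsOn-plug C {t} {t₂} dep (Agree-abs ag))
  DependsOn-plug (fun f C) {t} {t₂} dep ag = cong (fun f) (DependsOn-plug C {t} {t₂} dep (Agree-fun ag))
  DependsOn-plug (tup ss C ts) {t} {t₂} dep {ρ = ρ} {η} ag = cong tup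
    (trans (sem*-++ ss _ ρ)
    (trans (cong₂ _++_ (sem*-agree ss (Agree*-++ˡ ss ag*))
             (cong₂ _∷_ (DependsOn-plug C {t} {t₂} dep (Agree-head (Agree*-++ʳ ss ag*)))
                        (sem*-agree ts (Agree-tail (Agree*-++ʳ ss ag*)))))
    (sym (sem*-++ ss _ η))))
    where ag* = Agree-tup ag

  -- The field `us≡` equates tuples rather than vectors, since `k` and `m + suc n` are equal only
  -- propositionally.
  record Cut {k} (us : Vec NTerm k) (ρ : Envᴰ V) (xs : List (DB F V)) (d : DB F V) (ys : List (DB F V)) : Set where
    constructor cut
    field
      {m n} : ℕ
      ss : Vec NTerm m
      u  : NTerm
      ts : Vec NTerm n
      us≡ : _≡_ {A = NTerm} (tup us) (tup (ss V.++ u ∷ ts))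
      ss≡ : sem* ss ρ ≡ xs
      u≡  : sem u ρ ≡ d
      ts≡ : sem* ts ρ ≡ ys

  tup-∷ : ∀ t {m n} {ss : Vec NTerm m} {ts : Vec NTerm n} →
          _≡_ {A = NTerm} (tup ss) (tup ts) → _≡_ {A = NTerm} (tup (t ∷ ss)) (tup (t ∷ ts))
  tup-∷ t refl = refl

  sem*-split : ∀ {k} (us : Vec NTerm k) (ρ : Envᴰ V) xs {d ys} → sem* us ρ ≡ xs ++ d ∷ ys → Cut us ρ xs d ys
  sem*-split []       ρ []       ()
  sem*-split []       ρ (x ∷ xs) ()
  sem*-split (u ∷ us) ρ []       e = cut [] u us refl refl (proj₁ (∷-injective e)) (proj₂ (∷-injective e))
  sem*-split (u ∷ us) ρ (x ∷ xs) e with sem*-split us ρ xs (proj₂ (∷-injective e))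
  ... | cut ss v ts us≡ ss≡ u≡ ts≡ =
    cut (u ∷ ss) v ts (tup-∷ u us≡) (cong₂ _∷_ (proj₁ (∷-injective e)) ss≡) u≡ ts≡

  -- u is C[t] up to α-equivalence. The atoms of C[t] are renamed by f, and those of t by g, which also
  -- maps the binders above the hole in C to those in C′.
  record Decomposition {V} (C : NContext) (t u : NTerm) (f : Atom → Atom) (η : Envᴰ V) : Set₁ where
    field
      C′    : NContext
      u′    : NTerm
      u≡    : u ≡ plugₙ C′ u′
      {V′}  : Set
      η′    : Envᴰ V′
      ren   : IsRen η′
      inj   : Inj η′
      g     : Atom → Atom
      u′≡   : sem u′ η′ ≡ sem t (η′ ∘ g)
      -- Stated for all reducts, since it is applied to the right-hand side after all its explicit
      -- substitutions have been carried out.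
      plug≡ : ∀ {t₂ t₂′} → DependsOn t t₂ → sem t₂′ η′ ≡ sem t₂ (η′ ∘ g) →
              sem (plugₙ C′ t₂′) η ≡ sem (plugₙ C t₂) (η ∘ f)

  -- Equal values force `u` to have the shape of `C` along the path to the hole, so the descent
  -- through `C` finds the hole in `u`. Only the names of the binders on the way can differ, and `f`
  -- collects them.
  decompose : ∀ C t u f (η : Envᴰ V) → IsRen η → Inj η → Ground (plugₙ C t) → Ground u →
              sem u η ≡ sem (plugₙ C t) (η ∘ f) → Decomposition C t u f η
  decompose □ t u f η r inj _ _ e = record
    { C′ = □ ; u′ = u ; u≡ = refl ; η′ = η ; ren = r ; inj = inj ; g = f ; u′≡ = e ; plug≡ = λ _ e′ → e′ }
  decompose (abs b C) t (abs a u) f η r inj g h e = record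
    { C′ = abs a D.C′ ; u′ = D.u′ ; u≡ = cong (abs a) D.u≡ ; η′ = D.η′ ; ren = D.ren ; inj = D.inj
    ; g = D.g ; u′≡ = D.u′≡
    ; plug≡ = λ {t₂} {t₂′} dep e′ → cong lam (trans (D.plug≡ dep e′) (sym (DependsOn-plug C {t} {t₂} dep agree))) }
    where
    f′ : Atom → Atom
    f′ = upd b a f
    agree : Agree (plugₙ C t) (ext b (η ∘ f)) (ext a η ∘ f′)
    agree x with x ≟ b
    ... | yes refl = inj₂ (trans (upd-hit x _ _)
                      (sym (trans (cong (ext a η) (upd-hit x a f)) (upd-hit a _ _))))
    ... | no x≢b with f x ≟ a
    ... | no fx≢a = inj₂ (trans (upd-miss b _ _ x≢b)
                      (sym (trans (cong (ext a η) (upd-miss b a f x≢b)) (upd-miss a _ _ fx≢a))))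
    -- Here the binder `a` of `u` captures the image of `x`. But `x` is then fresh for the plugged
    -- term: its value is the outer value of `a`, which no atom below this binder can have.
    ... | yes fx≡a = inj₁ (fresh-by-sem (plugₙ C t) u g (IsRen-ext b (r ∘ f)) (IsRen-ext a r)
                      (λ y e′ → ext-fresh r inj y
                        (trans (sym (trans (upd-miss b _ _ x≢b) (cong (wk ∘ η) fx≡a))) e′))
                      (sym (lam-injective e)))
    module D = Decomposition (decompose C t u f′ (ext a η) (IsRen-ext a r) (Inj-ext a r inj) g h
                 (trans (lam-injective e) (sem-agree (plugₙ C t) agree)))
  decompose (fun k C) t (fun k′ u) f η r inj g h e with refl , e₁ ← fun-injective e = record
    { C′ = fun k D.C′ ; u′ = D.u′ ; u≡ = cong (fun k) D.u≡ ; η′ = D.η′ ; ren = D.ren ; inj = D.inj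
    ; g = D.g ; u′≡ = D.u′≡ ; plug≡ = λ dep e′ → cong (fun k) (D.plug≡ dep e′) }
    where module D = Decomposition (decompose C t u f η r inj g h e₁)
  decompose (tup ss C ts) t (tup us) f η r inj g h e
    with sem*-split us η (sem* ss (η ∘ f)) (trans (tup-injective e) (sem*-++ ss _ (η ∘ f)))
  ... | cut ss′ u ts′ refl ss≡ u≡ ts≡ = record
    { C′ = tup ss′ D.C′ ts′ ; u′ = D.u′ ; u≡ = cong (λ v → tup (ss′ V.++ v ∷ ts′)) D.u≡
    ; η′ = D.η′ ; ren = D.ren ; inj = D.inj ; g = D.g ; u′≡ = D.u′≡
    ; plug≡ = λ dep e′ → cong tup (trans (sem*-++ ss′ _ η)
        (trans (cong₂ _++_ ss≡ (cong₂ _∷_ (D.plug≡ dep e′) ts≡)) (sym (sem*-++ ss _ (η ∘ f))))) }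
    where
    module D = Decomposition (decompose C t u f η r inj
      (proj₁ (proj₂ (Ground*-++⁻ ss g))) (proj₁ (proj₂ (Ground*-++⁻ ss′ h))) u≡)
  decompose (abs b C)     t (atom a) f η r inj g h e with () ← trans (sym (proj₂ (r a))) e
  decompose (fun k C)     t (atom a) f η r inj g h e with () ← trans (sym (proj₂ (r a))) e
  decompose (tup ss C ts) t (atom a) f η r inj g h e with () ← trans (sym (proj₂ (r a))) e

-- CRS terms and meta-terms

fresh-> : ∀ {x} xs → x ∈ xs → x < fresh xs
fresh-> (y ∷ xs) (here refl) = s≤s (m≤m⊔n y _)
fresh-> (y ∷ xs) (there p)   = s≤s (≤-trans (s≤s⁻¹ (fresh-> xs p)) (m≤n⊔m y _))

fresh-∉ : ∀ xs → fresh xs ∉ xs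
fresh-∉ xs p = <-irrefl refl (fresh-> xs p)

lookup-hit : (a : Atom) (x : A) (ps : List (Atom × A)) → lookupₐ ((a , x) ∷ ps) a ≡ just x
lookup-hit a x ps rewrite dec-true (a ≟ a) refl = refl

lookup-miss : ∀ {a b} (x : A) (ps : List (Atom × A)) → a ≢ b → lookupₐ ((b , x) ∷ ps) a ≡ lookupₐ ps a
lookup-miss {a = a} {b} x ps a≢b rewrite dec-false (a ≟ b) a≢b = refl

lookup-∉ : ∀ {x} as (ts : List A) → x ∉ as → lookupₐ (L.zip as ts) x ≡ nothing
lookup-∉ []       ts       x∉ = refl
lookup-∉ (a ∷ as) []       x∉ = refl
lookup-∉ (a ∷ as) (t ∷ ts) x∉ = trans (lookup-miss t (L.zip as ts) (x∉ ∘ here)) (lookup-∉ as ts (x∉ ∘ there))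

extend : List (Atom × A) → (Atom → A) → Atom → A
extend []             κ = κ
extend ((a , d) ∷ ps) κ = upd a d (extend ps κ)

extend-cong : (ps : List (Atom × A)) {κ κ′ : Atom → A} → κ ≗ κ′ → extend ps κ ≗ extend ps κ′
extend-cong []       e = e
extend-cong (p ∷ ps) e = upd-cong refl (extend-cong ps e)

extend-zip : (as : List Atom) (ds : List A) {κ κ′ : Atom → A} {x : Atom} → L.length as ≡ L.length ds →
             (x ∉ as → κ x ≡ κ′ x) → extend (L.zip as ds) κ x ≡ extend (L.zip as ds) κ′ x
extend-zip []       []       _ e = e λ ()
extend-zip (a ∷ as) (d ∷ ds) {x = x} l e with x ≟ a
... | yes refl = trans (upd-hit x d _) (sym (upd-hit x d _))
... | no x≢a   = trans (upd-miss a d _ x≢a) (trans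
                   (extend-zip as ds (suc-injective l) (λ x∉ → e λ { (here r) → x≢a r ; (there p) → x∉ p }))
                   (sym (upd-miss a d _ x≢a)))

∘-extend : (f : A → B) (as : List Atom) (ds : List A) (κ : Atom → A) →
           f ∘ extend (L.zip as ds) κ ≗ extend (L.zip as (L.map f ds)) (f ∘ κ)
∘-extend f []       ds       κ x = refl
∘-extend f (a ∷ as) []       κ x = refl
∘-extend f (a ∷ as) (d ∷ ds) κ x = trans (∘-upd f a d _ x) (upd-cong refl (∘-extend f as ds κ) x)

toList-zip : ∀ {n} (as : Vec A n) (bs : Vec B n) → toList (V.zip as bs) ≡ L.zip (toList as) (toList bs)
toList-zip []       []       = refl
toList-zip (a ∷ as) (b ∷ bs) = cong ((a , b) ∷_) (toList-zip as bs)

module Terms (S : Signature) where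
  open Signature S
  open Translation S public
  open Semantics (NSym Sym) public

  module _ {M : Set} {ar : M → ℕ} where

    fv-abs⁺ : ∀ {a x} (t : Pre M ar) → x ∈ fv t → x ≢ a → x ∈ fv (abs a t)
    fv-abs⁺ {a} t = ∈-filter⁺ (λ b → ¬? (b ≟ a)) {xs = fv t}

    fv-abs⁻ : ∀ {a x} (t : Pre M ar) → x ∈ fv (abs a t) → x ∈ fv t × x ≢ a
    fv-abs⁻ {a} t = ∈-filter⁻ (λ b → ¬? (b ≟ a)) {xs = fv t}

    -- Meta-variables are interpreted by a function of the environment κ that was
    -- in force outside all abstractions, and of the values of the arguments.
    module PreSemantics (I : ∀ {V} → M → Envᴰ V → List (DB (NSym Sym) V) → DB (NSym Sym) V) where

      psem  : Pre M ar → Envᴰ V → Envᴰ V → DB (NSym Sym) V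
      psem* : ∀ {n} → Vec (Pre M ar) n → Envᴰ V → Envᴰ V → List (DB (NSym Sym) V)
      psem (var a)     κ ρ = ρ a
      psem (meta Z ts) κ ρ = I Z κ (psem* ts κ ρ)
      psem (abs a t)   κ ρ = lam (psem t (wk ∘ κ) (ext a ρ))
      psem (fun f t)   κ ρ = fun (op f) (psem t κ ρ)
      psem (tup ts)    κ ρ = tup (psem* ts κ ρ)
      psem* []       κ ρ = []
      psem* (t ∷ ts) κ ρ = psem t κ ρ ∷ psem* ts κ ρ

      psem*-length : ∀ {n} (ts : Vec (Pre M ar) n) {κ ρ : Envᴰ V} → L.length (psem* ts κ ρ) ≡ n
      psem*-length []       = refl
      psem*-length (t ∷ ts) = cong suc (psem*-length ts)

      psem-fv  : ∀ t {κ ρ η : Envᴰ V} → (∀ {a} → a ∈ fv t → ρ a ≡ η a) → psem t κ ρ ≡ psem t κ η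
      psem*-fv : ∀ {n} (ts : Vec (Pre M ar) n) {κ ρ η : Envᴰ V} → (∀ {a} → a ∈ fv* ts → ρ a ≡ η a) →
                 psem* ts κ ρ ≡ psem* ts κ η
      psem-fv (var a)     e = e (here refl)
      psem-fv (meta Z ts) {κ} e = cong (I Z κ) (psem*-fv ts e)
      psem-fv (abs a t)   {ρ = ρ} {η} e = cong lam (psem-fv t ext≡)
        where
        ext≡ : ∀ {x} → x ∈ fv t → ext a ρ x ≡ ext a η x
        ext≡ {x} p with x ≟ a
        ... | yes refl = trans (upd-hit x _ _) (sym (upd-hit x _ _))
        ... | no x≢a   = trans (upd-miss a _ _ x≢a)
                          (trans (cong wk (e (fv-abs⁺ t p x≢a))) (sym (upd-miss a _ _ x≢a)))
      psem-fv (fun f t)   e = cong (fun (op f)) (psem-fv t e)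
      psem-fv (tup ts)    e = cong tup (psem*-fv ts e)
      psem*-fv []       e = refl
      psem*-fv (t ∷ ts) e = cong₂ _∷_ (psem-fv t (e ∘ ∈-++⁺ˡ)) (psem*-fv ts (e ∘ ∈-++⁺ʳ (fv t)))

      psem-swap  : ∀ a b t {κ ρ : Envᴰ V} → psem (swap a b t) κ ρ ≡ psem t κ (ρ ∘ swapₐ a b)
      psem*-swap : ∀ {n} a b (ts : Vec (Pre M ar) n) {κ ρ : Envᴰ V} →
                   psem* (swap* a b ts) κ ρ ≡ psem* ts κ (ρ ∘ swapₐ a b)
      psem-swap a b (var x)     = refl
      psem-swap a b (meta Z ts) {κ} = cong (I Z κ) (psem*-swap a b ts)
      psem-swap a b (abs x t)   {ρ = ρ} = cong lam (trans (psem-swap a b t) (psem-fv t λ {y} _ →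
        upd-∘ (swapₐ a b) x (var nothing) (wk ∘ ρ) (swap-injective a b) y))
      psem-swap a b (fun f t)   = cong (fun (op f)) (psem-swap a b t)
      psem-swap a b (tup ts)    = cong tup (psem*-swap a b ts)
      psem*-swap a b []       = refl
      psem*-swap a b (t ∷ ts) = cong₂ _∷_ (psem-swap a b t) (psem*-swap a b ts)

      -- Holds for every interpretation `I`, as a meta-variable sees only the values of its
      -- arguments and `κ`, and `κ` does not depend on the names of the binders passed.
      psem-≈  : ∀ {s t} → s ≈ t → {κ ρ : Envᴰ V} → psem s κ ρ ≡ psem t κ ρ
      psem*-≈ : ∀ {m n} {ss : Vec (Pre M ar) m} {ts : Vec (Pre M ar) n} → Pointwise _≈_ ss ts →
                {κ ρ : Envᴰ V} → psem* ss κ ρ ≡ psem* ts κ ρ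
      psem-≈ var         = refl
      psem-≈ (meta {Z} ps) {κ} = cong (I Z κ) (psem*-≈ ps)
      psem-≈ (abs p)     = cong lam (psem-≈ p)
      psem-≈ (abs-≢ {a} {b} {s} {t} a≢b a∉t p) {ρ = ρ} =
        cong lam (trans (psem-≈ p) (trans (psem-swap a b t) (psem-fv t ext≡)))
        where
        ext≡ : ∀ {x} → x ∈ fv t → ext a ρ (swapₐ a b x) ≡ ext b ρ x
        ext≡ {x} p with x ≟ b
        ... | yes refl = trans (cong (ext a ρ) (swap-right a x)) (trans (upd-hit a _ _) (sym (upd-hit x _ _)))
        ... | no x≢b   = let x≢a = λ { refl → a∉t p } in
                trans (cong (ext a ρ) (swap-other x≢a x≢b))
                  (trans (upd-miss a _ _ x≢a) (sym (upd-miss b _ _ x≢b)))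
      psem-≈ (fun {f} p) = cong (fun (op f)) (psem-≈ p)
      psem-≈ (tup ps)    = cong tup (psem*-≈ ps)
      psem*-≈ []       = refl
      psem*-≈ (p ∷ ps) = cong₂ _∷_ (psem-≈ p) (psem*-≈ ps)

  tsem : Term → Envᴰ V → DB (NSym Sym) V
  tsem t = sem ⌜ t ⌝

  Ground-⌜⌝  : ∀ t → Ground ⌜ t ⌝
  Ground*-⌜⌝ : ∀ {n} (ts : Vec Term n) → Ground* ⌜ ts ⌝*
  Ground-⌜⌝ (var a)   = tt
  Ground-⌜⌝ (abs a t) = Ground-⌜⌝ t
  Ground-⌜⌝ (fun f t) = Ground-⌜⌝ t
  Ground-⌜⌝ (tup ts)  = Ground*-⌜⌝ ts
  Ground*-⌜⌝ []       = tt
  Ground*-⌜⌝ (t ∷ ts) = Ground-⌜⌝ t , Ground*-⌜⌝ ts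

  module _ where
    open PreSemantics {⊥} {λ ()} (λ ())

    tsem-psem  : ∀ t (κ ρ : Envᴰ V) → tsem t ρ ≡ psem t κ ρ
    tsem*-psem : ∀ {n} (ts : Vec Term n) (κ ρ : Envᴰ V) → sem* ⌜ ts ⌝* ρ ≡ psem* ts κ ρ
    tsem-psem (var a)   κ ρ = refl
    tsem-psem (abs a t) κ ρ = cong lam (tsem-psem t (wk ∘ κ) (ext a ρ))
    tsem-psem (fun f t) κ ρ = cong (fun (op f)) (tsem-psem t κ ρ)
    tsem-psem (tup ts)  κ ρ = cong tup (tsem*-psem ts κ ρ)
    tsem*-psem []       κ ρ = refl
    tsem*-psem (t ∷ ts) κ ρ = cong₂ _∷_ (tsem-psem t κ ρ) (tsem*-psem ts κ ρ)

    tsem-fv : ∀ t {ρ η : Envᴰ V} → (∀ {a} → a ∈ fv t → ρ a ≡ η a) → tsem t ρ ≡ tsem t η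
    tsem-fv t {ρ} {η} e = trans (tsem-psem t ρ ρ) (trans (psem-fv t e) (sym (tsem-psem t ρ η)))

    tsem-≈ : ∀ {s t} → s ≈ t → (ρ : Envᴰ V) → tsem s ρ ≡ tsem t ρ
    tsem-≈ {s = s} {t} p ρ = trans (tsem-psem s ρ ρ) (trans (psem-≈ p) (sym (tsem-psem t ρ ρ)))

  #-∉fv  : ∀ {Δ a} t → a ∉ fv t → Δ ⊢ a # ⌜ t ⌝
  #-∉fv* : ∀ {Δ a n} (ts : Vec Term n) → a ∉ fv* ts → VAll.All (Δ ⊢ a #_) ⌜ ts ⌝*
  #-∉fv (var b)   a∉ = atom (a∉ ∘ here)
  #-∉fv {a = a} (abs b t) a∉ with a ≟ b
  ... | yes refl = abs-≡
  ... | no a≢b   = abs-≢ a≢b (#-∉fv t (λ p → a∉ (fv-abs⁺ t p a≢b)))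
  #-∉fv (fun f t) a∉ = fun (#-∉fv t a∉)
  #-∉fv (tup ts)  a∉ = tup (#-∉fv* ts a∉)
  #-∉fv* []       a∉ = []
  #-∉fv* (t ∷ ts) a∉ = #-∉fv t (a∉ ∘ ∈-++⁺ˡ) ∷ #-∉fv* ts (a∉ ∘ ∈-++⁺ʳ (fv t))

  ∉fv-#  : ∀ {Δ a} t → Δ ⊢ a # ⌜ t ⌝ → a ∉ fv t
  ∉fv-#* : ∀ {Δ a n} (ts : Vec Term n) → VAll.All (Δ ⊢ a #_) ⌜ ts ⌝* → a ∉ fv* ts
  ∉fv-# (var b)   (atom a≢b) (here refl) = a≢b refl
  ∉fv-# (abs b t) abs-≡ q = proj₂ (fv-abs⁻ t q) refl
  ∉fv-# (abs b t) (abs-≢ _ p) q = ∉fv-# t p (proj₁ (fv-abs⁻ t q))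
  ∉fv-# (fun f t) (fun p) q = ∉fv-# t p q
  ∉fv-# (tup ts)  (tup p) q = ∉fv-#* ts p q
  ∉fv-#* (t ∷ ts) (p ∷ ps) q with ∈-++⁻ (fv t) q
  ... | inj₁ q = ∉fv-# t p q
  ... | inj₂ q = ∉fv-#* ts ps q

  var-hit : ∀ a t e → var a ⟪ (a , t) ∷ e ⟫ ≡ t
  var-hit a t e rewrite lookup-hit a t e = refl

  var-miss : ∀ {x a} t e → x ≢ a → var x ⟪ (a , t) ∷ e ⟫ ≡ var x ⟪ e ⟫
  var-miss {x} {a} t e x≢a rewrite dec-false (x ≟ a) x≢a = refl

  fv-var⟪⟫ : ∀ x e {y} → y ∈ fv (var x ⟪ e ⟫) → y ≡ x ⊎ y ∈ fvEnv e
  fv-var⟪⟫ x []            (here refl) = inj₁ refl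
  fv-var⟪⟫ x ((a , t) ∷ e) {y} p with x ≟ a
  ... | yes refl = inj₂ (∈-++⁺ˡ (subst (λ s → y ∈ fv s) (var-hit x t e) p))
  ... | no x≢a with fv-var⟪⟫ x e (subst (λ s → y ∈ fv s) (var-miss t e x≢a) p)
  ... | inj₁ q = inj₁ q
  ... | inj₂ q = inj₂ (∈-++⁺ʳ (fv t) q)

  tsem-wk : ∀ {c} t {ρ : Envᴰ V} → c ∉ fv t → tsem t (ext c ρ) ≡ wk (tsem t ρ)
  tsem-wk {c = c} t {ρ} c∉ = trans (tsem-fv t λ { p → upd-miss c _ _ λ { refl → c∉ p } }) (sem-mapᴰ ⌜ t ⌝ just ρ)

  var⟪⟫-ext : ∀ (t : Term) a e c (ρ : Envᴰ V) → c ∉ fv t ++ fvEnv e → ∀ {x} → x ∈ fv t →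
              tsem (var x ⟪ (a , var c) ∷ e ⟫) (ext c ρ) ≡ ext a (λ y → tsem (var y ⟪ e ⟫) ρ) x
  var⟪⟫-ext t a e c ρ c∉ {x} p with x ≟ a
  ... | yes refl = trans (cong (λ s → tsem s (ext c ρ)) (var-hit x (var c) e))
                     (trans (upd-hit c _ _) (sym (upd-hit x _ _)))
  ... | no x≢a   = trans (cong (λ s → tsem s (ext c ρ)) (var-miss (var c) e x≢a))
                     (trans (tsem-wk (var x ⟪ e ⟫) c∉′) (sym (upd-miss a _ _ x≢a)))
    where
    c∉′ : c ∉ fv (var x ⟪ e ⟫)
    c∉′ q with fv-var⟪⟫ x e q
    ... | inj₁ refl = c∉ (∈-++⁺ˡ p)
    ... | inj₂ r    = c∉ (∈-++⁺ʳ (fv t) r)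

  -- Phrased through the values of `var x ⟪ e ⟫`, so that below a binder only the atoms `x` free in
  -- `t` have to be compared; their images avoid the fresh `c`.
  tsem-⟪⟫var  : ∀ t e (ρ : Envᴰ V) → tsem (t ⟪ e ⟫) ρ ≡ tsem t (λ x → tsem (var x ⟪ e ⟫) ρ)
  tsem-⟪⟫var* : ∀ {n} (ts : Vec Term n) e (ρ : Envᴰ V) →
                sem* ⌜ ts ⟪ e ⟫* ⌝* ρ ≡ sem* ⌜ ts ⌝* (λ x → tsem (var x ⟪ e ⟫) ρ)
  tsem-⟪⟫var (var a)   e ρ = refl
  tsem-⟪⟫var (abs a t) e ρ = let c = fresh (fv t ++ fvEnv e) in
    cong lam (trans (tsem-⟪⟫var t ((a , var c) ∷ e) (ext c ρ))
                    (tsem-fv t (var⟪⟫-ext t a e c ρ (fresh-∉ (fv t ++ fvEnv e)))))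
  tsem-⟪⟫var (fun f t) e ρ = cong (fun (op f)) (tsem-⟪⟫var t e ρ)
  tsem-⟪⟫var (tup ts)  e ρ = cong tup (tsem-⟪⟫var* ts e ρ)
  tsem-⟪⟫var* []       e ρ = refl
  tsem-⟪⟫var* (t ∷ ts) e ρ = cong₂ _∷_ (tsem-⟪⟫var t e ρ) (tsem-⟪⟫var* ts e ρ)

  semEnv : Env → Envᴰ V → List (Atom × DB (NSym Sym) V)
  semEnv e ρ = L.map (λ (a , t) → a , tsem t ρ) e

  tsem-var⟪⟫ : ∀ x e (ρ : Envᴰ V) → tsem (var x ⟪ e ⟫) ρ ≡ extend (semEnv e ρ) ρ x
  tsem-var⟪⟫ x []            ρ = refl
  tsem-var⟪⟫ x ((a , t) ∷ e) ρ with x ≟ a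
  ... | yes refl = trans (cong (λ s → tsem s ρ) (var-hit x t e)) (sym (upd-hit x _ _))
  ... | no x≢a   = trans (cong (λ s → tsem s ρ) (var-miss t e x≢a))
                     (trans (tsem-var⟪⟫ x e ρ) (sym (upd-miss a _ _ x≢a)))

  tsem-⟪⟫ : ∀ t e (ρ : Envᴰ V) → tsem (t ⟪ e ⟫) ρ ≡ tsem t (extend (semEnv e ρ) ρ)
  tsem-⟪⟫ t e ρ = trans (tsem-⟪⟫var t e ρ) (sem-cong ⌜ t ⌝ (λ x → tsem-var⟪⟫ x e ρ))

  fv-⟪⟫  : ∀ t e {x} → x ∈ fv t → lookupₐ e x ≡ nothing → x ∈ fv (t ⟪ e ⟫)
  fv-⟪⟫* : ∀ {n} (ts : Vec Term n) e {x} → x ∈ fv* ts → lookupₐ e x ≡ nothing → x ∈ fv* (ts ⟪ e ⟫*)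
  fv-⟪⟫ (var a)   e (here refl) l rewrite l = here refl
  fv-⟪⟫ (abs a t) e {x} p l with p′ , x≢a ← fv-abs⁻ t p =
    let c = fresh (fv t ++ fvEnv e) in
    fv-abs⁺ (t ⟪ (a , var c) ∷ e ⟫)
      (fv-⟪⟫ t ((a , var c) ∷ e) p′ (trans (lookup-miss (var c) e x≢a) l))
      (λ x≡c → fresh-∉ (fv t ++ fvEnv e) (subst (_∈ (fv t ++ fvEnv e)) x≡c (∈-++⁺ˡ p′)))
  fv-⟪⟫ (fun f t) e p l = fv-⟪⟫ t e p l
  fv-⟪⟫ (tup ts)  e p l = fv-⟪⟫* ts e p l
  fv-⟪⟫* (t ∷ ts) e p l with ∈-++⁻ (fv t) p
  ... | inj₁ q = ∈-++⁺ˡ (fv-⟪⟫ t e q l)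
  ... | inj₂ q = ∈-++⁺ʳ (fv (t ⟪ e ⟫)) (fv-⟪⟫* ts e q l)

  #-⟪⟫  : ∀ {Δ c} t e → (∀ {x} → x ∈ fv t → Δ ⊢ c # ⌜ var x ⟪ e ⟫ ⌝) → Δ ⊢ c # ⌜ t ⟪ e ⟫ ⌝
  #-⟪⟫* : ∀ {Δ c n} (ts : Vec Term n) e → (∀ {x} → x ∈ fv* ts → Δ ⊢ c # ⌜ var x ⟪ e ⟫ ⌝) →
          VAll.All (Δ ⊢ c #_) ⌜ ts ⟪ e ⟫* ⌝*
  #-⟪⟫ (var a) e h = h (here refl)
  #-⟪⟫ {Δ} {c} (abs a t) e h with c ≟ fresh (fv t ++ fvEnv e)
  ... | yes refl = abs-≡
  ... | no c≢d = abs-≢ c≢d (#-⟪⟫ t _ h′)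
    where
    d = fresh (fv t ++ fvEnv e)
    h′ : ∀ {x} → x ∈ fv t → Δ ⊢ c # ⌜ var x ⟪ (a , var d) ∷ e ⟫ ⌝
    h′ {x} p with x ≟ a
    ... | yes refl = subst (λ s → Δ ⊢ c # ⌜ s ⌝) (sym (var-hit x (var d) e)) (atom c≢d)
    ... | no x≢a   = subst (λ s → Δ ⊢ c # ⌜ s ⌝) (sym (var-miss (var d) e x≢a)) (h (fv-abs⁺ t p x≢a))
  #-⟪⟫ (fun f t) e h = fun (#-⟪⟫ t e h)
  #-⟪⟫ (tup ts)  e h = tup (#-⟪⟫* ts e h)
  #-⟪⟫* []       e h = []
  #-⟪⟫* (t ∷ ts) e h = #-⟪⟫ t e (h ∘ ∈-++⁺ˡ) ∷ #-⟪⟫* ts e (h ∘ ∈-++⁺ʳ (fv t))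

  -- If the flag is false, the meta-variables inside arguments of meta-variables are left out.
  mvs  : Bool → MetaTerm → List Var
  mvs* : ∀ {n} → Bool → Vec MetaTerm n → List Var
  mvs d (var a)         = []
  mvs true (meta Z ts)  = Z ∷ mvs* true ts
  mvs false (meta Z ts) = Z ∷ []
  mvs d (abs a t)       = mvs d t
  mvs d (fun f t)       = mvs d t
  mvs d (tup ts)        = mvs* d ts
  mvs* d []       = []
  mvs* d (t ∷ ts) = mvs d t ++ mvs* d ts

  mvs-swap  : ∀ d a b t → mvs d (swap a b t) ≡ mvs d t
  mvs*-swap : ∀ {n} d a b (ts : Vec MetaTerm n) → mvs* d (swap* a b ts) ≡ mvs* d ts
  mvs-swap d a b (var x)         = refl
  mvs-swap true a b (meta Z ts)  = cong (Z ∷_) (mvs*-swap true a b ts)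
  mvs-swap false a b (meta Z ts) = refl
  mvs-swap d a b (abs x t)       = mvs-swap d a b t
  mvs-swap d a b (fun f t)       = mvs-swap d a b t
  mvs-swap d a b (tup ts)        = mvs*-swap d a b ts
  mvs*-swap d a b []       = refl
  mvs*-swap d a b (t ∷ ts) = cong₂ _++_ (mvs-swap d a b t) (mvs*-swap d a b ts)

  mvs-≈  : ∀ d {s t} → s ≈ t → mvs d s ≡ mvs d t
  mvs*-≈ : ∀ d {m n} {ss : Vec MetaTerm m} {ts : Vec MetaTerm n} → Pointwise _≈_ ss ts → mvs* d ss ≡ mvs* d ts
  mvs-≈ d var               = refl
  mvs-≈ true (meta {Z} ps)  = cong (Z ∷_) (mvs*-≈ true ps)
  mvs-≈ false (meta ps)     = refl
  mvs-≈ d (abs p)           = mvs-≈ d p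
  mvs-≈ d (abs-≢ {a} {b} {t = t} _ _ p) = trans (mvs-≈ d p) (mvs-swap d a b t)
  mvs-≈ d (fun p)           = mvs-≈ d p
  mvs-≈ d (tup ps)          = mvs*-≈ d ps
  mvs*-≈ d []       = refl
  mvs*-≈ d (p ∷ ps) = cong₂ _++_ (mvs-≈ d p) (mvs*-≈ d ps)

  mvs-occs  : ∀ bs t → L.map mv (occsUnder bs t) ≡ mvs true t
  mvs-occs* : ∀ {n} bs (ts : Vec MetaTerm n) → L.map mv (occsUnder* bs ts) ≡ mvs* true ts
  mvs-occs bs (var a)     = refl
  mvs-occs bs (meta Z ts) = cong (Z ∷_) (mvs-occs* bs ts)
  mvs-occs bs (abs a t)   = mvs-occs (a ∷ bs) t
  mvs-occs bs (fun f t)   = mvs-occs bs t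
  mvs-occs bs (tup ts)    = mvs-occs* bs ts
  mvs-occs* bs []       = refl
  mvs-occs* bs (t ∷ ts) = trans (map-++ mv (occsUnder bs t) _) (cong₂ _++_ (mvs-occs bs t) (mvs-occs* bs ts))

  mvs*-vars : ∀ {n} (ts : Vec MetaTerm n) bs → toList ts ≡ L.map var bs → mvs* true ts ≡ []
  mvs*-vars []       bs       e = refl
  mvs*-vars (t ∷ ts) (b ∷ bs) e with ∷-injective e
  ... | refl , e′ = mvs*-vars ts bs e′

  -- The arguments in a left-hand side are variables, so leaving out what lies inside arguments
  -- loses no meta-variable there.
  mvs-linear  : ∀ bs t → (∀ {o} → o ∈ occsUnder bs t → Linear o) → ∀ {Z} → Z ∈ mvs true t → Z ∈ mvs false t
  mvs*-linear : ∀ {n} bs (ts : Vec MetaTerm n) → (∀ {o} → o ∈ occsUnder* bs ts → Linear o) →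
                ∀ {Z} → Z ∈ mvs* true ts → Z ∈ mvs* false ts
  mvs-linear bs (meta Z ts) lin (here refl) = here refl
  mvs-linear bs (meta Z ts) lin (there p) with lin (here refl)
  ... | cs , e , _ with () ← subst (_ ∈_) (mvs*-vars ts cs e) p
  mvs-linear bs (abs a t)   lin p = mvs-linear (a ∷ bs) t lin p
  mvs-linear bs (fun f t)   lin p = mvs-linear bs t lin p
  mvs-linear bs (tup ts)    lin p = mvs*-linear bs ts lin p
  mvs*-linear bs (t ∷ ts) lin p with ∈-++⁻ (mvs true t) p
  ... | inj₁ q = ∈-++⁺ˡ (mvs-linear bs t (lin ∘ ∈-++⁺ˡ) q)
  ... | inj₂ q = ∈-++⁺ʳ (mvs false t) (mvs*-linear bs ts (lin ∘ ∈-++⁺ʳ (occsUnder bs t)) q)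

  fvₛ⁺ : ∀ {n} (s : Substitute n) {x} → x ∈ fv (body s) → x ∉ toList (params s) → x ∈ fvₛ s
  fvₛ⁺ s = ∈-filter⁺ (λ b → ¬? (b ∈? toList (params s)))

  fvₛ⁻ : ∀ {n} (s : Substitute n) {x} → x ∈ fvₛ s → x ∈ fv (body s) × x ∉ toList (params s)
  fvₛ⁻ s = ∈-filter⁻ (λ b → ¬? (b ∈? toList (params s)))

  -- Values of meta-terms under a valuation

  module Interpretation (σ : Valuation) where

    app : Var → Envᴰ V → List (DB (NSym Sym) V) → DB (NSym Sym) V
    app Z κ ds = tsem (body (σ Z)) (extend (L.zip (toList (params (σ Z))) ds) κ)

    open PreSemantics {Var} {mvArity} app public
      renaming (psem to interp; psem* to interp*; psem-fv to interp-fv; psem-≈ to interp-≈; psem*-length to interp*-length)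
      using ()

    app-cong : ∀ Z {κ κ′ : Envᴰ V} ds → L.length ds ≡ mvArity Z → (∀ {x} → x ∈ fvₛ (σ Z) → κ x ≡ κ′ x) →
               app Z κ ds ≡ app Z κ′ ds
    app-cong Z ds l e = tsem-fv (body (σ Z)) λ p →
      extend-zip (toList (params (σ Z))) ds (trans (length-toList (params (σ Z))) (sym l)) (λ x∉ → e (fvₛ⁺ (σ Z) p x∉))

    interp-κ  : ∀ t {κ κ′ ρ : Envᴰ V} → (∀ {Z x} → Z ∈ mvs true t → x ∈ fvₛ (σ Z) → κ x ≡ κ′ x) →
                interp t κ ρ ≡ interp t κ′ ρ
    interp*-κ : ∀ {n} (ts : Vec MetaTerm n) {κ κ′ ρ : Envᴰ V} →
                (∀ {Z x} → Z ∈ mvs* true ts → x ∈ fvₛ (σ Z) → κ x ≡ κ′ x) → interp* ts κ ρ ≡ interp* ts κ′ ρ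
    interp-κ (var a)     e = refl
    interp-κ (meta Z ts) {κ} {κ′} {ρ} e =
      trans (cong (app Z κ) (interp*-κ ts (e ∘ there)))
            (app-cong Z (interp* ts κ′ ρ) (interp*-length ts) (e (here refl)))
    interp-κ (abs a t)   e = cong lam (interp-κ t (λ p q → cong wk (e p q)))
    interp-κ (fun f t)   e = cong (fun (op f)) (interp-κ t e)
    interp-κ (tup ts)    e = cong tup (interp*-κ ts e)
    interp*-κ []       e = refl
    interp*-κ (t ∷ ts) e = cong₂ _∷_ (interp-κ t (e ∘ ∈-++⁺ˡ)) (interp*-κ ts (e ∘ ∈-++⁺ʳ (mvs true t)))

    interp-cong : ∀ t {κ κ′ ρ ρ′ : Envᴰ V} → κ ≗ κ′ → ρ ≗ ρ′ → interp t κ ρ ≡ interp t κ′ ρ′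
    interp-cong t e e′ = trans (interp-κ t (λ _ _ → e _)) (interp-fv t (λ _ → e′ _))

    semEnv-zip : ∀ {n} as (ts : Vec MetaTerm n) (ρ : Envᴰ V) →
                 semEnv (L.zip as (toList (ts [ σ ]*))) ρ ≡ L.zip as (sem* ⌜ ts [ σ ]* ⌝* ρ)
    semEnv-zip []       ts       ρ = refl
    semEnv-zip (a ∷ as) []       ρ = refl
    semEnv-zip (a ∷ as) (t ∷ ts) ρ = cong (_ ∷_) (semEnv-zip as ts ρ)

    -- In `t [ σ ]` substitutes are placed below the binders of `t` unrenamed, whereas `interp`
    -- evaluates them in `κ`, outside these binders. Safety reconciles the two: a binder updates `ρ`
    -- only at an atom that is free in no substitute concerned.
    interp-[]  : ∀ t {κ ρ : Envᴰ V} → (∀ {Z x} → Z ∈ mvs true t → x ∈ fvₛ (σ Z) → ρ x ≡ κ x) →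
                 (∀ {Z x} → Z ∈ mvs true t → x ∈ fvₛ (σ Z) → x ∉ binders t) →
                 tsem (t [ σ ]) ρ ≡ interp t κ ρ
    interp-[]* : ∀ {n} (ts : Vec MetaTerm n) {κ ρ : Envᴰ V} → (∀ {Z x} → Z ∈ mvs* true ts → x ∈ fvₛ (σ Z) → ρ x ≡ κ x) →
                 (∀ {Z x} → Z ∈ mvs* true ts → x ∈ fvₛ (σ Z) → x ∉ binders* ts) →
                 sem* ⌜ ts [ σ ]* ⌝* ρ ≡ interp* ts κ ρ
    interp-[] (var a)     e safe = refl
    interp-[] (meta Z ts) {κ} {ρ} e safe = let as = params (σ Z) in
      trans (tsem-⟪⟫ (body (σ Z)) (toList (V.zip as (ts [ σ ]*))) ρ)
      (trans (cong (λ ps → tsem (body (σ Z)) (extend ps ρ))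
               (trans (cong (λ ps → semEnv ps ρ) (toList-zip as (ts [ σ ]*))) (semEnv-zip (toList as) ts ρ)))
      (trans (cong (app Z ρ) (interp-[]* ts (e ∘ there) (safe ∘ there)))
             (app-cong Z (interp* ts κ ρ) (interp*-length ts) (e (here refl)))))
    interp-[] (abs a t)   {κ} {ρ} e safe = cong lam (interp-[] t
      (λ p q → trans (upd-miss a _ _ λ { refl → safe p q (here refl) }) (cong wk (e p q)))
      (λ p q → safe p q ∘ there))
    interp-[] (fun f t)   e safe = cong (fun (op f)) (interp-[] t e safe)
    interp-[] (tup ts)    e safe = cong tup (interp-[]* ts e safe)
    interp-[]* []       e safe = refl
    interp-[]* (t ∷ ts) e safe = cong₂ _∷_
      (interp-[] t (e ∘ ∈-++⁺ˡ) (λ p q → safe (∈-++⁺ˡ p) q ∘ ∈-++⁺ˡ))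
      (interp-[]* ts (e ∘ ∈-++⁺ʳ (mvs true t)) (λ p q → safe (∈-++⁺ʳ (mvs true t) p) q ∘ ∈-++⁺ʳ (binders t)))

    -- Shows that the redex exposes every atom on which the reduct can depend. Occurrences inside
    -- arguments do not count, since a substitute may drop its argument.
    fv-[]  : ∀ t {Z x} → Z ∈ mvs false t → x ∈ fvₛ (σ Z) → x ∉ binders t → x ∈ fv (t [ σ ])
    fv-[]* : ∀ {n} (ts : Vec MetaTerm n) {Z x} → Z ∈ mvs* false ts → x ∈ fvₛ (σ Z) → x ∉ binders* ts → x ∈ fv* (ts [ σ ]*)
    fv-[] (meta Z ts) {x = x} (here refl) q x∉ with p , x∉′ ← fvₛ⁻ (σ Z) q =
      fv-⟪⟫ (body (σ Z)) (toList (V.zip (params (σ Z)) (ts [ σ ]*))) p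
        (trans (cong (λ ps → lookupₐ ps x) (toList-zip (params (σ Z)) (ts [ σ ]*)))
               (lookup-∉ (toList (params (σ Z))) (toList (ts [ σ ]*)) x∉′))
    fv-[] (abs a t)   p q x∉ = fv-abs⁺ (t [ σ ]) (fv-[] t p q (x∉ ∘ there)) (x∉ ∘ here)
    fv-[] (fun f t)   p q x∉ = fv-[] t p q x∉
    fv-[] (tup ts)    p q x∉ = fv-[]* ts p q x∉
    fv-[]* (t ∷ ts) p q x∉ with ∈-++⁻ (mvs false t) p
    ... | inj₁ p′ = ∈-++⁺ˡ (fv-[] t p′ q (x∉ ∘ ∈-++⁺ˡ))
    ... | inj₂ p′ = ∈-++⁺ʳ (fv (t [ σ ])) (fv-[]* ts p′ q (x∉ ∘ ∈-++⁺ʳ (binders t)))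

∉-All : ∀ {x : A} {xs} → x ∉ xs → All (x ≢_) xs
∉-All x∉ = All.tabulate λ { p refl → x∉ p }

All-∉ : ∀ {x : A} {xs} → All (x ≢_) xs → x ∉ xs
All-∉ ps p = All.lookup ps p refl

unique-∷ : ∀ {x : A} {xs} → x ∉ xs → Unique xs → Unique (x ∷ xs)
unique-∷ x∉ u = ∉-All x∉ ∷ u

unique-head : ∀ {x : A} {xs} → Unique (x ∷ xs) → x ∉ xs
unique-head (p ∷ _) = All-∉ p

unique-tail : ∀ {x : A} {xs} → Unique (x ∷ xs) → Unique xs
unique-tail (_ ∷ u) = u

pigeonhole : ∀ (xs ys : List A) → Unique xs → (∀ {x} → x ∈ xs → x ∈ ys) → length xs ≤ length ys
pigeonhole []       ys u s = z≤n
pigeonhole (x ∷ xs) ys u s with ∈-∃++ (s (here refl))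
... | zs , ws , refl = ≤-trans (s≤s (pigeonhole xs (zs ++ ws) (unique-tail u) s′))
        (≤-reflexive (sym (trans (length-++ zs) (trans (+-suc (length zs) _) (cong suc (sym (length-++ zs)))))))
  where
  s′ : ∀ {y} → y ∈ xs → y ∈ zs ++ ws
  s′ {y} p with ∈-++⁻ zs (s (there p))
  ... | inj₁ q           = ∈-++⁺ˡ q
  ... | inj₂ (here refl) = ⊥-elim (unique-head u p)
  ... | inj₂ (there q)   = ∈-++⁺ʳ zs q

-- Permutations

·ₐ-++ : ∀ π π′ x → (π ++ π′) ·ₐ x ≡ π ·ₐ π′ ·ₐ x
·ₐ-++ π π′ x = foldr-++ _ x π π′

-- As `cyclePerm` reverses the tail, the swapping with `y` stands last in the list and acts first.
cycle-∷ : ∀ c y ys x → cyclePerm (c ∷ y ∷ ys) ·ₐ x ≡ cyclePerm (c ∷ ys) ·ₐ swapₐ c y x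
cycle-∷ c y ys x rewrite unfold-reverse y ys | map-++ (c ,_) (L.reverse ys) (y ∷ []) =
  ·ₐ-++ (L.map (c ,_) (L.reverse ys)) ((c , y) ∷ []) x

cycle-fix : ∀ c ys {x} → x ∉ c ∷ ys → cyclePerm (c ∷ ys) ·ₐ x ≡ x
cycle-fix c []       x∉ = refl
cycle-fix c (y ∷ ys) {x} x∉ = trans (cycle-∷ c y ys x)
  (trans (cong (cyclePerm (c ∷ ys) ·ₐ_) (swap-other (x∉ ∘ here) (x∉ ∘ there ∘ here)))
         (cycle-fix c ys λ { (here p) → x∉ (here p) ; (there p) → x∉ (there (there p)) }))

cycle-start : ∀ c y ys → Unique (c ∷ y ∷ ys) → cyclePerm (c ∷ y ∷ ys) ·ₐ c ≡ y
cycle-start c y ys u = trans (cycle-∷ c y ys c) (trans (cong (cyclePerm (c ∷ ys) ·ₐ_) (swap-left c y))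
  (cycle-fix c ys λ { (here refl) → unique-head u (here refl) ; (there p) → unique-head (unique-tail u) p }))

lookup-zip⁺ : ∀ {x} as (bs : List B) → length as ≡ length bs → x ∈ as → ∃[ y ] lookupₐ (L.zip as bs) x ≡ just y
lookup-zip⁺ {x = x} (a ∷ as) (b ∷ bs) l p with x ≟ a | p
... | yes refl | _ = b , lookup-hit x b (L.zip as bs)
... | no x≢a | here r = ⊥-elim (x≢a r)
... | no x≢a | there q with y , e ← lookup-zip⁺ as bs (suc-injective l) q =
  y , trans (lookup-miss b (L.zip as bs) x≢a) e

lookup-∈ : ∀ {x} {y : B} ps → lookupₐ ps x ≡ just y → (x , y) ∈ ps
lookup-∈ {x = x} ((a , b) ∷ ps) e with x ≟ a
... | yes refl with refl ← trans (sym (lookup-hit x b ps)) e = here refl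
... | no x≢a = there (lookup-∈ ps (trans (sym (lookup-miss b ps x≢a)) e))

zip-∈ : ∀ {x} {y : B} (as : List A) (bs : List B) → (x , y) ∈ L.zip as bs → x ∈ as × y ∈ bs
zip-∈ (a ∷ as) (b ∷ bs) (here refl) = here refl , here refl
zip-∈ (a ∷ as) (b ∷ bs) (there p) with q , r ← zip-∈ as bs p = there q , there r

lookup-injective : ∀ {x x′} {y : B} as (bs : List B) → Unique bs →
                   lookupₐ (L.zip as bs) x ≡ just y → lookupₐ (L.zip as bs) x′ ≡ just y → x ≡ x′
lookup-injective {x = x} {x′} (a ∷ as) (b ∷ bs) u e e′ with x ≟ a | x′ ≟ a
... | yes refl | yes refl = refl
... | no x≢a | no x′≢a = lookup-injective as bs (unique-tail u)
        (trans (sym (lookup-miss b (L.zip as bs) x≢a)) e) (trans (sym (lookup-miss b (L.zip as bs) x′≢a)) e′)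
... | yes refl | no x′≢a with refl ← trans (sym (lookup-hit x b (L.zip as bs))) e = ⊥-elim (unique-head u
        (proj₂ (zip-∈ as bs (lookup-∈ (L.zip as bs) (trans (sym (lookup-miss b (L.zip as bs) x′≢a)) e′)))))
... | no x≢a | yes refl with refl ← trans (sym (lookup-hit x′ b (L.zip as bs))) e′ = ⊥-elim (unique-head u
        (proj₂ (zip-∈ as bs (lookup-∈ (L.zip as bs) (trans (sym (lookup-miss b (L.zip as bs) x≢a)) e)))))

map-lookup : ∀ (f : Atom → B) as bs → Unique as → length as ≡ length bs →
             (∀ {x y} → lookupₐ (L.zip as bs) x ≡ just y → f x ≡ y) → L.map f as ≡ bs
map-lookup f []       []       u l h = refl
map-lookup f (a ∷ as) (b ∷ bs) u l h = cong₂ _∷_ (h (lookup-hit a b (L.zip as bs)))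
  (map-lookup f as bs (unique-tail u) (suc-injective l) λ {x} e → h (trans (lookup-miss b (L.zip as bs)
    λ { refl → unique-head u (proj₁ (zip-∈ as bs (lookup-∈ (L.zip as bs) e))) }) e))

module _ (k : ℕ) (ps : List (Atom × Atom)) (s c : Atom) where
  chain-stop : lookupₐ ps c ≡ nothing → chain (suc k) ps s c ≡ c ∷ []
  chain-stop e rewrite e = refl

  chain-close : lookupₐ ps c ≡ just s → chain (suc k) ps s c ≡ c ∷ []
  chain-close e rewrite e | dec-true (s ≟ s) refl = refl

  chain-next : ∀ {d} → lookupₐ ps c ≡ just d → d ≢ s → chain (suc k) ps s c ≡ c ∷ chain k ps s d
  chain-next {d} e d≢s rewrite e | dec-false (d ≟ s) d≢s = refl

-- Chains of an injection, and the correctness of `Ψ`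

module Chains (as bs : List Atom) (as-unique : Unique as) (bs-unique : Unique bs)
              (same-length : length as ≡ length bs) where

  ps : List (Atom × Atom)
  ps = L.zip as bs

  infix 4 _↝_
  _↝_ : Atom → Atom → Set
  x ↝ y = lookupₐ ps x ≡ just y

  ↝-functional : ∀ {x y z} → x ↝ y → x ↝ z → y ≡ z
  ↝-functional p q = just-injective (trans (sym p) q)

  ↝-injective : ∀ {x y z} → x ↝ z → y ↝ z → x ≡ y
  ↝-injective = lookup-injective as bs bs-unique

  ↝-total : ∀ {x} → x ∈ as → ∃[ y ] x ↝ y
  ↝-total = lookup-zip⁺ as bs same-length

  ↝-source : ∀ {x y} → x ↝ y → x ∈ as
  ↝-source p = proj₁ (zip-∈ as bs (lookup-∈ ps p))

  ↝-target : ∀ {x y} → x ↝ y → y ∈ bs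
  ↝-target p = proj₂ (zip-∈ as bs (lookup-∈ ps p))

  length-ps : length ps ≡ length as
  length-ps = go as bs same-length
    where
    go : ∀ (xs ys : List Atom) → length xs ≡ length ys → length (L.zip xs ys) ≡ length xs
    go []       []       l = refl
    go (x ∷ xs) (y ∷ ys) l = cong suc (go xs ys (suc-injective l))

  -- c ∷ ys is the chain of c up to its end, or to an element that is mapped to s
  data Orbit (s : Atom) : Atom → List Atom → Set where
    stop  : ∀ {c} → lookupₐ ps c ≡ nothing → Orbit s c []
    close : ∀ {c} → c ↝ s → Orbit s c []
    next  : ∀ {c d ys} → c ↝ d → Orbit s d ys → Orbit s c (d ∷ ys)

  record ChainOf (k : ℕ) (s c : Atom) (vis : List Atom) : Set where
    field
      {ys}     : List Atom
      chain≡   : chain k ps s c ≡ c ∷ ys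
      orbit    : Orbit s c ys
      unique   : Unique (c ∷ ys)
      disjoint : ∀ {x} → x ∈ c ∷ ys → x ∉ vis

  -- Fuel and `vis`, the elements already passed, together count `as`. So when the fuel is used up,
  -- `vis` exhausts `as`, and `c`, being new, has no successor. By the last hypothesis every element
  -- reached other than `s` has a predecessor in `vis`; hence, by injectivity, the chain can return
  -- only to `s`.
  chain-orbit : ∀ k s c vis → Unique (c ∷ vis) → (∀ {x} → x ∈ vis → x ∈ as) → k + length vis ≡ length as →
                (∀ {y} → y ∈ c ∷ vis → y ≡ s ⊎ ∃[ x ] x ∈ vis × x ↝ y) → ChainOf k s c vis
  chain-orbit zero s c vis u vis⊆ l inv = record
    { chain≡ = refl ; orbit = stop end ; unique = [] ∷ [] ; disjoint = λ { (here refl) → unique-head u } }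
    where
    c∉ : c ∉ as
    c∉ p = <-irrefl refl (≤-trans (s≤s (≤-reflexive (sym l)))
             (pigeonhole (c ∷ vis) as u λ { (here refl) → p ; (there q) → vis⊆ q }))
    end : lookupₐ ps c ≡ nothing
    end = lookup-∉ as bs c∉
  chain-orbit (suc k) s c vis u vis⊆ l inv with lookupₐ ps c in e
  ... | nothing = record
    { chain≡ = chain-stop k ps s c e ; orbit = stop e ; unique = [] ∷ [] ; disjoint = λ { (here refl) → unique-head u } }
  ... | just d with d ≟ s
  ... | yes refl = record
    { chain≡ = chain-close k ps d c e ; orbit = close e ; unique = [] ∷ [] ; disjoint = λ { (here refl) → unique-head u } }
  ... | no d≢s = record
    { chain≡ = trans (chain-next k ps s c e d≢s) (cong (c ∷_) R.chain≡) ; orbit = next e R.orbit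
    ; unique = unique-∷ (λ p → R.disjoint p (here refl)) R.unique
    ; disjoint = λ { (here refl) → unique-head u ; (there p) → R.disjoint p ∘ there } }
    where
    d∉ : d ∉ c ∷ vis
    d∉ p with inv p
    ... | inj₁ d≡s = d≢s d≡s
    ... | inj₂ (x , q , x↝d) with refl ← ↝-injective x↝d e = unique-head u q
    inv′ : ∀ {y} → y ∈ d ∷ c ∷ vis → y ≡ s ⊎ ∃[ x ] x ∈ c ∷ vis × x ↝ y
    inv′ (here refl) = inj₂ (c , here refl , e)
    inv′ (there q) with inv q
    ... | inj₁ r = inj₁ r
    ... | inj₂ (x , r , x↝y) = inj₂ (x , there r , x↝y)
    vis⊆′ : ∀ {x} → x ∈ c ∷ vis → x ∈ as
    vis⊆′ (here refl) = ↝-source e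
    vis⊆′ (there q)   = vis⊆ q
    module R = ChainOf (chain-orbit k s d (c ∷ vis) (unique-∷ d∉ u) vis⊆′ (trans (+-suc k _) l) inv′)

  -- All swappings share the pivot `s`, and the one with `d` acts first. It sends `d` to the pivot,
  -- and the next one sends the pivot on to the successor of `d`; if `d` closes the cycle, the pivot
  -- itself is that successor.
  cycle-next : ∀ {s d x y} ys → Orbit s d ys → s ∉ d ∷ ys → Unique (d ∷ ys) → x ∈ d ∷ ys → x ↝ y →
               cyclePerm (s ∷ d ∷ ys) ·ₐ x ≡ y
  cycle-next {s} {d} [] (stop e) s∉ u (here refl) x↝y with () ← trans (sym e) x↝y
  cycle-next {s} {d} [] (close e) s∉ u (here refl) x↝y =
    trans (cycle-∷ s d [] d) (trans (swap-right s d) (↝-functional e x↝y))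
  cycle-next {s} {d} (d′ ∷ ys) (next e o) s∉ u (here refl) x↝y =
    trans (cycle-∷ s d (d′ ∷ ys) d) (trans (cong (cyclePerm (s ∷ d′ ∷ ys) ·ₐ_) (swap-right s d))
      (trans (cycle-start s d′ ys (unique-∷ (s∉ ∘ there) (unique-tail u))) (↝-functional e x↝y)))
  cycle-next {s} {d} {x} (d′ ∷ ys) (next e o) s∉ u (there p) x↝y =
    trans (cycle-∷ s d (d′ ∷ ys) x) (trans (cong (cyclePerm (s ∷ d′ ∷ ys) ·ₐ_)
        (swap-other (λ { refl → s∉ (there p) }) λ { refl → unique-head u p }))
      (cycle-next ys o (s∉ ∘ there) (unique-tail u) p x↝y))

  cycle-orbit : ∀ {c x y} ys → Orbit c c ys → Unique (c ∷ ys) → x ∈ c ∷ ys → x ↝ y →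
                cyclePerm (c ∷ ys) ·ₐ x ≡ y
  cycle-orbit [] (stop e)  u (here refl) x↝y with () ← trans (sym e) x↝y
  cycle-orbit [] (close e) u (here refl) x↝y = ↝-functional e x↝y
  cycle-orbit {c} (d ∷ ys) (next e o) u (here refl) x↝y = trans (cycle-start c d ys u) (↝-functional e x↝y)
  cycle-orbit (d ∷ ys) (next e o) u (there p) x↝y = cycle-next ys o (unique-head u) (unique-tail u) p x↝y

  orbit-pred : ∀ {s c ys y} → Orbit s c ys → y ∈ ys → ∃[ x ] x ∈ c ∷ ys × x ↝ y
  orbit-pred (next e o) (here refl) = _ , here refl , e
  orbit-pred (next e o) (there p) with x , q , r ← orbit-pred o p = x , there q , r

  orbit-end : ∀ {s c ys} → Orbit s c ys →
              (∃[ x ] x ∈ c ∷ ys × x ↝ s) ⊎ (∃[ x ] x ∈ c ∷ ys × lookupₐ ps x ≡ nothing)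
  orbit-end (stop e)  = inj₂ (_ , here refl , e)
  orbit-end (close e) = inj₁ (_ , here refl , e)
  orbit-end (next e o) with orbit-end o
  ... | inj₁ (x , p , q) = inj₁ (x , there p , q)
  ... | inj₂ (x , p , q) = inj₂ (x , there p , q)

  orbit-succ : ∀ {s c ys x y} → Orbit s c ys → x ∈ c ∷ ys → x ↝ y → y ≡ s ⊎ y ∈ ys
  orbit-succ (stop e)   (here refl) x↝y with () ← trans (sym e) x↝y
  orbit-succ (close e)  (here refl) x↝y = inj₁ (↝-functional x↝y e)
  orbit-succ (next e o) (here refl) x↝y = inj₂ (here (↝-functional x↝y e))
  orbit-succ (next e o) (there p) x↝y with orbit-succ o p x↝y
  ... | inj₁ q = inj₁ q
  ... | inj₂ q = inj₂ (there q)

  -- Both hold of a union of complete chains. Backward closure of `seen` keeps a chain that starts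
  -- outside from running into it; forward closure serves to count the remaining elements.
  BackwardClosed ForwardClosed : List Atom → Set
  BackwardClosed xs = ∀ {x y} → x ↝ y → y ∈ xs → x ∈ xs
  ForwardClosed xs = ∀ {x y} → x ↝ y → x ∈ xs → y ∈ xs

  ++-backward : ∀ {xs ys} → BackwardClosed xs → BackwardClosed ys → BackwardClosed (xs ++ ys)
  ++-backward {xs} f g e p with ∈-++⁻ xs p
  ... | inj₁ q = ∈-++⁺ˡ (f e q)
  ... | inj₂ q = ∈-++⁺ʳ xs (g e q)

  ++-forward : ∀ {xs ys} → ForwardClosed xs → ForwardClosed ys → ForwardClosed (xs ++ ys)
  ++-forward {xs} f g e p with ∈-++⁻ xs p
  ... | inj₁ q = ∈-++⁺ˡ (f e q)
  ... | inj₂ q = ∈-++⁺ʳ xs (g e q)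

  cyc : Atom → List Atom
  cyc c = chain (length ps) ps c c

  chainOf : ∀ c → ChainOf (length ps) c c []
  chainOf c = chain-orbit (length ps) c c [] ([] ∷ []) (λ ()) (trans (+-identityʳ _) length-ps)
                λ { (here refl) → inj₁ refl }

  module Cyc (c : Atom) where
    open ChainOf (chainOf c) public

    c∈ : c ∈ cyc c
    c∈ = subst (c ∈_) (sym chain≡) (here refl)

    maps : ∀ {x y} → x ∈ cyc c → x ↝ y → cyclePerm (cyc c) ·ₐ x ≡ y
    maps p e rewrite chain≡ = cycle-orbit ys orbit unique p e

    fixes : ∀ {x} → x ∉ cyc c → cyclePerm (cyc c) ·ₐ x ≡ x
    fixes x∉ rewrite chain≡ = cycle-fix c ys x∉

    forward : ForwardClosed (cyc c)
    forward e p rewrite chain≡ with orbit-succ orbit p e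
    ... | inj₁ refl = here refl
    ... | inj₂ q    = there q

    backward : (∀ {x} → x ↝ c → x ∈ cyc c) → BackwardClosed (cyc c)
    backward h e p rewrite chain≡ with p
    ... | here refl = h e
    ... | there q with x , r , x↝y ← orbit-pred orbit q with refl ← ↝-injective e x↝y = r

    disjoint-from : ∀ {seen} → BackwardClosed seen → c ∉ seen → ∀ {x} → x ∈ cyc c → x ∉ seen
    disjoint-from {seen} bc c∉ p rewrite chain≡ = go orbit c∉ p
      where
      go : ∀ {d ys x} → Orbit c d ys → d ∉ seen → x ∈ d ∷ ys → x ∉ seen
      go o d∉ (here refl) = d∉
      go (next e o) d∉ (there p) = go o (d∉ ∘ bc e) p

  Π : List Atom → List Atom → Perm
  Π seen cs = L.concatMap cyclePerm (chains ps seen cs)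

  record Correct (seen cs : List Atom) : Set where
    field
      fixes : ∀ {x} → x ∈ seen → Π seen cs ·ₐ x ≡ x
      maps  : ∀ {x y} → x ↝ y → x ∉ seen → x ∈ cs → Π seen cs ·ₐ x ≡ y

  correct-[] : ∀ seen → Correct seen []
  correct-[] seen = record { fixes = λ _ → refl ; maps = λ _ _ () }

  Π-seen : ∀ {seen c} cs → c ∈ seen → Π seen (c ∷ cs) ≡ Π seen cs
  Π-seen {seen} {c} cs c∈ with c ∈? seen
  ... | yes _ = refl
  ... | no c∉ = ⊥-elim (c∉ c∈)

  Π-unseen : ∀ {seen c} cs → c ∉ seen → Π seen (c ∷ cs) ≡ cyclePerm (cyc c) ++ Π (cyc c ++ seen) cs
  Π-unseen {seen} {c} cs c∉ with c ∈? seen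
  ... | yes c∈ = ⊥-elim (c∉ c∈)
  ... | no _   = refl

  correct-seen : ∀ {seen c} cs → c ∈ seen → Correct seen cs → Correct seen (c ∷ cs)
  correct-seen {seen} cs c∈ K = record
    { fixes = λ {x} p → trans (cong (_·ₐ x) (Π-seen cs c∈)) (Correct.fixes K p)
    ; maps  = λ { {x} e x∉ (here refl) → ⊥-elim (x∉ c∈)
                ; {x} e x∉ (there p) → trans (cong (_·ₐ x) (Π-seen cs c∈)) (Correct.maps K e x∉ p) } }

  -- The cycle of `c` acts after the later ones. Those fix its atoms, which count as seen from then
  -- on; and it fixes the images that they produce, since an image in the cycle would, by backward
  -- closure, have its source there too.
  correct-unseen : ∀ {seen c} cs → c ∉ seen → BackwardClosed seen → BackwardClosed (cyc c) →
                   Correct (cyc c ++ seen) cs → Correct seen (c ∷ cs)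
  correct-unseen {seen} {c} cs c∉ bc bc′ K = record { fixes = fixes′ ; maps = maps′ }
    where
    open Cyc c
    unfold : ∀ x → Π seen (c ∷ cs) ·ₐ x ≡ cyclePerm (cyc c) ·ₐ Π (cyc c ++ seen) cs ·ₐ x
    unfold x = trans (cong (_·ₐ x) (Π-unseen cs c∉)) (·ₐ-++ (cyclePerm (cyc c)) _ x)
    fixes′ : ∀ {x} → x ∈ seen → Π seen (c ∷ cs) ·ₐ x ≡ x
    fixes′ {x} p = trans (unfold x) (trans (cong (cyclePerm (cyc c) ·ₐ_) (Correct.fixes K (∈-++⁺ʳ (cyc c) p)))
                     (fixes λ q → disjoint-from bc c∉ q p))
    maps′ : ∀ {x y} → x ↝ y → x ∉ seen → x ∈ c ∷ cs → Π seen (c ∷ cs) ·ₐ x ≡ y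
    maps′ {x} {y} e x∉ p with x ∈? cyc c
    ... | yes q = trans (unfold x)
                    (trans (cong (cyclePerm (cyc c) ·ₐ_) (Correct.fixes K (∈-++⁺ˡ q))) (maps q e))
    ... | no x∉cyc with p
    ... | here refl = ⊥-elim (x∉cyc c∈)
    ... | there p′ = trans (unfold x) (trans
            (cong (cyclePerm (cyc c) ·ₐ_) (Correct.maps K e (λ q → case (∈-++⁻ (cyc c) q)) p′))
            (fixes (x∉cyc ∘ bc′ e)))
      where
      case : ¬ (x ∈ cyc c ⊎ x ∈ seen)
      case (inj₁ q) = x∉cyc q
      case (inj₂ q) = x∉ q

  -- Once the open chains have been found, the remaining as are among the
  -- remaining bs; as there are equally many of them, they are the same.
  closes : ∀ {seen} → BackwardClosed seen → ForwardClosed seen → (∀ {x} → x ∈ as → x ∉ bs → x ∈ seen) →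
           ∀ {y} → y ∈ bs → y ∉ seen → y ∈ as
  closes {seen} bc fc open⊆ {y} y∈bs y∉ with y ∈? as
  ... | yes p = p
  -- Otherwise `y` and the unseen elements of `as` would all be among the images of those elements,
  -- which are one fewer.
  ... | no y∉as = ⊥-elim (<-irrefl refl (≤-trans
          (pigeonhole (y ∷ as′) (L.map img as′) (unique-∷ (y∉as ∘ proj₁ ∘ as′⁻) as′-unique) ⊆img)
          (≤-reflexive (length-map img as′))))
    where
    as′ = L.filter (λ a → ¬? (a ∈? seen)) as
    as′-unique : Unique as′
    as′-unique = filter⁺ (λ a → ¬? (a ∈? seen)) as-unique
    as′⁺ : ∀ {x} → x ∈ as → x ∉ seen → x ∈ as′
    as′⁺ = ∈-filter⁺ (λ a → ¬? (a ∈? seen))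
    as′⁻ : ∀ {x} → x ∈ as′ → x ∈ as × x ∉ seen
    as′⁻ = ∈-filter⁻ (λ a → ¬? (a ∈? seen))
    img : Atom → Atom
    img x = fromMaybe x (lookupₐ ps x)
    preimage : ∀ {z} (xs ys : List Atom) → length xs ≡ length ys → z ∈ ys → Unique xs →
               ∃[ x ] lookupₐ (L.zip xs ys) x ≡ just z
    preimage (x ∷ xs) (z ∷ ys) l (here refl) u = x , lookup-hit x z (L.zip xs ys)
    preimage (x ∷ xs) (z ∷ ys) l (there p) u with w , e ← preimage xs ys (suc-injective l) p (unique-tail u) =
      w , trans (lookup-miss z (L.zip xs ys)
            λ { refl → unique-head u (proj₁ (zip-∈ xs ys (lookup-∈ (L.zip xs ys) e))) }) e
    hit : ∀ {z} → z ∈ bs → z ∉ seen → z ∈ L.map img as′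
    hit {z} z∈ z∉ with x , e ← preimage as bs same-length z∈ as-unique =
      subst (_∈ L.map img as′) (cong (fromMaybe x) e) (∈-map⁺ img (as′⁺ (↝-source e) (z∉ ∘ fc e)))
    ⊆img : ∀ {x} → x ∈ y ∷ as′ → x ∈ L.map img as′
    ⊆img (here refl) = hit y∈bs y∉
    ⊆img {x} (there p) with x∈ , x∉ ← as′⁻ p with x ∈? bs
    ... | yes x∈bs = hit x∈bs x∉
    ... | no x∉bs  = ⊥-elim (x∉ (open⊆ x∈ x∉bs))

  -- By `closes` every remaining orbit stays inside `as`, so it cannot stop and has to return to its
  -- start. This return provides the predecessor that backward closure asks for.
  correct-closed : ∀ seen cs → (∀ {x} → x ∈ cs → x ∈ as) → BackwardClosed seen → ForwardClosed seen →
                   (∀ {x} → x ∈ as → x ∉ bs → x ∈ seen) → Correct seen cs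
  correct-closed seen [] cs⊆ bc fc open⊆ = correct-[] seen
  correct-closed seen (c ∷ cs) cs⊆ bc fc open⊆ with c ∈? seen
  ... | yes c∈ = correct-seen cs c∈ (correct-closed seen cs (cs⊆ ∘ there) bc fc open⊆)
  ... | no c∉  = correct-unseen cs c∉ bc bc′
      (correct-closed (cyc c ++ seen) cs (cs⊆ ∘ there) (++-backward bc′ bc) (++-forward forward fc)
        (λ p q → ∈-++⁺ʳ (cyc c) (open⊆ p q)))
    where
    open Cyc c
    orbit⊆as : ∀ {x} → x ∈ c ∷ ys → x ∈ as
    orbit⊆as (here refl) = cs⊆ (here refl)
    orbit⊆as {x} (there q) = closes bc fc open⊆ (↝-target (proj₂ (proj₂ (orbit-pred orbit q))))
                               (disjoint-from bc c∉ (subst (x ∈_) (sym chain≡) (there q)))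
    closed : ∃[ x ] x ∈ c ∷ ys × x ↝ c
    closed with orbit-end orbit
    ... | inj₁ h = h
    ... | inj₂ (x , p , e) with () ← trans (sym e) (proj₂ (↝-total (orbit⊆as p)))
    bc′ : BackwardClosed (cyc c)
    bc′ = backward λ {x} x↝c → let w , p , w↝c = closed in
      subst (x ∈_) (sym chain≡) (subst (_∈ c ∷ ys) (↝-injective w↝c x↝c) p)

  -- A start that is no element of `bs` has no predecessor, so its chain is backward closed at once.
  -- This is what the order of the starting points in `Ψ` achieves: a chain entered in the middle
  -- would not be.
  correct-open : ∀ seen cs → (∀ {x} → x ∈ cs → x ∉ bs) → BackwardClosed seen → ForwardClosed seen →
                 (∀ {x} → x ∈ as → x ∉ bs → x ∈ seen ⊎ x ∈ cs) → Correct seen (cs ++ as)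
  correct-open seen [] cs∉ bc fc open⊆ = correct-closed seen as id bc fc (λ p q → case (open⊆ p q))
    where
    case : ∀ {x} → x ∈ seen ⊎ x ∈ [] → x ∈ seen
    case (inj₁ p) = p
  correct-open seen (c ∷ cs) cs∉ bc fc open⊆ with c ∈? seen
  ... | yes c∈ = correct-seen (cs ++ as) c∈ (correct-open seen cs (cs∉ ∘ there) bc fc (λ p q → case (open⊆ p q)))
    where
    case : ∀ {x} → x ∈ seen ⊎ x ∈ c ∷ cs → x ∈ seen ⊎ x ∈ cs
    case (inj₁ p)           = inj₁ p
    case (inj₂ (here refl)) = inj₁ c∈
    case (inj₂ (there p))   = inj₂ p
  ... | no c∉ = correct-unseen (cs ++ as) c∉ bc bc′
      (correct-open (cyc c ++ seen) cs (cs∉ ∘ there) (++-backward bc′ bc) (++-forward forward fc)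
        (λ p q → case (open⊆ p q)))
    where
    open Cyc c
    bc′ : BackwardClosed (cyc c)
    bc′ = backward λ x↝c → ⊥-elim (cs∉ (here refl) (↝-target x↝c))
    case : ∀ {x} → x ∈ seen ⊎ x ∈ c ∷ cs → x ∈ cyc c ++ seen ⊎ x ∈ cs
    case (inj₁ p)           = inj₁ (∈-++⁺ʳ (cyc c) p)
    case (inj₂ (here refl)) = inj₁ (∈-++⁺ˡ c∈)
    case (inj₂ (there p))   = inj₂ p

  Ψ-maps : ∀ {x y} → x ↝ y → Ψ as bs ·ₐ x ≡ y
  Ψ-maps {x} e = Correct.maps (correct-open [] opens (proj₂ ∘ opens⁻) (λ _ ()) (λ _ ()) (λ p q → inj₂ (opens⁺ p q)))
                   e (λ ()) (∈-++⁺ʳ opens (↝-source e))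
    where
    opens = L.filter (λ a → ¬? (a ∈? bs)) as
    opens⁺ : ∀ {x} → x ∈ as → x ∉ bs → x ∈ opens
    opens⁺ = ∈-filter⁺ (λ a → ¬? (a ∈? bs))
    opens⁻ : ∀ {x} → x ∈ opens → x ∈ as × x ∉ bs
    opens⁻ = ∈-filter⁻ (λ a → ¬? (a ∈? bs))

Ψ-correct : ∀ as bs → Unique as → Unique bs → length as ≡ length bs → L.map (Ψ as bs ·ₐ_) as ≡ bs
Ψ-correct as bs u v l = map-lookup (Ψ as bs ·ₐ_) as bs u l (Chains.Ψ-maps as bs u v l)

-- Dividing arguments into swappings and explicit substitutions

module Splitting (S : Signature) where
  open Terms S

  -- More liberal than the graph of `split`: `kept` covers every pair, repeated atoms included, so
  -- that inductions have three cases instead of one for each constructor of `NTerm`.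
  data Split : List Atom → List (Atom × NTerm) → Perm → List (Atom × NTerm) → Set where
    done    : ∀ {used} → Split used [] [] []
    swapped : ∀ {used a b ps π ρ} → b ∉ used → Split (b ∷ used) ps π ρ →
           Split used ((a , atom b) ∷ ps) ((a , b) ∷ π) ρ
    kept    : ∀ {used a t ps π ρ} → Split used ps π ρ → Split used ((a , t) ∷ ps) π ((a , t) ∷ ρ)

  split-graph : ∀ used ps → Split used ps (proj₁ (split used ps)) (proj₂ (split used ps))
  split-graph used [] = done
  split-graph used ((a , atom b) ∷ ps) with b ∈? used
  ... | yes _ = kept (split-graph used ps)
  ... | no b∉ = swapped b∉ (split-graph (b ∷ used) ps)
  split-graph used ((a , susp _ _) ∷ ps) = kept (split-graph used ps)
  split-graph used ((a , abs _ _) ∷ ps)  = kept (split-graph used ps)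
  split-graph used ((a , fun _ _) ∷ ps)  = kept (split-graph used ps)
  split-graph used ((a , tup _) ∷ ps)    = kept (split-graph used ps)

  split-⊆ : ∀ {used ps π ρ} → Split used ps π ρ → ∀ {p} → p ∈ ρ → p ∈ ps
  split-⊆ (swapped _ s) p         = there (split-⊆ s p)
  split-⊆ (kept s) (here refl) = here refl
  split-⊆ (kept s) (there p)   = there (split-⊆ s p)

  dom : List (Atom × NTerm) → List Atom
  dom = L.map proj₁

  apply : List (Atom × NTerm) → Atom → NTerm
  apply ρ x = fromMaybe (atom x) (lookupₐ ρ x)

  ∈-dom : ∀ {a : Atom} {t : NTerm} {ps} → (a , t) ∈ ps → a ∈ dom ps
  ∈-dom = ∈-map⁺ proj₁

  lookup-∉dom : ∀ {x} (ρ : List (Atom × NTerm)) → x ∉ dom ρ → lookupₐ ρ x ≡ nothing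
  lookup-∉dom []            x∉ = refl
  lookup-∉dom ((a , t) ∷ ρ) x∉ = trans (lookup-miss t ρ (x∉ ∘ here)) (lookup-∉dom ρ (x∉ ∘ there))

  module _ (A : List Atom) where

    -- The list `A` will be `Φ l Z`, bound in `l`, whereas the atoms among the arguments are bound
    -- in `r`.
    Admissible : List (Atom × NTerm) → Set
    Admissible ps = ∀ {a t} → (a , t) ∈ ps → a ∈ A × (∀ {b} → t ≡ atom b → b ∉ A)

    split-fix : ∀ {used ps π ρ z} → Split used ps π ρ → Admissible ps → z ∉ dom ps → z ∈ used ⊎ z ∈ A → π ·ₐ z ≡ z
    split-fix done ok z∉ h = refl
    split-fix {z = z} (swapped {a = a} {b} {π = π} b∉ s) ok z∉ h =
      trans (cong (swapₐ a b) (split-fix s (ok ∘ there) (z∉ ∘ there) (weaken h))) (swap-other (z∉ ∘ here) (z≢b h))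
      where
      weaken : z ∈ _ ⊎ z ∈ A → z ∈ b ∷ _ ⊎ z ∈ A
      weaken (inj₁ p) = inj₁ (there p)
      weaken (inj₂ p) = inj₂ p
      z≢b : z ∈ _ ⊎ z ∈ A → z ≢ b
      z≢b (inj₁ p) refl = b∉ p
      z≢b (inj₂ p) refl = proj₂ (ok (here refl)) refl p
    split-fix (kept s) ok z∉ h = split-fix s (ok ∘ there) (z∉ ∘ there) h

    -- The first swapping in the list acts last. It moves `a`, fixed by the others, to `b`, which no
    -- substitution catches because the domain of `ρ` lies in `A`. It leaves the images of the other
    -- keys alone: the rest of the permutation is injective and fixes both `a` and `b`.
    split-correct : ∀ {used ps π ρ} → Split used ps π ρ → Admissible ps → Unique (dom ps) →
                    ∀ {a t} → (a , t) ∈ ps → apply ρ (π ·ₐ a) ≡ t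
    split-correct {ρ = ρ} (swapped {a = a} {b} {π = π} b∉ s) ok u (here refl) =
      trans (cong (apply ρ) moved) (cong (fromMaybe (atom b)) (lookup-∉dom ρ b∉ρ))
      where
      moved : swapₐ a b (π ·ₐ a) ≡ b
      moved = trans (cong (swapₐ a b) (split-fix s (ok ∘ there) (unique-head u) (inj₂ (proj₁ (ok (here refl))))))
                    (swap-left a b)
      b∉ρ : b ∉ dom ρ
      b∉ρ p with (a′ , t′) , q , refl ← ∈-map⁻ proj₁ p =
        proj₂ (ok (here refl)) refl (proj₁ (ok (there (split-⊆ s q))))
    split-correct {ρ = ρ} (swapped {a = a} {b} {π = π} b∉ s) ok u {a′} (there p) =
      trans (cong (apply ρ) (swap-other ≢a ≢b)) (split-correct s (ok ∘ there) (unique-tail u) p)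
      where
      ≢a : π ·ₐ a′ ≢ a
      ≢a e with refl ← ·ₐ-injective π (trans e (sym (split-fix s (ok ∘ there) (unique-head u)
                                                      (inj₂ (proj₁ (ok (here refl)))))))
        = unique-head u (∈-dom p)
      b∉A : b ∉ A
      b∉A = proj₂ (ok (here refl)) refl
      b∉dom : b ∉ dom _
      b∉dom q with (a″ , t″) , q′ , refl ← ∈-map⁻ proj₁ q = b∉A (proj₁ (ok (there q′)))
      ≢b : π ·ₐ a′ ≢ b
      ≢b e with refl ← ·ₐ-injective π (trans e (sym (split-fix s (ok ∘ there) b∉dom (inj₁ (here refl)))))
        = b∉A (proj₁ (ok (there p)))
    split-correct (kept {a = a} {t} {π = π} {ρ} s) ok u (here refl) =
      cong₂ fromMaybe (cong atom fixed) (trans (cong (lookupₐ ((a , t) ∷ ρ)) fixed) (lookup-hit a t ρ))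
      where
      fixed : π ·ₐ a ≡ a
      fixed = split-fix s (ok ∘ there) (unique-head u) (inj₂ (proj₁ (ok (here refl))))
    split-correct (kept {a = a} {t} {π = π} {ρ} s) ok u {a′} (there p) =
      trans (cong (fromMaybe _) (lookup-miss t ρ ≢a)) (split-correct s (ok ∘ there) (unique-tail u) p)
      where
      ≢a : π ·ₐ a′ ≢ a
      ≢a e with refl ← ·ₐ-injective π (trans e (sym (split-fix s (ok ∘ there) (unique-head u)
                                                      (inj₂ (proj₁ (ok (here refl)))))))
        = unique-head u (∈-dom p)

-- Rewriting and explicit substitution

module Rewriting (S : Signature) where
  open Signature S
  open Terms S

  atoms-rename  : ∀ ρ ξ t → atoms (rename ρ ξ t) ≡ L.map ρ (atoms t)
  atoms*-rename : ∀ {n} ρ ξ (ts : Vec NTerm n) → atoms* (rename* ρ ξ ts) ≡ L.map ρ (atoms* ts)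
  atoms-rename ρ ξ (atom a)   = refl
  atoms-rename ρ ξ (susp π X) = go π
    where
    go : ∀ π → permAtoms (L.map (λ (a , b) → ρ a , ρ b) π) ≡ L.map ρ (permAtoms π)
    go []      = refl
    go (_ ∷ π) = cong (λ xs → _ ∷ _ ∷ xs) (go π)
  atoms-rename ρ ξ (abs a t)  = cong (ρ a ∷_) (atoms-rename ρ ξ t)
  atoms-rename ρ ξ (fun f t)  = atoms-rename ρ ξ t
  atoms-rename ρ ξ (tup ts)   = atoms*-rename ρ ξ ts
  atoms*-rename ρ ξ []       = refl
  atoms*-rename ρ ξ (t ∷ ts) =
    trans (cong₂ _++_ (atoms-rename ρ ξ t) (atoms*-rename ρ ξ ts)) (sym (map-++ ρ (atoms t) _))

  vars-rename  : ∀ ρ ξ t → vars (rename ρ ξ t) ≡ L.map ξ (vars t)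
  vars*-rename : ∀ {n} ρ ξ (ts : Vec NTerm n) → vars* (rename* ρ ξ ts) ≡ L.map ξ (vars* ts)
  vars-rename ρ ξ (atom a)   = refl
  vars-rename ρ ξ (susp π X) = refl
  vars-rename ρ ξ (abs a t)  = vars-rename ρ ξ t
  vars-rename ρ ξ (fun f t)  = vars-rename ρ ξ t
  vars-rename ρ ξ (tup ts)   = vars*-rename ρ ξ ts
  vars*-rename ρ ξ []       = refl
  vars*-rename ρ ξ (t ∷ ts) =
    trans (cong₂ _++_ (vars-rename ρ ξ t) (vars*-rename ρ ξ ts)) (sym (map-++ ξ (vars t) _))

  map-++₃ : {A B : Set} (f : A → B) (xs ys zs : List A) →
            L.map f (xs ++ ys ++ zs) ≡ L.map f xs ++ L.map f ys ++ L.map f zs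
  map-++₃ f xs ys zs = trans (map-++ f xs _) (cong (L.map f xs ++_) (map-++ f ys zs))

  ruleAtoms-rename : ∀ ρ ξ R → ruleAtoms (renameRule ρ ξ R) ≡ L.map ρ (ruleAtoms R)
  ruleAtoms-rename ρ ξ (∇ ⊢ l ⟶ r) = trans
    (cong₂ _++_ (trans (sym (map-∘ ∇)) (map-∘ ∇)) (cong₂ _++_ (atoms-rename ρ ξ l) (atoms-rename ρ ξ r)))
    (sym (map-++₃ ρ (ctxAtoms ∇) (atoms l) (atoms r)))

  ruleVars-rename : ∀ ρ ξ R → ruleVars (renameRule ρ ξ R) ≡ L.map ξ (ruleVars R)
  ruleVars-rename ρ ξ (∇ ⊢ l ⟶ r) = trans
    (cong₂ _++_ (trans (sym (map-∘ ∇)) (map-∘ ∇)) (cong₂ _++_ (vars-rename ρ ξ l) (vars-rename ρ ξ r)))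
    (sym (map-++₃ ξ (ctxVars ∇) (vars l) (vars r)))

  shifted-∉ : ∀ N xs ys → fresh ys ≤ N → ∀ {x} → x ∈ L.map (N +_) xs → x ∉ ys
  shifted-∉ N xs ys le p q with y , _ , refl ← ∈-map⁻ (N +_) p =
    <-irrefl refl (<-≤-trans (fresh-> ys q) (≤-trans le (m≤m+n N y)))

  inst : ℕ → Subst → NTerm → NTerm
  inst N θ t = rename (N +_) id t ⟦ θ ⟧

  -- The variables of the copy are shifted as well; precomposing with `_∸ N` undoes this, so that a
  -- substitution can be given on the original variables.
  rename-shift  : ∀ ρ N θ t → rename ρ (N +_) t ⟦ θ ∘ (_∸ N) ⟧ ≡ rename ρ id t ⟦ θ ⟧
  rename*-shift : ∀ {n} ρ N θ (ts : Vec NTerm n) → rename* ρ (N +_) ts ⟦ θ ∘ (_∸ N) ⟧* ≡ rename* ρ id ts ⟦ θ ⟧*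
  rename-shift ρ N θ (atom a)   = refl
  rename-shift ρ N θ (susp π X) = cong (λ Y → L.map _ π · θ Y) (m+n∸m≡n N X)
  rename-shift ρ N θ (abs a t)  = cong (abs (ρ a)) (rename-shift ρ N θ t)
  rename-shift ρ N θ (fun f t)  = cong (fun f) (rename-shift ρ N θ t)
  rename-shift ρ N θ (tup ts)   = cong tup (rename*-shift ρ N θ ts)
  rename*-shift ρ N θ []       = refl
  rename*-shift ρ N θ (t ∷ ts) = cong₂ _∷_ (rename-shift ρ N θ t) (rename*-shift ρ N θ ts)

  infix 4 _≃_
  -- Equality under all environments, injective or not, is preserved by contexts, and on ground
  -- terms it implies α-equivalence.
  record _≃_ (s t : NTerm) : Set₁ where
    constructor eq
    field at : ∀ {V} (ρ : Envᴰ V) → sem s ρ ≡ sem t ρ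

  open _≃_

  -- The copy of the rule is obtained by shifting its atoms and variables by N. All large N are
  -- admitted, so that N can be chosen after t has been replaced by an α-variant.
  record Root (R : NRule) (s t : NTerm) : Set₁ where
    field
      bound : ℕ
      θ     : ℕ → Subst
      θ-ground : ∀ N X → Ground (θ N X)
      ∇θ    : ∀ {N} → bound ≤ N → ∀ {Δ} → All (λ (a , X) → Δ ⊢ N + a # θ N X) (∇ R)
      l≈    : ∀ {N} → bound ≤ N → ∀ {Δ} → Δ ⊢ inst N (θ N) (lhs R) ≈ s
      r≃    : ∀ {N} → bound ≤ N → inst N (θ N) (rhs R) ≃ t

  IsRen-var : IsRen {NSym Sym} {Atom} var
  IsRen-var x = x , refl

  Inj-var : Inj {NSym Sym} {Atom} var
  Inj-var x y = var-injective

  ≃⇒≈ : ∀ {Δ s t} → Ground s → Ground t → s ≃ t → Δ ⊢ s ≈ t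
  ≃⇒≈ {s = s} {t} g h e = sem-complete s t g h IsRen-var Inj-var (at e var)

  infixr 9 _∘ᶜ_
  _∘ᶜ_ : NContext → NContext → NContext
  □           ∘ᶜ D = D
  abs a C     ∘ᶜ D = abs a (C ∘ᶜ D)
  fun f C     ∘ᶜ D = fun f (C ∘ᶜ D)
  tup ss C ts ∘ᶜ D = tup ss (C ∘ᶜ D) ts

  plug-∘ᶜ : ∀ C D t → plugₙ (C ∘ᶜ D) t ≡ plugₙ C (plugₙ D t)
  plug-∘ᶜ □             D t = refl
  plug-∘ᶜ (abs a C)     D t = cong (abs a) (plug-∘ᶜ C D t)
  plug-∘ᶜ (fun f C)     D t = cong (fun f) (plug-∘ᶜ C D t)
  plug-∘ᶜ (tup ss C ts) D t = cong (λ u → tup (ss V.++ u ∷ ts)) (plug-∘ᶜ C D t)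

  module Reduction (𝓡 : NRule → Set) where

    infix 4 _⇝_ _⇝⁺_ _⊳_

    -- As in `Step`, the source is literally a plugged context, while the target is fixed only up to
    -- its value; `⇝-resp` can thus replace the target by an α-variant.
    record _⇝_ (s t : NTerm) : Set₁ where
      field
        {R}   : NRule
        R∈    : 𝓡 R
        C     : NContext
        {s′ t′} : NTerm
        s≡    : s ≡ plugₙ C s′
        root  : Root R s′ t′
        C-ground : Groundᶜ C
        t-ground : Ground t
        t≡    : sem (plugₙ C t′) var ≡ sem t var

    _⇝⁺_ : NTerm → NTerm → Set₁
    _⇝⁺_ = TransClosure _⇝_

    ⇝⇒closed : ∀ {s t} → s ⇝ t → ClosedStepIn [] 𝓡 s t
    ⇝⇒closed {s} {t} s⇝t = R , R∈ , record
      { ρ = N +_ ; ρ-inj = +-cancelˡ-≡ N _ _ ; ξ = N +_ ; ξ-inj = +-cancelˡ-≡ N _ _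
      ; freshAtoms = λ a p → shifted-∉ N (ruleAtoms R) as (≤-trans (m≤m⊔n (fresh as) (fresh Xs)) (m≤n⊔m bound _))
          (subst (a ∈_) (ruleAtoms-rename (N +_) (N +_) R) p)
      ; freshVars = λ X p → shifted-∉ N (ruleVars R) Xs (≤-trans (m≤n⊔m (fresh as) (fresh Xs)) (m≤n⊔m bound _))
          (subst (X ∈_) (ruleVars-rename (N +_) (N +_) R) p)
      ; step = record
        { C = C ; s′ = s′ ; s≡ = s≡ ; θ = θ N ∘ (_∸ N)
        ; ∇θ = AllP.map⁺ (All.map (λ { {a , X} p → subst (λ Y → _ ⊢ N + a # θ N Y) (sym (m+n∸m≡n N X)) p })
                           (∇θ (m≤m⊔n bound _)))
        ; l≈ = subst (λ r → Δ ⊢ r ≈ s′) (sym (rename-shift (N +_) N (θ N) (lhs R))) (l≈ (m≤m⊔n bound _))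
        ; r≈ = subst (λ r → Δ ⊢ plugₙ C r ≈ t) (sym (rename-shift (N +_) N (θ N) (rhs R)))
            (sem-complete _ t (Ground-plug⁺ C C-ground (Ground-⟦⟧ (rename (N +_) id (rhs R)) (θ-ground N)))
              t-ground IsRen-var Inj-var (trans (sem-plug C (at (r≃ (m≤m⊔n bound _))) var) t≡)) } }
      where
      open _⇝_ s⇝t
      open Root root
      as = ruleAtoms R ++ atoms s ++ atoms t
      Xs = ruleVars R ++ vars s ++ vars t
      -- `bound` serves the side conditions of the root step; the other two put the copy past all
      -- atoms and variables of `R`, `s` and `t`.
      N = bound ⊔ (fresh as ⊔ fresh Xs)
      Δ = L.cartesianProduct (ruleAtoms (renameRule (N +_) (N +_) R)) (vars s)

    ⇝⁺⇒closed : ∀ {s t} → s ⇝⁺ t → TransClosure (ClosedStepIn [] 𝓡) s t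
    ⇝⁺⇒closed Plus.[ p ] = Plus.[ ⇝⇒closed p ]
    ⇝⁺⇒closed (p ∷ ps) = ⇝⇒closed p ∷ ⇝⁺⇒closed ps

    ⇝⁺-ground : ∀ {s t} → s ⇝⁺ t → Ground t
    ⇝⁺-ground Plus.[ p ] = _⇝_.t-ground p
    ⇝⁺-ground (_ ∷ ps) = ⇝⁺-ground ps

    ⇝-resp : ∀ {s t t′} → s ⇝ t → Ground t′ → sem t var ≡ sem t′ var → s ⇝ t′
    ⇝-resp p g e = record { _⇝_ p hiding (t-ground; t≡) ; t-ground = g ; t≡ = trans (_⇝_.t≡ p) e }

    ⇝⁺-resp : ∀ {s t t′} → s ⇝⁺ t → Ground t′ → sem t var ≡ sem t′ var → s ⇝⁺ t′
    ⇝⁺-resp Plus.[ p ] g e = Plus.[ ⇝-resp p g e ]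
    ⇝⁺-resp (p ∷ ps) g e = p ∷ ⇝⁺-resp ps g e

    -- Reduction in zero or more steps up to α-equivalence. Every step may end in any
    -- α-variant of its result but has to start from the given term itself, so an
    -- α-conversion is absorbed by the step before it.
    _⊳_ : NTerm → NTerm → Set₁
    s ⊳ t = ∀ C {u} → u ⇝⁺ plugₙ C s → u ⇝⁺ plugₙ C t

    ⊳-refl : ∀ {t} → t ⊳ t
    ⊳-refl C p = p

    ⊳-trans : ∀ {s t u} → s ⊳ t → t ⊳ u → s ⊳ u
    ⊳-trans p q C r = q C (p C r)

    ⊳-plug : ∀ D {s t} → s ⊳ t → plugₙ D s ⊳ plugₙ D t
    ⊳-plug D {s} {t} p C {u} r =
      subst (u ⇝⁺_) (plug-∘ᶜ C D t) (p (C ∘ᶜ D) (subst (u ⇝⁺_) (sym (plug-∘ᶜ C D s)) r))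

    ⊳-≃ : ∀ {s t} → Ground t → s ≃ t → s ⊳ t
    ⊳-≃ {s} {t} g e C r = ⇝⁺-resp r (Ground-plug⁺ C (proj₁ (Ground-plug⁻ C (⇝⁺-ground r))) g) (sem-plug C (at e) var)

    ⊳-root : ∀ {R s t} → 𝓡 R → Root R s t → Ground t → s ⊳ t
    ⊳-root R∈ root g C r = r ∷ʳ record
      { R∈ = R∈ ; C = C ; s≡ = refl ; root = root ; C-ground = C-ground
      ; t-ground = Ground-plug⁺ C C-ground g ; t≡ = refl }
      where C-ground = proj₁ (Ground-plug⁻ C (⇝⁺-ground r))

    tup-shift : ∀ {m n} (us : Vec NTerm m) t (ts : Vec NTerm n) →
                _≡_ {A = NTerm} (tup ((us V.∷ʳ t) V.++ ts)) (tup (us V.++ t ∷ ts))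
    tup-shift []       t ts = refl
    tup-shift (u ∷ us) t ts = tup-∷ u (tup-shift us t ts)

    ⊳-tup : ∀ {n} {ss ts : Vec NTerm n} → Pointwise _⊳_ ss ts → tup ss ⊳ tup ts
    ⊳-tup = go []
      where
      go : ∀ {m n} (us : Vec NTerm m) {ss ts : Vec NTerm n} → Pointwise _⊳_ ss ts → tup (us V.++ ss) ⊳ tup (us V.++ ts)
      go us [] = ⊳-refl
      go us {s ∷ ss} {t ∷ ts} (p ∷ ps) = ⊳-trans (⊳-plug (tup us □ ss) p)
        (subst₂ _⊳_ (tup-shift us t ss) (tup-shift us t ts) (go (us V.∷ʳ t) ps))

    -- Executing an explicit substitution of a pure term into a pure term

    module ExplicitSubstitution (σ∈ : ∀ {R} → ExplicitSubst R → 𝓡 R) where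

      mkRoot : ∀ {R s t} (bound : ℕ) (θ : ℕ → Subst) → (∀ N X → Ground (θ N X)) → Ground s →
               (∀ {N} → bound ≤ N → ∀ {Δ} → All (λ (a , X) → Δ ⊢ N + a # θ N X) (∇ R)) →
               (∀ {N} → bound ≤ N → inst N (θ N) (lhs R) ≃ s) →
               (∀ {N} → bound ≤ N → inst N (θ N) (rhs R) ≃ t) → Root R s t
      mkRoot {R} bound θ g h ∇θ l≃ r≃ = record
        { bound = bound ; θ = θ ; θ-ground = g ; ∇θ = ∇θ
        ; l≈ = λ {N} le → ≃⇒≈ (Ground-⟦⟧ (rename (N +_) id (lhs R)) (g N)) h (l≃ le) ; r≃ = r≃ }

      bound∉ : ∀ {N k} xs → fresh xs ≤ N → N + k ∉ xs
      bound∉ {N} {k} xs le p = <-irrefl refl (<-≤-trans (fresh-> xs p) (≤-trans le (m≤m+n N k)))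

      rename-binder : ∀ t a c (ρ : Envᴰ V) → c ∉ fv t → tsem (t ⟪ (a , var c) ∷ [] ⟫) (ext c ρ) ≡ tsem t (ext a ρ)
      rename-binder t a c ρ c∉ = trans (tsem-⟪⟫ t ((a , var c) ∷ []) (ext c ρ)) (tsem-fv t λ {x} p → case x p)
        where
        case : ∀ x → x ∈ fv t → upd a (ext c ρ c) (ext c ρ) x ≡ ext a ρ x
        case x p with x ≟ a
        ... | yes refl = trans (upd-hit x _ _) (trans (upd-hit c _ _) (sym (upd-hit x _ _)))
        ... | no x≢a   = trans (upd-miss a _ _ x≢a)
                           (trans (upd-miss c _ _ λ { refl → c∉ p }) (sym (upd-miss a _ _ x≢a)))

      ≃-sub : ∀ {a b s s′ t t′} → abs a t ≃ abs b t′ → s ≃ s′ → (t [ a ↦ s ]) ≃ (t′ [ b ↦ s′ ])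
      ≃-sub e f = eq λ ρ → cong₂ (λ x y → fun sub (tup (x ∷ y ∷ []))) (at e ρ) (at f ρ)

      ≃-refl : ∀ {t} → t ≃ t
      ≃-refl = eq λ ρ → refl

      ⌜⌝-·[] : ∀ t → ([] · t) ≃ t
      ⌜⌝-·[] t = eq (sem-· [] t)

      -- The rule abstracts a shifted atom `c`, the redex abstracts `a`; instantiating with the body
      -- renamed from `a` to `c` reconciles them.
      abs-renamed : ∀ t a c → c ∉ fv t → abs c ([] · ⌜ t ⟪ (a , var c) ∷ [] ⟫ ⌝) ≃ abs a ⌜ t ⌝
      abs-renamed t a c c∉ = eq λ ρ → cong lam (trans (sem-· [] ⌜ t ⟪ (a , var c) ∷ [] ⟫ ⌝ _) (rename-binder t a c ρ c∉))

      ⊳-σ-var : ∀ a s → atom a [ a ↦ ⌜ s ⌝ ] ⊳ ⌜ s ⌝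
      ⊳-σ-var a s = ⊳-root (σ∈ σ-var) (mkRoot 0 (λ _ _ → ⌜ s ⌝) (λ _ _ → Ground-⌜⌝ s) (tt , Ground-⌜⌝ s , tt)
        (λ _ → [])
        (λ {N} _ → ≃-sub {N + 0} {a} {t = atom (N + 0)} {atom a}
           (eq λ ρ → cong lam (trans (upd-hit (N + 0) _ _) (sym (upd-hit a _ _)))) (⌜⌝-·[] ⌜ s ⌝))
        (λ _ → ⌜⌝-·[] ⌜ s ⌝)) (Ground-⌜⌝ s)

      -- Used at atoms only, as substitutions are pushed down to the leaves. The bound `suc b` makes
      -- the copied atom `N + 0` differ from `b`.
      ⊳-σ-ε : ∀ a b s → b ≢ a → atom b [ a ↦ ⌜ s ⌝ ] ⊳ atom b
      ⊳-σ-ε a b s b≢a = ⊳-root (σ∈ σ-ε) (mkRoot (suc b) (λ _ → θ) (λ _ → λ { zero → tt ; (suc _) → Ground-⌜⌝ s })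
        (tt , Ground-⌜⌝ s , tt)
        (λ le → atom (≢b le) ∷ [])
        (λ {N} le → ≃-sub {N + 0} {a} {t = atom b} {atom b}
           (eq λ ρ → cong lam (trans (upd-miss (N + 0) _ _ (≢b le ∘ sym)) (sym (upd-miss a _ _ b≢a)))) (⌜⌝-·[] ⌜ s ⌝))
        (λ _ → eq λ ρ → refl)) tt
        where
        θ : Subst
        θ zero    = atom b
        θ (suc _) = ⌜ s ⌝
        ≢b : ∀ {N} → b < N → N + 0 ≢ b
        ≢b {N} lt refl = <-irrefl refl (≤-trans lt (m≤m+n N 0))

      ⊳-σ-fun : ∀ f t a s → fun (op f) ⌜ t ⌝ [ a ↦ ⌜ s ⌝ ] ⊳ fun (op f) (⌜ t ⌝ [ a ↦ ⌜ s ⌝ ])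
      ⊳-σ-fun f t a s = ⊳-root (σ∈ (σ-fun f)) (mkRoot (fresh (fv t)) θ
        (λ N → λ { zero → Ground-⌜⌝ s ; (suc _) → Ground-⌜⌝ (t ⟪ (a , var (N + 0)) ∷ [] ⟫) })
        (Ground-⌜⌝ t , Ground-⌜⌝ s , tt)
        (λ _ → [])
        (λ {N} le → ≃-sub {N + 0} {a} {t = fun (op f) _} {fun (op f) ⌜ t ⌝}
           (eq λ ρ → cong (lam ∘ fun (op f)) (lam-injective (at (abs-renamed t a (N + 0) (bound∉ (fv t) le)) ρ)))
           (⌜⌝-·[] ⌜ s ⌝))
        (λ {N} le → eq λ ρ → cong (fun (op f)) (at (≃-sub (abs-renamed t a (N + 0) (bound∉ (fv t) le)) (⌜⌝-·[] ⌜ s ⌝)) ρ)))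
        (Ground-⌜⌝ t , Ground-⌜⌝ s , tt)
        where
        θ : ℕ → Subst
        θ N zero    = ⌜ s ⌝
        θ N (suc _) = ⌜ t ⟪ (a , var (N + 0)) ∷ [] ⟫ ⌝

      nth : ∀ {n} → Vec NTerm n → ℕ → NTerm
      -- Out of range, where the variable does not occur in the rule; any ground term would do.
      nth []       _       = tup []
      nth (u ∷ us) zero    = u
      nth (u ∷ us) (suc k) = nth us k

      Ground-nth : ∀ {n} (us : Vec NTerm n) → Ground* us → ∀ k → Ground (nth us k)
      Ground-nth []       g       k       = tt
      Ground-nth (u ∷ us) (g , _) zero    = g
      Ground-nth (u ∷ us) (_ , g) (suc k) = Ground-nth us g k

      tabulate-nth : ∀ {n} (us : Vec NTerm n) (F : NTerm → NTerm) → V.tabulate (λ i → F (nth us (toℕ i))) ≡ V.map F us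
      tabulate-nth []       F = refl
      tabulate-nth (u ∷ us) F = cong (F u ∷_) (tabulate-nth us F)

      inst-tabulate : ∀ {n} N θ (g : Fin n → NTerm) →
                      rename* (N +_) id (V.tabulate g) ⟦ θ ⟧* ≡ V.tabulate (inst N θ ∘ g)
      inst-tabulate {zero}  N θ g = refl
      inst-tabulate {suc n} N θ g = cong (inst N θ (g zero) ∷_) (inst-tabulate N θ (g ∘ suc))

      Ground*-map-sub : ∀ {n} (ts : Vec Term n) a s → Ground* (V.map (_[ a ↦ ⌜ s ⌝ ]) ⌜ ts ⌝*)
      Ground*-map-sub []       a s = tt
      Ground*-map-sub (t ∷ ts) a s = (Ground-⌜⌝ t , Ground-⌜⌝ s , tt) , Ground*-map-sub ts a s

      ⊳-σ-tup : ∀ {n} (ts : Vec Term n) a s → tup ⌜ ts ⌝* [ a ↦ ⌜ s ⌝ ] ⊳ tup (V.map (_[ a ↦ ⌜ s ⌝ ]) ⌜ ts ⌝*)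
      ⊳-σ-tup {n} ts a s = ⊳-root (σ∈ (σ-tup n)) (mkRoot (fresh (fv* ts)) θ
        (λ N → λ { zero → Ground-⌜⌝ s ; (suc k) → Ground-nth (us N) (Ground*-⌜⌝ (ts ⟪ (a , var (N + 0)) ∷ [] ⟫*)) k })
        (Ground*-⌜⌝ ts , Ground-⌜⌝ s , tt)
        (λ _ → [])
        (λ {N} le → eq λ ρ → trans (cong (λ vs → sem (tup vs [ N + 0 ↦ [] · ⌜ s ⌝ ]) ρ)
             (trans (inst-tabulate N (θ N) _) (tabulate-nth (us N) ([] ·_))))
           (at (≃-sub {N + 0} {a} {t = tup (V.map ([] ·_) (us N))} {tup ⌜ ts ⌝*}
              (eq λ η → cong (lam ∘ tup) (bodies ts (N + 0) (bound∉ (fv* ts) le) η)) (⌜⌝-·[] ⌜ s ⌝)) ρ))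
        (λ {N} le → eq λ ρ → trans (cong (λ vs → sem (tup vs) ρ)
             (trans (inst-tabulate N (θ N) _) (tabulate-nth (us N) (λ u → ([] · u) [ N + 0 ↦ [] · ⌜ s ⌝ ]))))
           (cong tup (components ts (N + 0) (bound∉ (fv* ts) le) ρ))))
        (Ground*-map-sub ts a s)
        where
        us : ∀ N → Vec NTerm n
        us N = ⌜ ts ⟪ (a , var (N + 0)) ∷ [] ⟫* ⌝*
        θ : ℕ → Subst
        θ N zero    = ⌜ s ⌝
        θ N (suc k) = nth (us N) k
        bodies : ∀ {n} (ts : Vec Term n) c → c ∉ fv* ts → ∀ {V} (ρ : Envᴰ V) →
               sem* (V.map ([] ·_) ⌜ ts ⟪ (a , var c) ∷ [] ⟫* ⌝*) (ext c ρ) ≡ sem* ⌜ ts ⌝* (ext a ρ)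
        bodies []       c c∉ ρ = refl
        bodies (t ∷ ts) c c∉ ρ = cong₂ _∷_ (lam-injective (at (abs-renamed t a c (c∉ ∘ ∈-++⁺ˡ)) ρ))
                                          (bodies ts c (c∉ ∘ ∈-++⁺ʳ (fv t)) ρ)
        components : ∀ {n} (ts : Vec Term n) c → c ∉ fv* ts → ∀ {V} (ρ : Envᴰ V) →
                     sem* (V.map (λ u → ([] · u) [ c ↦ [] · ⌜ s ⌝ ]) ⌜ ts ⟪ (a , var c) ∷ [] ⟫* ⌝*) ρ ≡
                     sem* (V.map (_[ a ↦ ⌜ s ⌝ ]) ⌜ ts ⌝*) ρ
        components []       c c∉ ρ = refl
        components (t ∷ ts) c c∉ ρ = cong₂ _∷_
          (at (≃-sub (abs-renamed t a c (c∉ ∘ ∈-++⁺ˡ)) (⌜⌝-·[] ⌜ s ⌝)) ρ)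
          (components ts c (c∉ ∘ ∈-++⁺ʳ (fv t)) ρ)

      -- The step itself produces the binder `N + 1` of a copy whose `N` is not yet known. Freshness
      -- of `c` makes the stated result an α-variant for every large `N`.
      ⊳-σ-abs : ∀ b t a s c → c ∉ fv t → c ∉ fv s → c ≢ a →
                abs b ⌜ t ⌝ [ a ↦ ⌜ s ⌝ ] ⊳ abs c (⌜ t ⟪ (b , var c) ∷ [] ⟫ ⌝ [ a ↦ ⌜ s ⌝ ])
      ⊳-σ-abs b t a s c c∉t c∉s c≢a = ⊳-root (σ∈ σ-abs) (mkRoot (fresh (fv t ++ fv s)) θ
        (λ N → λ { zero → Ground-⌜⌝ s ; (suc _) → Ground-⌜⌝ (t′ N) })
        (Ground-⌜⌝ t , Ground-⌜⌝ s , tt)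
        (λ {N} le → #-∉fv s (∉s N 1 le) ∷ [])
        (λ {N} le → ≃-sub (left N le) (⌜⌝-·[] ⌜ s ⌝))
        (λ {N} le → eq λ ρ → cong lam (cong₂ (λ x y → fun sub (tup (lam x ∷ y ∷ []))) (right N le ρ)
          (trans (at (⌜⌝-·[] ⌜ s ⌝) _) (trans (tsem-wk s (∉s N 1 le)) (sym (tsem-wk s c∉s)))))))
        (Ground-⌜⌝ (t ⟪ (b , var c) ∷ [] ⟫) , Ground-⌜⌝ s , tt)
        where
        t′ : ℕ → Term
        -- The leftmost entry is the one used, as it has to be when `a` and `b` coincide: the inner
        -- binder shadows the outer one.
        t′ N = t ⟪ (b , var (N + 1)) ∷ (a , var (N + 0)) ∷ [] ⟫
        θ : ℕ → Subst
        θ N zero    = ⌜ s ⌝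
        θ N (suc _) = ⌜ t′ N ⌝
        ∉t : ∀ N k → fresh (fv t ++ fv s) ≤ N → N + k ∉ fv t
        ∉t N k le p = bound∉ (fv t ++ fv s) le (∈-++⁺ˡ p)
        ∉s : ∀ N k → fresh (fv t ++ fv s) ≤ N → N + k ∉ fv s
        ∉s N k le p = bound∉ (fv t ++ fv s) le (∈-++⁺ʳ (fv t) p)
        0≢1 : ∀ N → N + 0 ≢ N + 1
        0≢1 N e with () ← +-cancelˡ-≡ N 0 1 e
        left : ∀ N → fresh (fv t ++ fv s) ≤ N → abs (N + 0) (abs (N + 1) ([] · ⌜ t′ N ⌝)) ≃ abs a (abs b ⌜ t ⌝)
        left N le = eq λ ρ → let η = ext (N + 1) (ext (N + 0) ρ) in cong (lam ∘ lam) (trans (sem-· [] ⌜ t′ N ⌝ η)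
          (trans (tsem-⟪⟫ t ((b , var (N + 1)) ∷ (a , var (N + 0)) ∷ []) η) (tsem-fv t λ {x} p → case ρ x p)))
          where
          case : ∀ {V} (ρ : Envᴰ V) x → x ∈ fv t → let η = ext (N + 1) (ext (N + 0) ρ) in
                 upd b (η (N + 1)) (upd a (η (N + 0)) η) x ≡ ext b (ext a ρ) x
          case ρ x p with x ≟ b
          ... | yes refl = trans (upd-hit x _ _) (trans (upd-hit (N + 1) _ _) (sym (upd-hit x _ _)))
          ... | no x≢b with x ≟ a
          ... | yes refl = trans (upd-miss b _ _ x≢b) (trans (upd-hit x _ _) (trans (upd-miss (N + 1) _ _ (0≢1 N))
                  (trans (cong wk (upd-hit (N + 0) _ _)) (sym (trans (upd-miss b _ _ x≢b) (cong wk (upd-hit x _ _)))))))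
          ... | no x≢a = trans (upd-miss b _ _ x≢b) (trans (upd-miss a _ _ x≢a)
                  (trans (upd-miss (N + 1) _ _ λ { refl → ∉t N 1 le p })
                  (trans (cong wk (upd-miss (N + 0) _ _ λ { refl → ∉t N 0 le p }))
                    (sym (trans (upd-miss b _ _ x≢b) (cong wk (upd-miss a _ _ x≢a)))))))
        right : ∀ N → fresh (fv t ++ fv s) ≤ N → ∀ {V} (ρ : Envᴰ V) →
                sem ([] · ⌜ t′ N ⌝) (ext (N + 0) (ext (N + 1) ρ)) ≡ tsem (t ⟪ (b , var c) ∷ [] ⟫) (ext a (ext c ρ))
        right N le ρ = trans (sem-· [] ⌜ t′ N ⌝ η)
          (trans (tsem-⟪⟫ t ((b , var (N + 1)) ∷ (a , var (N + 0)) ∷ []) η) (trans (tsem-fv t λ {x} p → case x p)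
            (sym (tsem-⟪⟫ t ((b , var c) ∷ []) η′))))
          where
          η = ext (N + 0) (ext (N + 1) ρ)
          η′ = ext a (ext c ρ)
          case : ∀ x → x ∈ fv t → upd b (η (N + 1)) (upd a (η (N + 0)) η) x ≡ upd b (η′ c) η′ x
          case x p with x ≟ b
          ... | yes refl = trans (upd-hit x _ _) (trans (upd-miss (N + 0) _ _ (0≢1 N ∘ sym))
                  (trans (cong wk (upd-hit (N + 1) _ _))
                    (sym (trans (upd-hit x _ _) (trans (upd-miss a _ _ c≢a) (cong wk (upd-hit c _ _)))))))
          ... | no x≢b with x ≟ a
          ... | yes refl = trans (upd-miss b _ _ x≢b) (trans (upd-hit x _ _) (trans (upd-hit (N + 0) _ _)
                  (sym (trans (upd-miss b _ _ x≢b) (upd-hit x _ _)))))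
          ... | no x≢a = trans (upd-miss b _ _ x≢b) (trans (upd-miss a _ _ x≢a)
                  (trans (upd-miss (N + 0) _ _ λ { refl → ∉t N 0 le p })
                  (trans (cong wk (upd-miss (N + 1) _ _ λ { refl → ∉t N 1 le p }))
                    (sym (trans (upd-miss b _ _ x≢b) (trans (upd-miss a _ _ x≢a)
                      (cong wk (upd-miss c _ _ λ { refl → c∉t p }))))))))

      renEnv : List (Atom × Atom) → Env
      renEnv = L.map (λ (x , y) → x , var y)

      renEnv-var : ∀ x e → ∃[ y ] var x ⟪ renEnv e ⟫ ≡ var y
      renEnv-var x [] = x , refl
      renEnv-var x ((a , b) ∷ e) with x ≟ a
      ... | yes refl = b , var-hit x (var b) (renEnv e)
      ... | no x≢a with y , q ← renEnv-var x e = y , trans (var-miss (var b) (renEnv e) x≢a) q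

      renamedBody : Atom → Term → List (Atom × Atom) → Term
      renamedBody b t e = t ⟪ (b , var (fresh (fv t ++ fvEnv (renEnv e)))) ∷ renEnv e ⟫

      freshBinder : Atom → Term → List (Atom × Atom) → Atom → Term → Atom
      freshBinder b t e a s = fresh (a ∷ fv (renamedBody b t e) ++ fv s)

      SubstOf : Term → Atom → Term → Term → Set₁
      SubstOf t a s p = ∀ {V} (ρ : Envᴰ V) → tsem p ρ ≡ tsem t (upd a (tsem s ρ) ρ)

      -- Substitution renames the bound variable of an abstraction; with the renaming e the induction
      -- is nevertheless structural.
      ⊳-subst  : ∀ t e a s → ∃[ p ] (⌜ t ⟪ renEnv e ⟫ ⌝ [ a ↦ ⌜ s ⌝ ] ⊳ ⌜ p ⌝) × SubstOf (t ⟪ renEnv e ⟫) a s p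
      ⊳-subst* : ∀ {n} (ts : Vec Term n) e a s → Σ[ ps ∈ Vec Term n ]
                 Pointwise _⊳_ (V.map (_[ a ↦ ⌜ s ⌝ ]) ⌜ ts ⟪ renEnv e ⟫* ⌝*) ⌜ ps ⌝* ×
                 (∀ {V} (ρ : Envᴰ V) → sem* ⌜ ps ⌝* ρ ≡ sem* ⌜ ts ⟪ renEnv e ⟫* ⌝* (upd a (tsem s ρ) ρ))
      ⊳-subst (var x) e a s with var x ⟪ renEnv e ⟫ | renEnv-var x e
      ... | _ | y , refl with y ≟ a
      ... | yes refl = s , ⊳-σ-var y s , λ ρ → sym (upd-hit y _ _)
      ... | no y≢a   = var y , ⊳-σ-ε a y s y≢a , λ ρ → sym (upd-miss a _ _ y≢a)
      ⊳-subst (fun f t) e a s with p , r , q ← ⊳-subst t e a s =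
        fun f p , ⊳-trans (⊳-σ-fun f (t ⟪ renEnv e ⟫) a s) (⊳-plug (fun (op f) □) r) , λ ρ → cong (fun (op f)) (q ρ)
      ⊳-subst (tup ts) e a s with ps , r , q ← ⊳-subst* ts e a s =
        tup ps , ⊳-trans (⊳-σ-tup (ts ⟪ renEnv e ⟫*) a s) (⊳-tup r) , λ ρ → cong tup (q ρ)
      ⊳-subst (abs b t) e a s with ⊳-subst t ((b , freshBinder b t e a s) ∷ e) a s
      ... | p , r , q = abs c p ,
          ⊳-trans (⊳-σ-abs c₀ t₀ a s c (c∉ ∘ there ∘ ∈-++⁺ˡ) (c∉ ∘ there ∘ ∈-++⁺ʳ (fv t₀)) (c∉ ∘ here))
            -- Renaming `b` to `c₀` and then `c₀` to `c` has the same value as renaming `b` to `c`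
            -- at once, which is the form that the induction hypothesis covers.
            (⊳-plug (abs c □) (⊳-trans (⊳-≃ (Ground-⌜⌝ (t ⟪ (b , var c) ∷ renEnv e ⟫) , Ground-⌜⌝ s , tt)
               (≃-sub (eq λ ρ → cong lam (trans (tsem-⟪⟫ t₀ ((c₀ , var c) ∷ []) (ext a ρ)) (sym (rebind (ext a ρ)))))
                      ≃-refl)) r)) ,
          λ ρ → cong lam (trans (q (ext c ρ)) (trans (rebind _) (tsem-fv t₀ λ {x} → case ρ x)))
        where
        c₀ = fresh (fv t ++ fvEnv (renEnv e))
        t₀ = renamedBody b t e
        c = freshBinder b t e a s
        c∉ : c ∉ a ∷ fv t₀ ++ fv s
        c∉ = fresh-∉ (a ∷ fv t₀ ++ fv s)
        rebind : ∀ {V} (η : Envᴰ V) → tsem (t ⟪ (b , var c) ∷ renEnv e ⟫) η ≡ tsem t₀ (upd c₀ (η c) η)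
        rebind η = trans (tsem-⟪⟫var t ((b , var c) ∷ renEnv e) η) (trans (tsem-fv t λ {x} p → agree x p)
                     (sym (tsem-⟪⟫var t ((b , var c₀) ∷ renEnv e) _)))
          where
          agree : ∀ x → x ∈ fv t → tsem (var x ⟪ (b , var c) ∷ renEnv e ⟫) η ≡
                                tsem (var x ⟪ (b , var c₀) ∷ renEnv e ⟫) (upd c₀ (η c) η)
          agree x p with x ≟ b
          ... | yes refl = trans (cong (λ u → tsem u η) (var-hit x (var c) (renEnv e)))
                  (sym (trans (cong (λ u → tsem u (upd c₀ (η c) η)) (var-hit x (var c₀) (renEnv e))) (upd-hit c₀ _ _)))
          ... | no x≢b = trans (cong (λ u → tsem u η) (var-miss (var c) (renEnv e) x≢b))
                  (trans (tsem-fv (var x ⟪ renEnv e ⟫) λ {y} y∈ → sym (upd-miss c₀ _ _ λ { refl → c₀∉ y∈ }))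
                    (cong (λ u → tsem u (upd c₀ (η c) η)) (sym (var-miss (var c₀) (renEnv e) x≢b))))
            where
            c₀∉ : c₀ ∉ fv (var x ⟪ renEnv e ⟫)
            c₀∉ q with fv-var⟪⟫ x (renEnv e) q
            ... | inj₁ r = fresh-∉ (fv t ++ fvEnv (renEnv e)) (subst (_∈ fv t ++ fvEnv (renEnv e)) (sym r) (∈-++⁺ˡ p))
            ... | inj₂ r = fresh-∉ (fv t ++ fvEnv (renEnv e)) (∈-++⁺ʳ (fv t) r)
        case : ∀ {V} (ρ : Envᴰ V) z → z ∈ fv t₀ → let η = upd a (tsem s (ext c ρ)) (ext c ρ) in
               upd c₀ (η c) η z ≡ ext c₀ (upd a (tsem s ρ) ρ) z
        case ρ z z∈ with z ≟ c₀
        ... | yes refl = trans (upd-hit z _ _) (trans (upd-miss a _ _ (c∉ ∘ here)) (trans (upd-hit c _ _) (sym (upd-hit z _ _))))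
        ... | no z≢c₀ with z ≟ a
        ... | yes refl = trans (upd-miss c₀ _ _ z≢c₀) (trans (upd-hit z _ _) (trans (tsem-wk s (c∉ ∘ there ∘ ∈-++⁺ʳ (fv t₀)))
                (sym (trans (upd-miss c₀ _ _ z≢c₀) (cong wk (upd-hit z _ _))))))
        ... | no z≢a = trans (upd-miss c₀ _ _ z≢c₀) (trans (upd-miss a _ _ z≢a)
                (trans (upd-miss c _ _ λ { refl → c∉ (there (∈-++⁺ˡ z∈)) })
                  (sym (trans (upd-miss c₀ _ _ z≢c₀) (cong wk (upd-miss a _ _ z≢a))))))
      ⊳-subst* []       e a s = [] , [] , λ ρ → refl
      ⊳-subst* (t ∷ ts) e a s with ⊳-subst t e a s | ⊳-subst* ts e a s
      ... | p , r , q | ps , rs , qs = p ∷ ps , r ∷ rs , λ ρ → cong₂ _∷_ (q ρ) (qs ρ)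

      -- Even the empty substitution renames all binders, so `t ⟪ [] ⟫` and `t` are matched by value
      -- before the induction is used.
      ⊳-substitute : ∀ t a s → ∃[ p ] (⌜ t ⌝ [ a ↦ ⌜ s ⌝ ] ⊳ ⌜ p ⌝) × SubstOf t a s p
      ⊳-substitute t a s with p , r , q ← ⊳-subst t [] a s =
        p , ⊳-trans (⊳-≃ (Ground-⌜⌝ (t ⟪ [] ⟫) , Ground-⌜⌝ s , tt)
              (≃-sub (eq λ ρ → cong lam (sym (tsem-⟪⟫ t [] (ext a ρ)))) ≃-refl)) r ,
        λ ρ → trans (q ρ) (tsem-⟪⟫ t [] _)

-- The translated rule

unique-++ : ∀ (xs : List A) {ys} → Unique (xs ++ ys) → ∀ {x} → x ∈ xs → x ∉ ys
unique-++ (x ∷ xs) u (here refl) q = unique-head u (∈-++⁺ʳ xs q)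
unique-++ (x ∷ xs) u (there p)   q = unique-++ xs (unique-tail u) p q

map-zip : ∀ {C : Set} (F : A → C) (G : B → C) as bs → length as ≡ length bs →
          (∀ {a b} → (a , b) ∈ L.zip as bs → F a ≡ G b) → L.map F as ≡ L.map G bs
map-zip F G []       []       l h = refl
map-zip F G (a ∷ as) (b ∷ bs) l h = cong₂ _∷_ (h (here refl)) (map-zip F G as bs (cong (λ n → n ∸ 1) l) (h ∘ there))

zip-dom : ∀ (as : List A) (bs : List B) → length as ≡ length bs → L.map proj₁ (L.zip as bs) ≡ as
zip-dom []       []       l = refl
zip-dom (a ∷ as) (b ∷ bs) l = cong (a ∷_) (zip-dom as bs (cong (λ n → n ∸ 1) l))

zip-∈⁺ : ∀ (as : List A) (bs : List B) → length as ≡ length bs → ∀ {a} → a ∈ as → ∃[ b ] (a , b) ∈ L.zip as bs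
zip-∈⁺ (a ∷ as) (b ∷ bs) l (here refl) = b , here refl
zip-∈⁺ (a ∷ as) (b ∷ bs) l (there p) with c , q ← zip-∈⁺ as bs (cong (λ n → n ∸ 1) l) p = c , there q

extend-cases : ∀ as (ds : List A) (κ : Atom → A) x → extend (L.zip as ds) κ x ≡ κ x ⊎ extend (L.zip as ds) κ x ∈ ds
extend-cases []       ds       κ x = inj₁ refl
extend-cases (a ∷ as) []       κ x = inj₁ refl
extend-cases (a ∷ as) (d ∷ ds) κ x with x ≟ a
... | yes refl = inj₂ (here (upd-hit x d _))
... | no x≢a with extend-cases as ds κ x
... | inj₁ e = inj₁ (trans (upd-miss a d _ x≢a) e)
... | inj₂ p = inj₂ (there (subst (_∈ ds) (sym (upd-miss a d _ x≢a)) p))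

module Simulation (S : Signature) where
  open Signature S
  open Terms S public
  open Rewriting S public
  open Splitting S public

  shift : ℕ → Perm → Perm
  shift N = L.map (λ (a , b) → N + a , N + b)

  swap-shift : ∀ N a b x → swapₐ (N + a) (N + b) (N + x) ≡ N + swapₐ a b x
  swap-shift N a b x with x ≟ a
  ... | yes refl = trans (swap-left (N + x) (N + b)) (cong (N +_) (sym (swap-left x b)))
  ... | no x≢a with x ≟ b
  ... | yes refl = trans (swap-right (N + a) (N + x)) (cong (N +_) (sym (swap-right a x)))
  ... | no x≢b = trans (swap-other (x≢a ∘ +-cancelˡ-≡ N x a) (x≢b ∘ +-cancelˡ-≡ N x b))
                   (cong (N +_) (sym (swap-other x≢a x≢b)))

  shift-·ₐ : ∀ N π x → shift N π ·ₐ (N + x) ≡ N + π ·ₐ x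
  shift-·ₐ N []            x = refl
  shift-·ₐ N ((a , b) ∷ π) x = trans (cong (swapₐ (N + a) (N + b)) (shift-·ₐ N π x)) (swap-shift N a b (π ·ₐ x))

  below-≢ : ∀ {N x a} → x < N → x ≢ N + a
  below-≢ {N} {x} {a} lt e = <-irrefl e (<-≤-trans lt (m≤m+n N a))

  shift-below : ∀ {N x} π → x < N → shift N π ·ₐ x ≡ x
  shift-below []            lt = refl
  shift-below ((a , b) ∷ π) lt =
    trans (cong (swapₐ _ _) (shift-below π lt)) (swap-other (below-≢ lt) (below-≢ lt))

  graph : (Atom → Atom) → List Atom → Env
  graph h = L.map (λ x → x , var (h x))

  -- Renaming goes through `⟪_⟫`, so that it avoids capture for any `h`, injective or not; as
  -- environments are finite, `h` is tabulated on the free variables.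
  ren : (Atom → Atom) → Term → Term
  ren h t = t ⟪ graph h (fv t) ⟫

  var-graph : ∀ h xs {x} → x ∈ xs → var x ⟪ graph h xs ⟫ ≡ var (h x)
  var-graph h (y ∷ xs) {x} p with x ≟ y | p
  ... | yes refl | _         = var-hit x (var (h x)) (graph h xs)
  ... | no x≢y   | here e    = ⊥-elim (x≢y e)
  ... | no x≢y   | there q   = trans (var-miss (var (h y)) (graph h xs) x≢y) (var-graph h xs q)

  tsem-ren : ∀ h t (ρ : Envᴰ V) → tsem (ren h t) ρ ≡ tsem t (ρ ∘ h)
  tsem-ren h t ρ = trans (tsem-⟪⟫var t (graph h (fv t)) ρ)
    (tsem-fv t λ p → cong (λ u → tsem u ρ) (var-graph h (fv t) p))

  #-ren : ∀ {Δ c} h t → (∀ x → c ≢ h x) → Δ ⊢ c # ⌜ ren h t ⌝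
  #-ren {Δ} {c} h t c≢ = #-⟪⟫ t (graph h (fv t)) λ {x} p →
    subst (λ u → Δ ⊢ c # ⌜ u ⌝) (sym (var-graph h (fv t) p)) (atom (c≢ x))

  above-⊆  : ∀ bs t {o a} → o ∈ occsUnder bs t → a ∈ above o → a ∈ bs ⊎ a ∈ binders t
  above-⊆* : ∀ {n} bs (ts : Vec MetaTerm n) {o a} → o ∈ occsUnder* bs ts → a ∈ above o → a ∈ bs ⊎ a ∈ binders* ts
  above-⊆ bs (meta Z ts) (here refl) q = inj₁ q
  above-⊆ bs (meta Z ts) (there p)   q = above-⊆* bs ts p q
  above-⊆ bs (abs b t)   p q with above-⊆ (b ∷ bs) t p q
  ... | inj₁ (here r)  = inj₂ (here r)
  ... | inj₁ (there r) = inj₁ r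
  ... | inj₂ r         = inj₂ (there r)
  above-⊆ bs (fun f t)   p q = above-⊆ bs t p q
  above-⊆ bs (tup ts)    p q = above-⊆* bs ts p q
  above-⊆* bs (t ∷ ts) p q with ∈-++⁻ (occsUnder bs t) p
  above-⊆* bs (t ∷ ts) p q | inj₁ p′ with above-⊆ bs t p′ q
  ... | inj₁ r = inj₁ r
  ... | inj₂ r = inj₂ (∈-++⁺ˡ r)
  above-⊆* bs (t ∷ ts) p q | inj₂ p′ with above-⊆* bs ts p′ q
  ... | inj₁ r = inj₁ r
  ... | inj₂ r = inj₂ (∈-++⁺ʳ (binders t) r)

  above⊆binders : ∀ t {o a} → o ∈ occs t → a ∈ above o → a ∈ binders t
  above⊆binders t p q with above-⊆ [] t p q
  ... | inj₂ r = r

  length-args  : ∀ bs t {o} → o ∈ occsUnder bs t → length (args o) ≡ mvArity (mv o)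
  length-args* : ∀ {n} bs (ts : Vec MetaTerm n) {o} → o ∈ occsUnder* bs ts → length (args o) ≡ mvArity (mv o)
  length-args bs (meta Z ts) (here refl) = length-toList ts
  length-args bs (meta Z ts) (there p)   = length-args* bs ts p
  length-args bs (abs a t)   p = length-args (a ∷ bs) t p
  length-args bs (fun f t)   p = length-args bs t p
  length-args bs (tup ts)    p = length-args* bs ts p
  length-args* bs (t ∷ ts) p with ∈-++⁻ (occsUnder bs t) p
  ... | inj₁ q = length-args bs t q
  ... | inj₂ q = length-args* bs ts q

  atomic-vars : ∀ bs → L.mapMaybe atomic (L.map var bs) ≡ bs
  atomic-vars []       = refl
  atomic-vars (b ∷ bs) = cong (b ∷_) (atomic-vars bs)

  leftmost-∈ : ∀ os Z → Z ∈ L.map mv os → ∃[ o ] o ∈ os × mv o ≡ Z × leftmost os Z ≡ L.mapMaybe atomic (args o)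
  leftmost-∈ (o ∷ os) Z p with mv o ≟ Z
  ... | yes e rewrite dec-true (mv o ≟ Z) e = o , here refl , e , refl
  ... | no ≢Z rewrite dec-false (mv o ≟ Z) ≢Z with p
  ... | here e = ⊥-elim (≢Z (sym e))
  ... | there q with o′ , r , e , e′ ← leftmost-∈ os Z q = o′ , there r , e , e′

  -- Values of the translated sides of the rule

  module Rule (l r : MetaTerm) (isRule : IsRule l r) (barendregt : Barendregt l r) (σ : Valuation) where
    open IsRule isRule
    open Interpretation σ

    record Pattern (Z : Var) : Set where
      field
        unique  : Unique (Φ l Z)
        binders⊇ : ∀ {a} → a ∈ Φ l Z → a ∈ binders l
        length≡ : length (Φ l Z) ≡ mvArity Z

    linear : ∀ {o} → o ∈ occs l → Linear o
    linear = All.lookup patternˡ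

    patternOf : ∀ {Z} → Z ∈ mvs true l → Pattern Z
    patternOf {Z} p with leftmost-∈ (occs l) Z (subst (Z ∈_) (sym (mvs-occs [] l)) p)
    ... | o , o∈ , refl , e with linear o∈
    ... | bs , args≡ , u , bs⊆ = record
      { unique = subst Unique (sym Φ≡) u
      ; binders⊇ = λ {a} q → above⊆binders l o∈ (All.lookup bs⊆ (subst (a ∈_) Φ≡ q))
      ; length≡ = trans (cong length Φ≡) (trans (sym (length-map var bs))
                    (trans (cong length (sym args≡)) (length-args [] l o∈))) }
      where
      Φ≡ : Φ l Z ≡ bs
      Φ≡ = trans e (trans (cong (L.mapMaybe atomic) args≡) (atomic-vars bs))

    -- The atoms of `Φ l Z` are binders of `l`, and Barendregt's convention keeps these apart from
    -- the binders of `r`.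
    Φ-∉ : ∀ {Z a} → Z ∈ mvs true l → a ∈ binders r → a ∉ Φ l Z
    Φ-∉ p q a∈ = unique-++ (binders l) barendregt (Pattern.binders⊇ (patternOf p) a∈) q

    app-≗ : ∀ Z {κ κ′ : Envᴰ V} ds → κ ≗ κ′ → app Z κ ds ≡ app Z κ′ ds
    app-≗ Z ds e = sem-cong ⌜ body (σ Z) ⌝ (extend-cong (L.zip (toList (params (σ Z))) ds) e)

    interp*-vars : ∀ {n} (ts : Vec MetaTerm n) cs → toList ts ≡ L.map var cs → (κ ρ : Envᴰ V) →
                   interp* ts κ ρ ≡ L.map ρ cs
    interp*-vars []       []       e κ ρ = refl
    interp*-vars (t ∷ ts) (c ∷ cs) e κ ρ with ∷-injective e
    ... | refl , e′ = cong (ρ c ∷_) (interp*-vars ts cs e′ κ ρ)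

    -- Explicit substitutions are carried out, and susp π Z has the value of Z applied to π · Φ(Z). Other
    -- uses of sub have a junk value.
    vsem  : NTerm → Envᴰ V → Envᴰ V → DB (NSym Sym) V
    vsem* : ∀ {n} → Vec NTerm n → Envᴰ V → Envᴰ V → List (DB (NSym Sym) V)
    vsem (atom a)     κ ρ = ρ a
    vsem (susp π Z)   κ ρ = app Z κ (L.map (ρ ∘ (π ·ₐ_)) (Φ l Z))
    vsem (abs a t)    κ ρ = lam (vsem t (wk ∘ κ) (ext a ρ))
    vsem (fun (op f) t) κ ρ = fun (op f) (vsem t κ ρ)
    vsem (fun sub (tup (abs a t ∷ s ∷ []))) κ ρ = vsem t κ (upd a (vsem s κ ρ) ρ)
    vsem (fun sub _)  κ ρ = tup []
    vsem (tup ts)     κ ρ = tup (vsem* ts κ ρ)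
    vsem* []       κ ρ = []
    vsem* (t ∷ ts) κ ρ = vsem t κ ρ ∷ vsem* ts κ ρ

    -- The atoms are in scope of bs, and sub is only used for explicit substitutions.
    data Simple (bs : List Atom) : NTerm → Set where
      atom : ∀ {a} → a ∈ bs → Simple bs (atom a)
      susp : ∀ {π Z} → (∀ {a} → a ∈ Φ l Z → π ·ₐ a ∈ bs) → Simple bs (susp π Z)
      abs  : ∀ {a t} → Simple (a ∷ bs) t → Simple bs (abs a t)
      fun  : ∀ {f t} → Simple bs t → Simple bs (fun (op f) t)
      sub  : ∀ {a t s} → Simple (a ∷ bs) t → Simple bs s → Simple bs (t [ a ↦ s ])
      tup  : ∀ {n} {ts : Vec NTerm n} → VAll.All (Simple bs) ts → Simple bs (tup ts)

    weaken-∷ : ∀ {bs cs : List Atom} {a} → (∀ {x} → x ∈ bs → x ∈ cs) → ∀ {x} → x ∈ a ∷ bs → x ∈ a ∷ cs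
    weaken-∷ s (here e)  = here e
    weaken-∷ s (there p) = there (s p)

    weaken  : ∀ {bs cs t} → (∀ {x} → x ∈ bs → x ∈ cs) → Simple bs t → Simple cs t
    weaken* : ∀ {bs cs n} {ts : Vec NTerm n} → (∀ {x} → x ∈ bs → x ∈ cs) →
              VAll.All (Simple bs) ts → VAll.All (Simple cs) ts
    weaken s (atom p)  = atom (s p)
    weaken s (susp p)  = susp (s ∘ p)
    weaken s (abs p)   = abs (weaken (weaken-∷ s) p)
    weaken s (fun p)   = fun (weaken s p)
    weaken s (sub p q) = sub (weaken (weaken-∷ s) p) (weaken s q)
    weaken s (tup ps)  = tup (weaken* s ps)
    weaken* s []       = []
    weaken* s (p ∷ ps) = weaken s p ∷ weaken* s ps

    vsem-cong  : ∀ {bs t} → Simple bs t → {κ κ′ ρ ρ′ : Envᴰ V} → κ ≗ κ′ → ρ ≗ ρ′ → vsem t κ ρ ≡ vsem t κ′ ρ′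
    vsem*-cong : ∀ {bs n} {ts : Vec NTerm n} → VAll.All (Simple bs) ts → {κ κ′ ρ ρ′ : Envᴰ V} → κ ≗ κ′ → ρ ≗ ρ′ →
                 vsem* ts κ ρ ≡ vsem* ts κ′ ρ′
    vsem-cong (atom _) e e′ = e′ _
    vsem-cong (susp {π} {Z} _) {κ = κ} e e′ =
      trans (cong (app Z κ) (map-cong (λ a → e′ (π ·ₐ a)) (Φ l Z))) (app-≗ Z _ e)
    vsem-cong (abs p)   e e′ = cong lam (vsem-cong p (cong wk ∘ e) (ext-cong e′))
    vsem-cong (fun {f} p) e e′ = cong (fun (op f)) (vsem-cong p e e′)
    vsem-cong (sub p q) e e′ = vsem-cong p e (upd-cong (vsem-cong q e e′) e′)
    vsem-cong (tup ps)  e e′ = cong tup (vsem*-cong ps e e′)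
    vsem*-cong []       e e′ = refl
    vsem*-cong (p ∷ ps) e e′ = cong₂ _∷_ (vsem-cong p e e′) (vsem*-cong ps e e′)

    substs : NTerm → List (Atom × NTerm) → NTerm
    substs = L.foldl (λ s (a , t) → s [ a ↦ t ])

    Simple-substs : ∀ {bs} s ρs → Simple (dom ρs ++ bs) s → (∀ {a t} → (a , t) ∈ ρs → Simple bs t) →
                    Simple bs (substs s ρs)
    Simple-substs s []             p h = p
    Simple-substs s ((a , t) ∷ ρs) p h =
      Simple-substs (s [ a ↦ t ]) ρs (sub p (weaken (∈-++⁺ʳ (dom ρs)) (h (here refl)))) (h ∘ there)

    -- The last substitution of ρs is the outermost one.
    senv : List (Atom × NTerm) → Envᴰ V → Envᴰ V → Envᴰ V
    senv []             κ ρ = ρ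
    senv ((a , t) ∷ ρs) κ ρ = upd a (vsem t κ (senv ρs κ ρ)) (senv ρs κ ρ)

    vsem-substs : ∀ s ρs (κ ρ : Envᴰ V) → vsem (substs s ρs) κ ρ ≡ vsem s κ (senv ρs κ ρ)
    vsem-substs s []             κ ρ = refl
    vsem-substs s ((a , t) ∷ ρs) κ ρ = vsem-substs (s [ a ↦ t ]) ρs κ ρ

    Stable : List Atom → NTerm → Set₁
    Stable as t = ∀ {V} (κ : Envᴰ V) {ρ ρ′ : Envᴰ V} → (∀ {x} → x ∉ as → ρ x ≡ ρ′ x) → vsem t κ ρ ≡ vsem t κ ρ′

    senv-off : ∀ as ρs → (∀ {a t} → (a , t) ∈ ρs → a ∈ as) → (κ ρ : Envᴰ V) → ∀ {x} → x ∉ as → senv ρs κ ρ x ≡ ρ x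
    senv-off as []             h κ ρ x∉ = refl
    senv-off as ((a , t) ∷ ρs) h κ ρ x∉ =
      trans (upd-miss a _ _ (λ { refl → x∉ (h (here refl)) })) (senv-off as ρs (h ∘ there) κ ρ x∉)

    -- Where sequential and simultaneous substitution meet: the substitutions further out change
    -- values at atoms of `as` only, and the substituted terms are stable under such changes. Each
    -- of them may thus be evaluated in the original `ρ`.
    senv-lookup : ∀ as ρs → (∀ {a t} → (a , t) ∈ ρs → a ∈ as × Stable as t) → (κ ρ : Envᴰ V) → ∀ x →
                  senv ρs κ ρ x ≡ vsem (apply ρs x) κ ρ
    senv-lookup as []             h κ ρ x = refl
    senv-lookup as ((a , t) ∷ ρs) h κ ρ x with x ≟ a
    ... | yes refl = trans (upd-hit x _ _)
            (trans (proj₂ (h (here refl)) κ (senv-off as ρs (proj₁ ∘ h ∘ there) κ ρ))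
                   (cong (λ m → vsem (fromMaybe (atom x) m) κ ρ) (sym (lookup-hit x t ρs))))
    ... | no x≢a = trans (upd-miss a _ _ x≢a) (trans (senv-lookup as ρs (h ∘ there) κ ρ x)
                     (cong (λ m → vsem (fromMaybe (atom x) m) κ ρ) (sym (lookup-miss t ρs x≢a))))

    substs-atom : ∀ s ρs {b} → substs s ρs ≡ atom b → s ≡ atom b
    substs-atom s []             e = e
    substs-atom s ((a , t) ∷ ρs) e with () ← substs-atom (s [ a ↦ t ]) ρs e

    right-atom : ∀ t {b} → ⟨ t ⟩[ l ] ≡ atom b → t ≡ var b
    right-atom (var a)     refl = refl
    right-atom (meta Z ts) e with () ← substs-atom (susp (proj₁ (split [] (L.zip (Φ l Z) (toList ⟨ ts ⟩*[ l ]))))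
                                         Z) (proj₂ (split [] (L.zip (Φ l Z) (toList ⟨ ts ⟩*[ l ])))) e

    -- The invariant of the recursion into `r`: as `r` is closed, an atom free in a part of it is
    -- bound further up in `r`.
    record Within (fvs bs : List Atom) (Zs : List Var) : Set where
      field
        fvs⊆ : ∀ {a} → a ∈ fvs → a ∈ binders r
        bs⊆  : ∀ {a} → a ∈ bs → a ∈ binders r
        Zs⊆  : ∀ {Z} → Z ∈ Zs → Z ∈ mvs true l

    Withinᵗ : MetaTerm → Set
    Withinᵗ t = Within (fv t) (binders t) (mvs true t)

    Within* : ∀ {n} → Vec MetaTerm n → Set
    Within* ts = Within (fv* ts) (binders* ts) (mvs* true ts)

    within-abs : ∀ a t → Withinᵗ (abs a t) → Withinᵗ t
    within-abs a t w = record { fvs⊆ = fvs⊆′ ; bs⊆ = W.bs⊆ ∘ there ; Zs⊆ = W.Zs⊆ }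
      where
      module W = Within w
      fvs⊆′ : ∀ {x} → x ∈ fv t → x ∈ binders r
      fvs⊆′ {x} p with x ≟ a
      ... | yes refl = W.bs⊆ (here refl)
      ... | no x≢a   = W.fvs⊆ (fv-abs⁺ t p x≢a)

    within-head : ∀ {n} t (ts : Vec MetaTerm n) → Within* (t ∷ ts) → Withinᵗ t
    within-head t ts w = record { fvs⊆ = W.fvs⊆ ∘ ∈-++⁺ˡ ; bs⊆ = W.bs⊆ ∘ ∈-++⁺ˡ ; Zs⊆ = W.Zs⊆ ∘ ∈-++⁺ˡ }
      where module W = Within w

    within-tail : ∀ {n} t (ts : Vec MetaTerm n) → Within* (t ∷ ts) → Within* ts
    within-tail t ts w = record
      { fvs⊆ = W.fvs⊆ ∘ ∈-++⁺ʳ (fv t) ; bs⊆ = W.bs⊆ ∘ ∈-++⁺ʳ (binders t) ; Zs⊆ = W.Zs⊆ ∘ ∈-++⁺ʳ (mvs true t) }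
      where module W = Within w

    within-args : ∀ Z ts → Withinᵗ (meta Z ts) → Within* ts
    within-args Z ts w = record { fvs⊆ = W.fvs⊆ ; bs⊆ = W.bs⊆ ; Zs⊆ = W.Zs⊆ ∘ there }
      where module W = Within w

    right-∈ : ∀ {n} (ts : Vec MetaTerm n) {u} → u ∈ toList ⟨ ts ⟩*[ l ] → ∃[ t ] t ∈ toList ts × u ≡ ⟨ t ⟩[ l ]
    right-∈ (t ∷ ts) (here refl) = t , here refl , refl
    right-∈ (t ∷ ts) (there p) with t′ , q , e ← right-∈ ts p = t′ , there q , e

    fv-∈ : ∀ {n} (ts : Vec MetaTerm n) {t a} → t ∈ toList ts → a ∈ fv t → a ∈ fv* ts
    fv-∈ (t ∷ ts) (here refl) q = ∈-++⁺ˡ q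
    fv-∈ (t ∷ ts) (there p)   q = ∈-++⁺ʳ (fv t) (fv-∈ ts p q)

    module MetaApp (Z : Var) (ts : Vec MetaTerm (mvArity Z)) (w : Withinᵗ (meta Z ts)) where
      open Within w

      Z∈ : Z ∈ mvs true l
      Z∈ = Zs⊆ (here refl)

      us : List NTerm
      us = toList ⟨ ts ⟩*[ l ]

      ps ρs : List (Atom × NTerm)
      ps = L.zip (Φ l Z) us
      ρs = proj₂ (split [] ps)

      π : Perm
      π = proj₁ (split [] ps)

      open Pattern (patternOf Z∈)

      same-length : length (Φ l Z) ≡ length us
      same-length = trans length≡ (sym (length-toList ⟨ ts ⟩*[ l ]))

      argument : ∀ {a u} → (a , u) ∈ ps → ∃[ t ] t ∈ toList ts × u ≡ ⟨ t ⟩[ l ]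
      argument p = right-∈ ts (proj₂ (zip-∈ (Φ l Z) us p))

      argument-atom : ∀ {a u b} → (a , u) ∈ ps → u ≡ atom b → b ∈ fv* ts
      argument-atom {b = b} p e with t , t∈ , e′ ← argument p =
        fv-∈ ts t∈ (subst (λ t → b ∈ fv t) (sym (right-atom t (trans (sym e′) e))) (here refl))

      admissible : Admissible (Φ l Z) ps
      admissible p = proj₁ (zip-∈ (Φ l Z) us p) , λ e → Φ-∉ Z∈ (fvs⊆ (argument-atom p e))

      images : ∀ {a u} → (a , u) ∈ ps → apply ρs (π ·ₐ a) ≡ u
      images = split-correct (Φ l Z) (split-graph [] ps) admissible
                 (subst Unique (sym (zip-dom (Φ l Z) us same-length)) unique)

      ρs⊆ps : ∀ {p} → p ∈ ρs → p ∈ ps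
      ρs⊆ps = split-⊆ (split-graph [] ps)

      -- If no substitution catches the image of `a`, then by `images` this image is itself the
      -- argument at `a`, hence an atom free in `ts`.
      scoped : ∀ {bs a} → (∀ {x} → x ∈ fv* ts → x ∈ bs) → a ∈ Φ l Z → π ·ₐ a ∈ dom ρs ++ bs
      scoped {a = a} fv⊆ p with π ·ₐ a ∈? dom ρs
      ... | yes q = ∈-++⁺ˡ q
      ... | no ∉ρs with u , q ← zip-∈⁺ (Φ l Z) us same-length p =
        ∈-++⁺ʳ (dom ρs) (fv⊆ (argument-atom q
          (trans (sym (images q)) (cong (fromMaybe (atom (π ·ₐ a))) (lookup-∉dom ρs ∉ρs)))))

    Simple-right  : ∀ t bs → Withinᵗ t → (∀ {a} → a ∈ fv t → a ∈ bs) → Simple bs ⟨ t ⟩[ l ]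
    Simple-right* : ∀ {n} (ts : Vec MetaTerm n) bs → Within* ts → (∀ {a} → a ∈ fv* ts → a ∈ bs) →
                    VAll.All (Simple bs) ⟨ ts ⟩*[ l ]
    Simple-∈      : ∀ {n} (ts : Vec MetaTerm n) bs → Within* ts → (∀ {a} → a ∈ fv* ts → a ∈ bs) →
                    ∀ {u} → u ∈ toList ⟨ ts ⟩*[ l ] → Simple bs u
    Simple-right (var a)     bs w fv⊆ = atom (fv⊆ (here refl))
    Simple-right (meta Z ts) bs w fv⊆ = Simple-substs (susp π Z) ρs (susp (scoped fv⊆))
      λ p → Simple-∈ ts bs (within-args Z ts w) fv⊆ (proj₂ (zip-∈ (Φ l Z) us (ρs⊆ps p)))
      where open MetaApp Z ts w
    Simple-right (abs a t)   bs w fv⊆ = abs (Simple-right t (a ∷ bs) (within-abs a t w) fv⊆′)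
      where
      fv⊆′ : ∀ {x} → x ∈ fv t → x ∈ a ∷ bs
      fv⊆′ {x} p with x ≟ a
      ... | yes refl = here refl
      ... | no x≢a   = there (fv⊆ (fv-abs⁺ t p x≢a))
    Simple-right (fun f t)   bs w fv⊆ = fun (Simple-right t bs w fv⊆)
    Simple-right (tup ts)    bs w fv⊆ = tup (Simple-right* ts bs w fv⊆)
    Simple-right* []       bs w fv⊆ = []
    Simple-right* (t ∷ ts) bs w fv⊆ =
      Simple-right t bs (within-head t ts w) (fv⊆ ∘ ∈-++⁺ˡ) ∷ Simple-right* ts bs (within-tail t ts w) (fv⊆ ∘ ∈-++⁺ʳ (fv t))
    Simple-∈ (t ∷ ts) bs w fv⊆ (here refl) = Simple-right t bs (within-head t ts w) (fv⊆ ∘ ∈-++⁺ˡ)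
    Simple-∈ (t ∷ ts) bs w fv⊆ (there p)   = Simple-∈ ts bs (within-tail t ts w) (fv⊆ ∘ ∈-++⁺ʳ (fv t)) p

    map-vsem : ∀ {n} (us : Vec NTerm n) (κ ρ : Envᴰ V) → L.map (λ u → vsem u κ ρ) (toList us) ≡ vsem* us κ ρ
    map-vsem []       κ ρ = refl
    map-vsem (u ∷ us) κ ρ = cong (vsem u κ ρ ∷_) (map-vsem us κ ρ)

    vsem-right  : ∀ t → Withinᵗ t → (κ ρ : Envᴰ V) → vsem ⟨ t ⟩[ l ] κ ρ ≡ interp t κ ρ
    vsem-right* : ∀ {n} (ts : Vec MetaTerm n) → Within* ts → (κ ρ : Envᴰ V) → vsem* ⟨ ts ⟩*[ l ] κ ρ ≡ interp* ts κ ρ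
    vsem-∈      : ∀ {n} (ts : Vec MetaTerm n) → Within* ts → ∀ {t} → t ∈ toList ts →
                  (κ ρ : Envᴰ V) → vsem ⟨ t ⟩[ l ] κ ρ ≡ interp t κ ρ
    vsem-right (var a)     w κ ρ = refl
    vsem-right (abs a t)   w κ ρ = cong lam (vsem-right t (within-abs a t w) (wk ∘ κ) (ext a ρ))
    vsem-right (fun f t)   w κ ρ = cong (fun (op f)) (vsem-right t w κ ρ)
    vsem-right (tup ts)    w κ ρ = cong tup (vsem-right* ts w κ ρ)
    vsem-right (meta Z ts) w κ ρ = trans (vsem-substs (susp π Z) ρs κ ρ)
      (cong (app Z κ) (trans (map-zip _ (λ u → vsem u κ ρ) (Φ l Z) us same-length value)
        (trans (map-vsem ⟨ ts ⟩*[ l ] κ ρ) (vsem-right* ts (within-args Z ts w) κ ρ))))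
      where
      open MetaApp Z ts w
      -- By induction an argument has the value of a meta-term whose free atoms are bound in `r`,
      -- and so are outside `Φ l Z`.
      stable : ∀ {a u} → (a , u) ∈ ps → Stable (Φ l Z) u
      stable p κ {ρ} {ρ′} e with t , t∈ , refl ← argument p =
        trans (vsem-∈ ts (within-args Z ts w) t∈ κ ρ)
          (trans (interp-fv t (λ q → e (Φ-∉ Z∈ (Within.fvs⊆ w (fv-∈ ts t∈ q)))))
            (sym (vsem-∈ ts (within-args Z ts w) t∈ κ ρ′)))
      value : ∀ {a u} → (a , u) ∈ ps → senv ρs κ ρ (π ·ₐ a) ≡ vsem u κ ρ
      value {a} p = trans
        (senv-lookup (Φ l Z) ρs (λ q → proj₁ (admissible (ρs⊆ps q)) , stable (ρs⊆ps q)) κ ρ (π ·ₐ a))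
        (cong (λ u → vsem u κ ρ) (images p))
    vsem-right* []       w κ ρ = refl
    vsem-right* (t ∷ ts) w κ ρ = cong₂ _∷_ (vsem-right t (within-head t ts w) κ ρ) (vsem-right* ts (within-tail t ts w) κ ρ)
    vsem-∈ (t ∷ ts) w (here refl) = vsem-right t (within-head t ts w)
    vsem-∈ (t ∷ ts) w (there p)   = vsem-∈ ts (within-tail t ts w) p

    mvs-r⊆l : ∀ {Z} → Z ∈ mvs true r → Z ∈ mvs true l
    mvs-r⊆l {Z} p = subst (Z ∈_) (mvs-occs [] l) (metaVars⊆ Z (subst (Z ∈_) (sym (mvs-occs [] r)) p))

    within-r : Withinᵗ r
    within-r = record { fvs⊆ = λ p → ⊥-elim (closedʳ _ p) ; bs⊆ = id ; Zs⊆ = mvs-r⊆l }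

    Simple-rhs : Simple [] ⟨ r ⟩[ l ]
    Simple-rhs = Simple-right r [] within-r λ p → ⊥-elim (closedʳ _ p)

    -- The atoms of the rule are shifted by N ≥ B, and hence apart from those of the valuation, which
    -- are renamed by g.
    module Instance (g : Atom → Atom) (B : ℕ) (g< : ∀ x → g x < B) where

      h : ℕ → Var → Atom → Atom
      h N Z = extend (L.zip (toList (params (σ Z))) (L.map (N +_) (Φ l Z))) g

      θ : ℕ → Subst
      θ N Z = ⌜ ren (h N Z) (body (σ Z)) ⌝

      -- The shifted permutation moves no atom below `N`, hence no value of `g`; on the copies of
      -- `Φ l Z` it acts as `π`.
      sem-susp : ∀ {N} → B ≤ N → ∀ π Z (η : Envᴰ V) →
                 sem (shift N π · θ N Z) η ≡ app Z (η ∘ g) (L.map (λ a → η (N + π ·ₐ a)) (Φ l Z))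
      sem-susp {N = N} le π Z η =
        trans (sem-· (shift N π) (θ N Z) η) (trans (tsem-ren (h N Z) (body (σ Z)) η′)
          (sem-cong ⌜ body (σ Z) ⌝ λ x → trans (∘-extend η′ as (L.map (N +_) (Φ l Z)) g x)
            (trans (cong (λ ds → extend (L.zip as ds) (η′ ∘ g) x)
                     (trans (sym (map-∘ (Φ l Z))) (map-cong (λ a → cong η (shift-·ₐ N π a)) (Φ l Z))))
                   (extend-cong (L.zip as _) (λ y → cong η (shift-below π (<-≤-trans (g< y) le))) x))))
        where
        η′ = η ∘ (shift N π ·ₐ_)
        as = toList (params (σ Z))

      g-ext : ∀ {N} → B ≤ N → ∀ {a} {d : A} {η : Atom → A} → upd (N + a) d η ∘ g ≗ η ∘ g
      g-ext le {a} {d} {η} x = upd-miss _ d η (below-≢ (<-≤-trans (g< x) le))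

      shift-ext : ∀ {N a} {d : A} {η : Atom → A} → upd (N + a) d η ∘ (N +_) ≗ upd a d (η ∘ (N +_))
      shift-ext {N = N} {a} {d} {η} = upd-∘ (N +_) a d η (+-cancelˡ-≡ N _ _)

      -- One environment `η` yields both environments of `interp`: names from the valuation are read
      -- through `g`, atoms of the rule through the shift. As `g` stays below `N`, entering a copied
      -- binder merely weakens the first reading.
      sem-left  : ∀ {N} → B ≤ N → ∀ bs t → (∀ {o} → o ∈ occsUnder bs t → o ∈ occs l) → (η : Envᴰ V) →
                  sem (inst N (θ N) (leftTerm l t)) η ≡ interp t (η ∘ g) (η ∘ (N +_))
      sem-left* : ∀ {N} → B ≤ N → ∀ {n} bs (ts : Vec MetaTerm n) → (∀ {o} → o ∈ occsUnder* bs ts → o ∈ occs l) →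
                  (η : Envᴰ V) →
                  sem* (rename* (N +_) id (leftTerm* l ts) ⟦ θ N ⟧*) η ≡ interp* ts (η ∘ g) (η ∘ (N +_))
      sem-left le bs (var a)     h η = refl
      sem-left {N = N} le bs (meta Z ts) h η with linear (h (here refl))
      ... | cs , args≡ , u , _ = trans (sem-susp le (Ψ (Φ l Z) (L.mapMaybe atomic (toList ts))) Z η)
          (cong (app Z (η ∘ g)) (trans (map-∘ (Φ l Z)) (trans
            (cong (L.map (η ∘ (N +_))) (trans (cong (λ bs → L.map (Ψ (Φ l Z) bs ·ₐ_) (Φ l Z)) args≡cs)
              (Ψ-correct (Φ l Z) cs unique u len)))
            (sym (interp*-vars ts cs args≡ (η ∘ g) (η ∘ (N +_)))))))
        where
        open Pattern (patternOf (subst (Z ∈_) (mvs-occs [] l) (∈-map⁺ mv (h (here refl)))))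
        args≡cs : L.mapMaybe atomic (toList ts) ≡ cs
        args≡cs = trans (cong (L.mapMaybe atomic) args≡) (atomic-vars cs)
        len : length (Φ l Z) ≡ length cs
        len = trans length≡ (trans (sym (length-toList ts)) (trans (cong length args≡) (length-map var cs)))
      sem-left {N = N} le bs (abs a t) h η = cong lam (trans (sem-left le (a ∷ bs) t h (ext (N + a) η))
        (interp-cong t (g-ext le) shift-ext))
      sem-left le bs (fun f t)   h η = cong (fun (op f)) (sem-left le bs t h η)
      sem-left le bs (tup ts)    h η = cong tup (sem-left* le bs ts h η)
      sem-left* le bs []       h η = refl
      sem-left* le bs (t ∷ ts) h η =
        cong₂ _∷_ (sem-left le bs t (h ∘ ∈-++⁺ˡ) η) (sem-left* le bs ts (h ∘ ∈-++⁺ʳ (occsUnder bs t)) η)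

      -- `Root` requires one reduct for all large `N`. At the root `bs` is empty, so every copied
      -- atom is bound and the size of the shift leaves no trace in the value.
      inst-unique  : ∀ {N M} → B ≤ N → B ≤ M → ∀ {bs t} → Simple bs t → ∀ {η η′ : Envᴰ V} →
                     (∀ {a} → a ∈ bs → η (N + a) ≡ η′ (M + a)) → (∀ x → η (g x) ≡ η′ (g x)) →
                     sem (inst N (θ N) t) η ≡ sem (inst M (θ M) t) η′
      inst-unique* : ∀ {N M} → B ≤ N → B ≤ M → ∀ {bs n} {ts : Vec NTerm n} → VAll.All (Simple bs) ts →
                     ∀ {η η′ : Envᴰ V} →
                     (∀ {a} → a ∈ bs → η (N + a) ≡ η′ (M + a)) → (∀ x → η (g x) ≡ η′ (g x)) →
                     sem* (rename* (N +_) id ts ⟦ θ N ⟧*) η ≡ sem* (rename* (M +_) id ts ⟦ θ M ⟧*) η′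
      inst-unique-abs : ∀ {N M} → B ≤ N → B ≤ M → ∀ {bs a t} → Simple (a ∷ bs) t → ∀ {η η′ : Envᴰ V} →
                     (∀ {a} → a ∈ bs → η (N + a) ≡ η′ (M + a)) → (∀ x → η (g x) ≡ η′ (g x)) →
                     sem (inst N (θ N) (abs a t)) η ≡ sem (inst M (θ M) (abs a t)) η′
      inst-unique le le′ (atom p)   e e′ = e p
      inst-unique le le′ (susp {π} {Z} p) {η} {η′} e e′ = trans (sem-susp le π Z η) (trans
        (trans (cong (app Z (η ∘ g)) (map-cong-local (All.tabulate (e ∘ p)))) (app-≗ Z _ e′))
        (sym (sem-susp le′ π Z η′)))
      inst-unique le le′ (abs p)    e e′ = inst-unique-abs le le′ p e e′
      inst-unique le le′ (fun {f} p) e e′ = cong (fun (op f)) (inst-unique le le′ p e e′)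
      inst-unique le le′ (sub p q)  e e′ =
        cong₂ (λ x y → fun sub (tup (x ∷ y ∷ []))) (inst-unique-abs le le′ p e e′) (inst-unique le le′ q e e′)
      inst-unique le le′ (tup ps)   e e′ = cong tup (inst-unique* le le′ ps e e′)
      inst-unique* le le′ []       e e′ = refl
      inst-unique* le le′ (p ∷ ps) e e′ = cong₂ _∷_ (inst-unique le le′ p e e′) (inst-unique* le le′ ps e e′)
      inst-unique-abs {N = N} {M} le le′ {bs} {a} p {η} {η′} e e′ = cong lam (inst-unique le le′ p scope
        (λ x → trans (g-ext le x) (trans (cong wk (e′ x)) (sym (g-ext le′ x)))))
        where
        scope : ∀ {x} → x ∈ a ∷ bs → ext (N + a) η (N + x) ≡ ext (M + a) η′ (M + x)
        scope {x} q with x ≟ a | q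
        ... | yes refl | _       = trans (upd-hit _ _ _) (sym (upd-hit _ _ _))
        ... | no x≢a   | here r  = ⊥-elim (x≢a r)
        ... | no x≢a   | there r = trans (upd-miss _ _ _ (x≢a ∘ +-cancelˡ-≡ N x a))
                (trans (cong wk (e r)) (sym (upd-miss _ _ _ (x≢a ∘ +-cancelˡ-≡ M x a))))

      #-θ : ∀ {N Δ b Z} → B ≤ N → b ∉ Φ l Z → Δ ⊢ N + b # θ N Z
      #-θ {N} {b = b} {Z} le b∉ = #-ren (h N Z) (body (σ Z)) ≢h
        where
        ≢h : ∀ x → N + b ≢ h N Z x
        ≢h x e with extend-cases (toList (params (σ Z))) (L.map (N +_) (Φ l Z)) g x
        ... | inj₁ e′ = below-≢ (<-≤-trans (g< x) le) (sym (trans e e′))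
        ... | inj₂ p with c , q , e′ ← ∈-map⁻ (N +_) p =
          b∉ (subst (_∈ Φ l Z) (sym (+-cancelˡ-≡ N b c (trans e e′))) q)

      occ-mvs : ∀ t {o} → o ∈ occs t → mv o ∈ mvs true t
      occ-mvs t p = subst (_ ∈_) (mvs-occs [] t) (∈-map⁺ mv p)

      -- A shifted atom `N + b` can be free in `θ N Z` only as the image of a parameter, that is,
      -- for `b` in `Φ l Z`. The constraints from `l` exclude such `b` by definition, those from `r`
      -- by `Φ-∉`.
      ∇θ : ∀ {N} → B ≤ N → ∀ {Δ} → All (λ (a , X) → Δ ⊢ N + a # θ N X) (∇ (𝓒ᴿ l r))
      ∇θ le = AllP.++⁺
        (AllP.concat⁺ (AllP.map⁺ {xs = occs l} (All.tabulate λ {o} o∈ → AllP.map⁺ (All.tabulate λ {b} b∈ →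
          #-θ le (proj₂ (∈-filter⁻ (λ b → ¬? (b ∈? Φ l (mv o))) {xs = above o} b∈))))))
        (AllP.concat⁺ (AllP.map⁺ {xs = occs r} (All.tabulate λ {o} o∈ → AllP.map⁺ (All.tabulate λ {a} a∈ →
          #-θ le (Φ-∉ (mvs-r⊆l (occ-mvs r o∈)) (above⊆binders r o∈ a∈))))))

      -- Evaluating the instantiated right-hand side

      module Evaluate (𝓡 : NRule → Set) (σ∈ : ∀ {R} → ExplicitSubst R → 𝓡 R) where
        open Reduction 𝓡
        open ExplicitSubstitution σ∈

        record Value (t : NTerm) (t′ : Term) : Set₁ where
          field
            reduces : inst B (θ B) t ⊳ ⌜ t′ ⌝
            sem≡    : ∀ {V} (η : Envᴰ V) → tsem t′ η ≡ vsem t (η ∘ g) (η ∘ (B +_))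

        ⊳-[↦] : ∀ {s s′ t t′} a → t ⊳ t′ → s ⊳ s′ → (t [ a ↦ s ]) ⊳ (t′ [ a ↦ s′ ])
        ⊳-[↦] {s} {t′ = t′} a p q = ⊳-trans
          (⊳-plug (fun sub (tup [] (abs a □) (s ∷ []))) p) (⊳-plug (fun sub (tup (abs a t′ ∷ []) □ [])) q)

        evaluate  : ∀ {bs t} → Simple bs t → ∃[ t′ ] Value t t′
        evaluate* : ∀ {bs n} {ts : Vec NTerm n} → VAll.All (Simple bs) ts → Σ[ ts′ ∈ Vec Term n ]
                    Pointwise _⊳_ (rename* (B +_) id ts ⟦ θ B ⟧*) ⌜ ts′ ⌝* ×
                    (∀ {V} (η : Envᴰ V) → sem* ⌜ ts′ ⌝* η ≡ vsem* ts (η ∘ g) (η ∘ (B +_)))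
        evaluate (atom {a} _) = var (B + a) , record { reduces = ⊳-refl ; sem≡ = λ η → refl }
        evaluate (susp {π} {Z} _) = t′ , record
          { reduces = ⊳-≃ (Ground-⌜⌝ t′) (eq λ η → sym (same η))
          ; sem≡ = λ η → trans (same η) (sem-susp ≤-refl π Z η) }
          where
          t = ren (h B Z) (body (σ Z))
          -- A permuted ground term is not literally the image of a CRS term; the renaming by the
          -- same permutation is, and has the same value.
          t′ = ren (shift B π ·ₐ_) t
          same : ∀ {V} (η : Envᴰ V) → tsem t′ η ≡ sem (shift B π · ⌜ t ⌝) η
          same η = trans (tsem-ren (shift B π ·ₐ_) t η) (sym (sem-· (shift B π) ⌜ t ⌝ η))
        evaluate (abs {a} p) with t′ , v ← evaluate p = abs (B + a) t′ , record
          { reduces = ⊳-plug (abs (B + a) □) (Value.reduces v)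
          ; sem≡ = λ η → cong lam (trans (Value.sem≡ v (ext (B + a) η)) (vsem-cong p (g-ext ≤-refl) shift-ext)) }
        evaluate (fun {f} p) with t′ , v ← evaluate p = fun f t′ , record
          { reduces = ⊳-plug (fun (op f) □) (Value.reduces v) ; sem≡ = λ η → cong (fun (op f)) (Value.sem≡ v η) }
        evaluate (sub {a} p q) with t′ , v ← evaluate p | s′ , w ← evaluate q
          with t″ , r , e ← ⊳-substitute t′ (B + a) s′ = t″ , record
          { reduces = ⊳-trans (⊳-[↦] (B + a) (Value.reduces v) (Value.reduces w)) r
          ; sem≡ = λ η → trans (e η) (trans (Value.sem≡ v (upd (B + a) (tsem s′ η) η))
              (vsem-cong p (g-ext ≤-refl) (λ x → trans (shift-ext x) (upd-cong (Value.sem≡ w η) (λ _ → refl) x)))) }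
        evaluate (tup ps) with ts′ , rs , es ← evaluate* ps = tup ts′ , record
          { reduces = ⊳-tup rs ; sem≡ = λ η → cong tup (es η) }
        evaluate* []       = [] , [] , λ η → refl
        evaluate* (p ∷ ps) with t′ , v ← evaluate p | ts′ , rs , es ← evaluate* ps =
          t′ ∷ ts′ , Value.reduces v ∷ rs , λ η → cong₂ _∷_ (Value.sem≡ v η) (es η)

-- Assembling the simulation

module Main (S : Signature) where
  open Signature S
  open Simulation S

  ⌜_⌝ᶜ : Context → NContext
  ⌜ □ ⌝ᶜ           = □
  ⌜ abs a C ⌝ᶜ     = abs a ⌜ C ⌝ᶜ
  ⌜ fun f C ⌝ᶜ     = fun (op f) ⌜ C ⌝ᶜ
  ⌜ tup ss C ts ⌝ᶜ = tup ⌜ ss ⌝* ⌜ C ⌝ᶜ ⌜ ts ⌝*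

  ⌜⌝*-++ : ∀ {m n} (ss : Vec Term m) (ts : Vec Term n) → ⌜ ss V.++ ts ⌝* ≡ ⌜ ss ⌝* V.++ ⌜ ts ⌝*
  ⌜⌝*-++ []       ts = refl
  ⌜⌝*-++ (s ∷ ss) ts = cong (⌜ s ⌝ ∷_) (⌜⌝*-++ ss ts)

  ⌜⌝-plug : ∀ C t → ⌜ plug C t ⌝ ≡ plugₙ ⌜ C ⌝ᶜ ⌜ t ⌝
  ⌜⌝-plug □             t = refl
  ⌜⌝-plug (abs a C)     t = cong (abs a) (⌜⌝-plug C t)
  ⌜⌝-plug (fun f C)     t = cong (fun (op f)) (⌜⌝-plug C t)
  ⌜⌝-plug (tup ss C ts) t =
    cong tup (trans (⌜⌝*-++ ss _) (cong (λ u → ⌜ ss ⌝* V.++ u ∷ ⌜ ts ⌝*) (⌜⌝-plug C t)))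

  module _ {l r : MetaTerm} (isRule : IsRule l r) (barendregt : Barendregt l r)
           {u v : Term} (rewrites : Rewrites l r u v) where
    open IsRule isRule
    open Rewrites rewrites hiding (barendregt)
    open Interpretation σ
    module R = Rule l r isRule barendregt σ

    𝓡 : NRule → Set
    𝓡 = ｛ 𝓒ᴿ l r ｝ ∪ ExplicitSubst

    open Reduction 𝓡

    tˡ tʳ : Term
    tˡ = l′ [ σ ]
    tʳ = r′ [ σ ]

    l⊆l′ : ∀ {Z} → Z ∈ mvs true l → Z ∈ metaVars l′
    l⊆l′ {Z} = subst (Z ∈_) (trans (mvs-≈ true l≈) (sym (mvs-occs [] l′)))

    -- The CRS step instantiates the renamed copy `l′`, for which the valuation is safe, while the
    -- translation is made from `l`; `interp` does not distinguish the two.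
    tsem-tˡ : (ρ : Envᴰ V) → tsem tˡ ρ ≡ interp l ρ ρ
    tsem-tˡ ρ = trans (interp-[] l′ (λ _ _ → refl)
      (λ {Z} {x} p q x∈ → Safe.rule safe Z (subst (Z ∈_) (sym (mvs-occs [] l′)) p) x q (∈-++⁺ˡ x∈)))
      (sym (interp-≈ l≈))

    tsem-tʳ : (ρ : Envᴰ V) → tsem tʳ ρ ≡ interp r ρ ρ
    tsem-tʳ ρ = trans (interp-[] r′ (λ _ _ → refl)
      (λ {Z} {x} p q x∈ → Safe.rule safe Z (l⊆l′ (R.mvs-r⊆l (subst (Z ∈_) (sym (mvs-≈ true r≈)) p))) x q
                            (∈-++⁺ʳ (binders l′) x∈)))
      (sym (interp-≈ r≈))

    fvₛ⊆tˡ : ∀ {Z x} → Z ∈ mvs true l → x ∈ fvₛ (σ Z) → x ∈ fv tˡ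
    fvₛ⊆tˡ {Z} {x} p q = fv-[] l′ (subst (Z ∈_) (mvs-≈ false l≈) (mvs-linear [] l R.linear p)) q
      (λ x∈ → Safe.rule safe Z (l⊆l′ p) x q (∈-++⁺ˡ x∈))

    interp-closed : ∀ t → Closed t → (∀ {Z} → Z ∈ mvs true t → Z ∈ mvs true l) → {κ κ′ ρ ρ′ : Envᴰ V} →
                    (∀ {Z x} → Z ∈ mvs true l → x ∈ fvₛ (σ Z) → κ x ≡ κ′ x) → interp t κ ρ ≡ interp t κ′ ρ′
    interp-closed t closed ⊆l e = trans (interp-κ t (e ∘ ⊆l)) (interp-fv t (λ p → ⊥-elim (closed _ p)))

    -- As `r` is closed, its instance sees of the environment only the free variables of
    -- substitutes, and all of these occur free in the redex.
    dependsOn : DependsOn ⌜ tˡ ⌝ ⌜ tʳ ⌝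
    dependsOn {ρ = ρ} {η} agree = trans (tsem-tʳ ρ) (trans (interp-closed r closedʳ R.mvs-r⊆l same) (sym (tsem-tʳ η)))
      where
      same : ∀ {Z x} → Z ∈ mvs true l → x ∈ fvₛ (σ Z) → ρ x ≡ η x
      same {x = x} p q with agree x
      ... | inj₁ x# = ⊥-elim (∉fv-# tˡ x# (fvₛ⊆tˡ p q))
      ... | inj₂ e  = e

    D : Decomposition ⌜ C ⌝ᶜ ⌜ tˡ ⌝ ⌜ u ⌝ id var
    D = decompose ⌜ C ⌝ᶜ ⌜ tˡ ⌝ ⌜ u ⌝ id var IsRen-var Inj-var
          (subst Ground (⌜⌝-plug C tˡ) (Ground-⌜⌝ (plug C tˡ))) (Ground-⌜⌝ u)
          (trans (tsem-≈ u≈ var) (cong (λ t → sem t var) (⌜⌝-plug C tˡ)))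
    module D = Decomposition D

    support : List Atom
    support = L.concatMap (λ Z → fvₛ (σ Z)) (mvs true l)

    support⁺ : ∀ {Z x} → Z ∈ mvs true l → x ∈ fvₛ (σ Z) → x ∈ support
    support⁺ p q = ∈-concat⁺′ q (∈-map⁺ (λ Z → fvₛ (σ Z)) p)

    -- D.g, bounded so that its values are apart from the shifted atoms of the rule.
    g : Atom → Atom
    g x = if does (x ∈? support) then D.g x else 0

    g≡ : ∀ {Z x} → Z ∈ mvs true l → x ∈ fvₛ (σ Z) → g x ≡ D.g x
    g≡ {x = x} p q rewrite dec-true (x ∈? support) (support⁺ p q) = refl

    N₀ : ℕ
    -- The entry `0` accounts for the default value of `g` outside `support`.
    N₀ = fresh (0 ∷ L.map D.g support)

    g< : ∀ x → g x < N₀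
    g< x with x ∈? support
    ... | yes p = fresh-> (0 ∷ L.map D.g support) (there (∈-map⁺ D.g p))
    ... | no _  = fresh-> (0 ∷ L.map D.g support) (here refl)

    open R.Instance g N₀ g<
    open Evaluate 𝓡 inj₂

    grounds : Groundᶜ D.C′ × Ground D.u′
    grounds = Ground-plug⁻ D.C′ (subst Ground D.u≡ (Ground-⌜⌝ u))

    θ-ground : ∀ {N} Z → Ground (θ N Z)
    θ-ground {N} Z = Ground-⌜⌝ (ren (h N Z) (body (σ Z)))

    rootStep : Root (𝓒ᴿ l r) D.u′ (inst N₀ (θ N₀) ⟨ r ⟩[ l ])
    rootStep = record
      { bound = N₀ ; θ = θ ; θ-ground = λ N → θ-ground ; ∇θ = ∇θ
      ; l≈ = λ {N} le → sem-complete (inst N (θ N) (leftTerm l l)) D.u′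
          (Ground-⟦⟧ (rename (N +_) id (leftTerm l l)) θ-ground)
          (proj₂ grounds) D.ren D.inj
          (trans (sem-left le [] l id D.η′) (trans (interp-closed l closedˡ id (λ p q → cong D.η′ (g≡ p q)))
            (trans (sym (tsem-tˡ (D.η′ ∘ D.g))) (sym D.u′≡))))
      ; r≃ = λ {N} le → eq λ ρ → inst-unique le ≤-refl R.Simple-rhs (λ ()) (λ _ → refl) }

    simulation : [] ⊢ ⌜ u ⌝ ─[ 𝓡 ]→ᶜ⁺ ⌜ v ⌝
    simulation with t′ , value ← evaluate R.Simple-rhs = ⇝⁺⇒closed (⇝⁺-resp
      -- The rule step, made inside the context found in `u`, is the nonempty reduction that `⊳`
      -- extends. The last step of the whole is then redirected to `v`, whose value agrees by
      -- `D.plug≡`.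
      (Value.reduces value D.C′ Plus.[ record
        { R∈ = inj₁ refl ; C = D.C′ ; s≡ = D.u≡ ; root = rootStep ; C-ground = (proj₁ grounds)
        ; t-ground = Ground-plug⁺ D.C′ (proj₁ grounds) (Ground-⟦⟧ (rename (N₀ +_) id ⟨ r ⟩[ l ]) θ-ground)
        ; t≡ = refl } ])
      (Ground-⌜⌝ v)
      (trans (D.plug≡ {⌜ tʳ ⌝} {⌜ t′ ⌝} dependsOn same)
        (trans (cong (λ t → sem t var) (sym (⌜⌝-plug C tʳ))) (sym (tsem-≈ v≈ var)))))
      where
      same : tsem t′ D.η′ ≡ tsem tʳ (D.η′ ∘ D.g)
      same = trans (Value.sem≡ value D.η′) (trans (R.vsem-right r R.within-r _ _)
        (trans (interp-closed r closedʳ R.mvs-r⊆l (λ p q → cong D.η′ (g≡ p q))) (sym (tsem-tʳ (D.η′ ∘ D.g)))))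

mainTheorem3 : (S : Signature) → let open Translation S in
    (l r : MetaTerm) → IsRule l r → Barendregt l r →
    (u v : Term) → Rewrites l r u v →
    [] ⊢ ⌜ u ⌝ ─[ ｛ 𝓒ᴿ l r ｝ ∪ ExplicitSubst ]→ᶜ⁺ ⌜ v ⌝
mainTheorem3 S l r isRule barendregt u v rewrites = Main.simulation S isRule barendregt rewrites
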